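{- There are absolute constants $0<\epsilon_0<1/200$, $\alpha>0$ and $\beta>0$ such that the following holds. Let $r>0$, $c$, $n$ be integers with $c<(n\log n)/2$. If there is an $r$-round deterministic protocol with $c$-bit messages for $\mathrm{EE}_n$ that has $\epsilon_0$ error on $\nu_n$, then there is an $(r-1)$-round deterministic protocol with $O(c)$-bit messages (messages of at most $\alpha c$ bits) for $\mathrm{EE}_{n'}$ that has $\epsilon_0$ error on $\nu_{n'}$, where $n'=\Omega\big(n/2^{\frac{5c}{4n}}\big)$ (i.e. $n'\ge\beta\, n/2^{\frac{5c}{4n}}$).
   Context: All logarithms are to base 2; $[t]=\{1,\dots,t\}$. In the exists-equal problem $\mathrm{EE}_n$ (parameters $n$ and $t=4n$) Alice receives $x\in[t]^n$ and Bob receives $y\in[t]^n$; the value $\mathrm{EE}(x,y)$ is $1$ if there is $i\in[n]$ with $x_i=y_i$, and $0$ otherwise. $\nu_n$ is the uniform distribution on $[t]^n\times[t]^n$ with $t=4n$. In an $r$-round protocol the players take at most $r$ turns alternately sending each other a message, and the last player to receive a message declares the output. In a $0$-round protocol no message is sent and the output is decided by a single player from his own input. A deterministic protocol $Q$ has $\epsilon$ error on a distribution $\nu$ if $\Pr_{(x,y)\sim\nu}[Q(x,y)\ne\mathrm{EE}(x,y)]\le\epsilon$. The paper ignores divisibility/rounding issues throughout. -}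

module Defs where

open import Data.Bool using (Bool)
import Data.Bool.Properties as Bool
open import Data.Fin using (Fin)
import Data.Fin.Properties as Fin
open import Data.Integer using (+_)
open import Data.List using (List; []; _∷_; [_]; _++_; map; length; filter; allFin; cartesianProduct; cartesianProductWith)
open import Data.List.Properties using (length-++; length-map; length-tabulate)
open import Data.Nat using (ℕ; zero; suc; _+_; _*_; _^_; _<_; NonZero)
open import Data.Nat.Properties using (m^n≢0; m*n≢0)
open import Data.Product using (_×_; _,_)
open import Data.Rational as ℚ using (ℚ)
open import Data.Vec using (Vec; []; _∷_; lookup)
open import Function using (id)
open import Level using (Level)
open import Relation.Binary.PropositionalEquality using (_≡_; _≢_; refl; sym; trans; cong; cong₂; subst)
open import Relation.Nullary.Decidable using (does; ¬?)
open import Relation.Unary using (Pred; Decidable)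

private
  variable
    a b d p : Level
    A : Set a
    B : Set b
    D : Set d

Input : ℕ → Set
Input n = Vec (Fin (4 * n)) n

EE : ∀ {n} → Input n → Input n → Bool
EE x y = does (Fin.any? λ i → lookup x i Fin.≟ lookup y i)

-- A protocol tree seen from the player about to act, who is the last receiver
-- as soon as anything has been sent.  That player either declares the output
-- or sends a c-bit message, after which the roles are exchanged.  The
-- constructor is determined by the transcript, so both players know when the
-- protocol stops.  `output` is available for every r: at most r turns are taken.
data Tree (n c : ℕ) : ℕ → Set where
  output : ∀ {r} → (Input n → Bool) → Tree n c r
  send   : ∀ {r} → (Input n → Vec Bool c) → (Vec Bool c → Tree n c r) → Tree n c (suc r)

runTree : ∀ {n c r} → Tree n c r → (own other : Input n) → Bool
runTree (output f)    own other = f own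
runTree (send msg k)  own other = runTree (k (msg own)) other own

data Player : Set where
  alice bob : Player

record Protocol (n r c : ℕ) : Set where
  constructor protocol
  field
    first : Player
    tree  : Tree n c r

run : ∀ {n r c} → Protocol n r c → Input n → Input n → Bool
run (protocol alice T) x y = runTree T x y
run (protocol bob   T) x y = runTree T y x

words : (t n : ℕ) → List (Vec (Fin t) n)
words t zero    = [ [] ]
words t (suc n) = cartesianProductWith _∷_ (allFin t) (words t n)

-- Uniform distributions are given by their duplicate-free supports.
ν : (n : ℕ) → List (Input n × Input n)
ν n = cartesianProduct (words (4 * n) n) (words (4 * n) n)

length-cartesianProductWith : (f : A → B → D) (xs : List A) (ys : List B) →
  length (cartesianProductWith f xs ys) ≡ length xs * length ys
length-cartesianProductWith f []       ys = refl
length-cartesianProductWith f (x ∷ xs) ys =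
  trans (length-++ (map (f x) ys))
        (cong₂ _+_ (length-map (f x) ys) (length-cartesianProductWith f xs ys))

length-words : ∀ t n → length (words t n) ≡ t ^ n
length-words t zero    = refl
length-words t (suc n) =
  trans (length-cartesianProductWith _∷_ (allFin t) (words t n))
        (cong₂ _*_ (length-tabulate {n = t} id) (length-words t n))

length-ν : ∀ n → length (ν n) ≡ (4 * n) ^ n * (4 * n) ^ n
length-ν n =
  trans (length-cartesianProductWith _,_ (words (4 * n) n) (words (4 * n) n))
        (cong₂ _*_ (length-words (4 * n) n) (length-words (4 * n) n))

ν-nonEmpty : ∀ n → NonZero (length (ν n))
ν-nonEmpty zero      = _
ν-nonEmpty n@(suc _) = subst NonZero (sym (length-ν n)) (m*n≢0 N N {{N≢0}} {{N≢0}})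
  where
  N   = (4 * n) ^ n
  N≢0 = m^n≢0 (4 * n) n

Pr : {P : Pred A p} (xs : List A) → .{{NonZero (length xs)}} → Decidable P → ℚ
Pr xs P? = + length (filter P? xs) ℚ./ length xs

wrong? : ∀ {n r c} (Q : Protocol n r c) →
  Decidable {A = Input n × Input n} (λ (x , y) → run Q x y ≢ EE x y)
wrong? Q (x , y) = ¬? (run Q x y Bool.≟ EE x y)

error : ∀ {n r c} → Protocol n r c → ℚ
error {n} Q = Pr (ν n) {{ν-nonEmpty n}} (wrong? Q)

fromℕ : ℕ → ℚ
fromℕ n = + n ℚ./ 1

open import Algebra.Definitions.RawSemiring ℚ.+-*-rawSemiring public
  using () renaming (_^_ to _^ℚ_)

-- c < (n log₂ n) / 2, i.e. 2c < log₂ (nⁿ), exponentiated.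
-- At n = 0 it fails for every c, since 0 ^ 0 = 1.
_<½nlog_ : ℕ → ℕ → Set
c <½nlog n = 2 ^ (2 * c) < n ^ n

-- n′ ≥ β n / 2^(5c/4n) for n > 0 and β ≥ 0, raised to the power 4n.
SizeBound : (β : ℚ) (n c n′ : ℕ) → Set
SizeBound β n c n′ =
  (β ℚ.* fromℕ n) ^ℚ (4 * n) ℚ.≤ (fromℕ n′ ^ℚ (4 * n)) ℚ.* fromℕ (2 ^ (5 * c))

{-# OPTIONS --safe #-}

-- Fix a message of the first player that is sent on a set S of density at least 2^-(c+1) and on
-- which the error is at most 2ε.  To solve an instance (u, v) of EE_m, every coordinate i of [n]
-- draws a random j in [m] and a random φ : [4m] → [4n], and proposes z = φ(u_j) and y = φ(v_j).
-- The holder of u samples x ∈ S uniformly, coordinate by coordinate, each time keeping z with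
-- probability τ w(z), where w is the conditional density given the prefix, provided w(z) ≤ M.
-- The densities along x telescope to the reciprocal of the density of S, so a constant fraction
-- of them is at most M, and a match u_j = v_j makes x and y agree somewhere with high probability.
-- Given a match, the law of (x, y) has a density D with bounded second moment relative to the
-- uniform law on S × [4n]^n, so the old error stays small; without a match it is that uniform law.
-- Several matches are reduced to one by discarding coordinates at random, at one rate for each
-- possible number of matches, and a constant number of independent runs restores the error ε.
-- If β n ≤ 2^(5c/4n), then n is bounded: for r = 1 no protocol with so small an error exists, and
-- for r > 1 four bits settle EE_1.
module Submission where

open import Defs
open import Data.Integer using (+_)
open import Data.Nat using (ℕ; _∸_; _>_)
open import Data.Product using (_×_; ∃-syntax)
open import Data.Rational using (ℚ; 0ℚ; _<_; _≤_; _*_; _/_)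

open import Algebra.Bundles using (CommutativeMonoid; CommutativeRing)
open import Data.Bool using (Bool; true; false; if_then_else_; _∧_; _∨_; not)
import Data.Bool.Properties as Bool
open import Data.Empty using (⊥; ⊥-elim)
open import Data.Fin using (Fin; zero; suc)
import Data.Fin.Properties as Fin
import Data.Integer as ℤ
import Data.Integer.Properties as ℤ
open import Data.List as List using (List; []; _∷_; _++_; length; filter; tabulate; cartesianProductWith)
open import Data.Nat as ℕ using (zero; suc)
import Data.Nat.Properties as ℕ
open import Data.Product using (_,_; proj₁; proj₂)
open import Data.Rational using (1ℚ; ½; _+_; _-_; -_; 1/_; positive; nonNegative; ≢-nonZero; toℚᵘ)
open import Data.Rational.Properties
open import Data.Rational.Unnormalised as ℚᵘ using (mkℚᵘ; *≡*)
import Data.Rational.Unnormalised.Properties as ℚᵘ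
open import Data.Sum as Sum using (_⊎_; inj₁; inj₂)
open import Data.Unit using (⊤; tt)
open import Data.Vec as Vec using (Vec; []; _∷_; lookup)
open import Data.Vec.Properties using (lookup∘tabulate)
open import Function using (_∘_)
open import Relation.Binary.PropositionalEquality
open import Relation.Nullary using (Dec; yes; no; ¬_; contradiction; does)
open import Relation.Nullary.Decidable using (True; toWitness; toWitnessFalse; dec⇒maybe; ¬?)
open import Relation.Unary using (Pred; Decidable)
open import Tactic.RingSolver using (solve-∀)
open import Tactic.RingSolver.Core.AlmostCommutativeRing using (AlmostCommutativeRing; fromCommutativeRing)
open import Algebra.Properties.CommutativeSemiring.Exp (CommutativeRing.commutativeSemiring +-*-commutativeRing)
  using (^-homo-*; ^-assocʳ; ^-distrib-*)
open import Algebra.Properties.CommutativeSemigroup (CommutativeMonoid.commutativeSemigroup *-1-commutativeMonoid)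
  using (x∙yz≈y∙xz)
open import Algebra.Properties.Semiring.Sum (CommutativeRing.semiring +-*-commutativeRing)
  using (sum; ∑-distrib-+; *-distribˡ-sum; sum-cong-≗; sum-replicate-zero)
open ≤-Reasoning

-- The exponent 5/4 comes from asking for one fifth of the coordinates. If more than four fifths of
-- the densities along x exceeded M, then M^(4n/5) would be at most 2^(c+1) times a factor
-- contributed by good coordinates of tiny density, and the mean of that factor over S is at most
-- 2^n. So M of order 2^(5c/4n) is enough. With one match, each good coordinate makes x and y agree
-- with chance 75/n, and this fixes m at the order of n/M. The obstacle is that forcing agreement
-- distorts the law of (x, y). The density of a coordinate pair is near 1 off the diagonal and a
-- constant on it; as t = 4n, the diagonal has mass 1/(4n), and the second moments multiply to (1 +
-- O(1/n))^n. With k matches the distortion would grow with k, hence one discarding rate for each k.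
-- The reduction itself only reaches constant error. Amplification by a constant factor, independent
-- of n and c, returns to ε, and that factor becomes α. The bound on c gives 2^(5c/4n) ≤ n^(5/8), so
-- only bounded n can leave no room for a nontrivial m. All of this stays in ℚ: Bernoulli's
-- inequality takes the place of exponentials, and powers clear fractional exponents.

ℚ-ring : AlmostCommutativeRing _ _
ℚ-ring = fromCommutativeRing +-*-commutativeRing (λ x → dec⇒maybe (0ℚ ≟ x))

-- Ordered-field arithmetic and powers in ℚ

1≡[1-a]+a : ∀ a → 1ℚ ≡ (1ℚ - a) + a
1≡[1-a]+a = solve-∀ ℚ-ring

1-[1-a]≡a : ∀ a → 1ℚ - (1ℚ - a) ≡ a
1-[1-a]≡a = solve-∀ ℚ-ring

<⇒≱ : ∀ {a b} → a < b → b ≤ a → ⊥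
<⇒≱ a<b b≤a = <-irrefl refl (<-≤-trans a<b b≤a)

≤-by : ∀ {a b} e → b ≡ a + e → 0ℚ ≤ e → a ≤ b
≤-by {a} {b} e b≡a+e 0≤e = begin
  a       ≡⟨ +-identityʳ a ⟨
  a + 0ℚ  ≤⟨ +-monoʳ-≤ a 0≤e ⟩
  a + e   ≡⟨ b≡a+e ⟨
  b       ∎

0≤-⇒≤ : ∀ {a b} → 0ℚ ≤ b - a → a ≤ b
0≤-⇒≤ {a} {b} = ≤-by (b - a) (eq a b)
  where
  eq : ∀ a b → b ≡ a + (b - a)
  eq = solve-∀ ℚ-ring

≤⇒0≤- : ∀ {a b} → a ≤ b → 0ℚ ≤ b - a
≤⇒0≤- {a} {b} a≤b = begin
  0ℚ     ≡⟨ +-inverseʳ a ⟨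
  a - a  ≤⟨ +-monoˡ-≤ (- a) a≤b ⟩
  b - a  ∎

0≤+ : ∀ {a b} → 0ℚ ≤ a → 0ℚ ≤ b → 0ℚ ≤ a + b
0≤+ = +-mono-≤

*-monoˡ : ∀ {c a b} → 0ℚ ≤ c → a ≤ b → c * a ≤ c * b
*-monoˡ {c} 0≤c = *-monoˡ-≤-nonNeg c {{nonNegative 0≤c}}

*-monoʳ : ∀ {c a b} → 0ℚ ≤ c → a ≤ b → a * c ≤ b * c
*-monoʳ {c} 0≤c = *-monoʳ-≤-nonNeg c {{nonNegative 0≤c}}

0≤* : ∀ {a b} → 0ℚ ≤ a → 0ℚ ≤ b → 0ℚ ≤ a * b
0≤* {a} {b} 0≤a 0≤b = subst (_≤ a * b) (*-zeroʳ a) (*-monoˡ 0≤a 0≤b)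

*-mono : ∀ {a b c d} → 0ℚ ≤ a → 0ℚ ≤ d → a ≤ b → c ≤ d → a * c ≤ b * d
*-mono 0≤a 0≤d a≤b c≤d = ≤-trans (*-monoˡ 0≤a c≤d) (*-monoʳ 0≤d a≤b)

0<* : ∀ {a b} → 0ℚ < a → 0ℚ < b → 0ℚ < a * b
0<* {a} {b} 0<a 0<b = subst (_< a * b) (*-zeroʳ a) (*-monoʳ-<-pos a {{positive 0<a}} 0<b)

*-cancelˡ : ∀ {c a b} → 0ℚ < c → c * a ≤ c * b → a ≤ b
*-cancelˡ {c} 0<c = *-cancelˡ-≤-pos c {{positive 0<c}}

*-cancelˡ-≡ : ∀ {c a b} → 0ℚ < c → c * a ≡ c * b → a ≡ b
*-cancelˡ-≡ 0<c eq = ≤-antisym (*-cancelˡ 0<c (≤-reflexive eq)) (*-cancelˡ 0<c (≤-reflexive (sym eq)))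

0≤1 : 0ℚ ≤ 1ℚ
0≤1 = nonNegative⁻¹ 1ℚ

0<1 : 0ℚ < 1ℚ
0<1 = positive⁻¹ 1ℚ

infix 9 _⁻¹

-- Junk value 0ℚ ⁻¹ = 0ℚ.
_⁻¹ : ℚ → ℚ
q ⁻¹ with q ≟ 0ℚ
... | yes _  = 0ℚ
... | no q≢0 = (1/ q) {{≢-nonZero q≢0}}

*-⁻¹ : ∀ {q} → 0ℚ < q → q * q ⁻¹ ≡ 1ℚ
*-⁻¹ {q} 0<q with q ≟ 0ℚ
... | yes q≡0 = contradiction (sym q≡0) (<⇒≢ 0<q)
... | no q≢0  = *-inverseʳ q {{≢-nonZero q≢0}}

0≤⁻¹ : ∀ {q} → 0ℚ ≤ q → 0ℚ ≤ q ⁻¹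
0≤⁻¹ {q} 0≤q with q ≟ 0ℚ
... | yes _  = ≤-refl
... | no q≢0 = <⇒≤ (positive⁻¹ _ {{1/pos⇒pos q {{nonNeg∧nonZero⇒pos q {{nonNegative 0≤q}} {{≢-nonZero q≢0}}}}}})

0<⁻¹ : ∀ {q} → 0ℚ < q → 0ℚ < q ⁻¹
0<⁻¹ {q} 0<q = ≰⇒> λ q⁻¹≤0 → <⇒≱ 0<1 (begin
  1ℚ        ≡⟨ *-⁻¹ 0<q ⟨
  q * q ⁻¹  ≤⟨ *-monoˡ (<⇒≤ 0<q) q⁻¹≤0 ⟩
  q * 0ℚ    ≡⟨ *-zeroʳ q ⟩
  0ℚ        ∎)

toℚᵘ-fromℕ : ∀ n → toℚᵘ (fromℕ n) ℚᵘ.≃ mkℚᵘ (+ n) 0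
toℚᵘ-fromℕ n = toℚᵘ-fromℚᵘ (mkℚᵘ (+ n) 0)

fromℕ-+ : ∀ m n → fromℕ (m ℕ.+ n) ≡ fromℕ m + fromℕ n
fromℕ-+ m n = toℚᵘ-injective (ℚᵘ.≃-trans (toℚᵘ-fromℕ (m ℕ.+ n)) (ℚᵘ.≃-trans (*≡* eq)
  (ℚᵘ.≃-sym (ℚᵘ.≃-trans (toℚᵘ-homo-+ (fromℕ m) (fromℕ n)) (ℚᵘ.+-cong (toℚᵘ-fromℕ m) (toℚᵘ-fromℕ n))))))
  where
  eq : + (m ℕ.+ n) ℤ.* + 1 ≡ (+ m ℤ.* + 1 ℤ.+ + n ℤ.* + 1) ℤ.* + 1
  eq = cong (ℤ._* + 1) (cong₂ ℤ._+_ (sym (ℤ.*-identityʳ (+ m))) (sym (ℤ.*-identityʳ (+ n))))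

fromℕ-* : ∀ m n → fromℕ (m ℕ.* n) ≡ fromℕ m * fromℕ n
fromℕ-* m n = toℚᵘ-injective (ℚᵘ.≃-trans (toℚᵘ-fromℕ (m ℕ.* n)) (ℚᵘ.≃-trans (*≡* eq)
  (ℚᵘ.≃-sym (ℚᵘ.≃-trans (toℚᵘ-homo-* (fromℕ m) (fromℕ n)) (ℚᵘ.*-cong (toℚᵘ-fromℕ m) (toℚᵘ-fromℕ n))))))
  where
  eq : + (m ℕ.* n) ℤ.* + 1 ≡ (+ m ℤ.* + n) ℤ.* + 1
  eq = cong (ℤ._* + 1) (ℤ.pos-* m n)

fromℕ-^ : ∀ m n → fromℕ (m ℕ.^ n) ≡ fromℕ m ^ℚ n
fromℕ-^ m zero    = refl
fromℕ-^ m (suc n) = trans (fromℕ-* m (m ℕ.^ n)) (cong (fromℕ m *_) (fromℕ-^ m n))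

0≤fromℕ : ∀ n → 0ℚ ≤ fromℕ n
0≤fromℕ n = nonNegative⁻¹ (fromℕ n) {{normalize-nonNeg n 1}}

fromℕ-mono : ∀ {m n} → m ℕ.≤ n → fromℕ m ≤ fromℕ n
fromℕ-mono {m} {n} m≤n = ≤-by (fromℕ (n ℕ.∸ m))
  (trans (cong fromℕ (sym (ℕ.m+[n∸m]≡n m≤n))) (fromℕ-+ m (n ℕ.∸ m))) (0≤fromℕ (n ℕ.∸ m))

fromℕ-suc : ∀ n → fromℕ (suc n) ≡ 1ℚ + fromℕ n
fromℕ-suc = fromℕ-+ 1

0<fromℕ : ∀ n .{{_ : ℕ.NonZero n}} → 0ℚ < fromℕ n
0<fromℕ (suc n) = <-≤-trans 0<1 (≤-by (fromℕ n) (fromℕ-suc n) (0≤fromℕ n))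

/-* : ∀ m n .{{_ : ℕ.NonZero n}} → (+ m / n) * fromℕ n ≡ fromℕ m
/-* m (suc n) = toℚᵘ-injective (ℚᵘ.≃-trans (toℚᵘ-homo-* (+ m / suc n) (fromℕ (suc n)))
  (ℚᵘ.≃-trans (ℚᵘ.*-cong (toℚᵘ-fromℚᵘ (mkℚᵘ (+ m) n)) (toℚᵘ-fromℕ (suc n)))
  (ℚᵘ.≃-trans (*≡* eq) (ℚᵘ.≃-sym (toℚᵘ-fromℕ m)))))
  where
  eq : (+ m ℤ.* + suc n) ℤ.* + 1 ≡ + m ℤ.* + (suc n ℕ.* 1)
  eq = trans (ℤ.*-identityʳ _) (cong (λ k → + m ℤ.* + k) (sym (ℕ.*-identityʳ (suc n))))

0≤^ : ∀ {a} n → 0ℚ ≤ a → 0ℚ ≤ a ^ℚ n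
0≤^ zero    0≤a = 0≤1
0≤^ (suc n) 0≤a = 0≤* 0≤a (0≤^ n 0≤a)

0<^ : ∀ {a} n → 0ℚ < a → 0ℚ < a ^ℚ n
0<^ zero    0<a = 0<1
0<^ (suc n) 0<a = 0<* 0<a (0<^ n 0<a)

^-mono : ∀ {a b} n → 0ℚ ≤ a → a ≤ b → a ^ℚ n ≤ b ^ℚ n
^-mono zero    0≤a a≤b = ≤-refl
^-mono (suc n) 0≤a a≤b = *-mono 0≤a (0≤^ n (≤-trans 0≤a a≤b)) a≤b (^-mono n 0≤a a≤b)

^-mono-< : ∀ {a b} n .{{_ : ℕ.NonZero n}} → 0ℚ ≤ a → a < b → a ^ℚ n < b ^ℚ n
^-mono-< {a} {b} (suc n) 0≤a a<b = begin-strict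
  a * a ^ℚ n  ≤⟨ *-monoˡ 0≤a (^-mono n 0≤a (<⇒≤ a<b)) ⟩
  a * b ^ℚ n  <⟨ *-monoˡ-<-pos (b ^ℚ n) {{positive (0<^ n (≤-<-trans 0≤a a<b))}} a<b ⟩
  b * b ^ℚ n  ∎

^-cancel-≤ : ∀ {a b} n .{{_ : ℕ.NonZero n}} → 0ℚ ≤ b → a ^ℚ n ≤ b ^ℚ n → a ≤ b
^-cancel-≤ n 0≤b p = ≮⇒≥ λ b<a → <⇒≱ (^-mono-< n 0≤b b<a) p

1≤^ : ∀ {a} n → 1ℚ ≤ a → 1ℚ ≤ a ^ℚ n
1≤^ zero    1≤a = ≤-refl
1≤^ (suc n) 1≤a = *-mono 0≤1 (0≤^ n (≤-trans 0≤1 1≤a)) 1≤a (1≤^ n 1≤a)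

^-mono-exp : ∀ {a m n} → 1ℚ ≤ a → m ℕ.≤ n → a ^ℚ m ≤ a ^ℚ n
^-mono-exp {n = n} 1≤a ℕ.z≤n     = 1≤^ n 1≤a
^-mono-exp         1≤a (ℕ.s≤s p) = *-monoˡ (≤-trans 0≤1 1≤a) (^-mono-exp 1≤a p)

1^ : ∀ n → 1ℚ ^ℚ n ≡ 1ℚ
1^ zero    = refl
1^ (suc n) = trans (*-identityˡ _) (1^ n)

^≤1 : ∀ {a} n → 0ℚ ≤ a → a ≤ 1ℚ → a ^ℚ n ≤ 1ℚ
^≤1 {a} n 0≤a a≤1 = subst (a ^ℚ n ≤_) (1^ n) (^-mono n 0≤a a≤1)

0≤sq : ∀ s → 0ℚ ≤ s * s
0≤sq s with ≤-total 0ℚ s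
... | inj₁ 0≤s = 0≤* 0≤s 0≤s
... | inj₂ s≤0 = subst (0ℚ ≤_) (sym (neg s)) (0≤* (≤⇒0≤- s≤0) (≤⇒0≤- s≤0))
  where
  neg : ∀ s → s * s ≡ (0ℚ - s) * (0ℚ - s)
  neg = solve-∀ ℚ-ring

-- Replaces the exponential function: the later bounds on n-th powers of 1 ± O(1/n) are derived from
-- it.
bernoulli : ∀ {s} k → 0ℚ ≤ 1ℚ + s → 1ℚ + fromℕ k * s ≤ (1ℚ + s) ^ℚ k
bernoulli {s} zero    _     = ≤-reflexive (trans (cong (_+_ 1ℚ) (*-zeroˡ s)) (+-identityʳ 1ℚ))
bernoulli {s} (suc k) 0≤1+s = begin
  1ℚ + fromℕ (suc k) * s         ≤⟨ ≤-by (fromℕ k * (s * s)) (trans (eq (fromℕ k) s) (cong (λ z → 1ℚ + z * s + fromℕ k * (s * s)) (sym (fromℕ-suc k))))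
                                      (0≤* (0≤fromℕ k) (0≤sq s)) ⟩
  (1ℚ + s) * (1ℚ + fromℕ k * s)  ≤⟨ *-monoˡ 0≤1+s (bernoulli k 0≤1+s) ⟩
  (1ℚ + s) ^ℚ suc k              ∎
  where
  eq : ∀ k s → (1ℚ + s) * (1ℚ + k * s) ≡ 1ℚ + (1ℚ + k) * s + k * (s * s)
  eq = solve-∀ ℚ-ring

-- Exponential estimates and finite distributions

module Distributions where

  private variable
    A B C : Set
    m n t : ℕ

  -- A division-free form of (1 - s)^k ≤ 1/(1 + ks), a weak substitute for exp(-ks). Bernoulli
  -- bounds (1 + s)^k from below, and (1 - s)(1 + s) ≤ 1.
  [1-s]^k≤ : ∀ {s} k → 0ℚ ≤ s → s ≤ 1ℚ → (1ℚ - s) ^ℚ k * (1ℚ + fromℕ k * s) ≤ 1ℚ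
  [1-s]^k≤ {s} k 0≤s s≤1 = begin
    (1ℚ - s) ^ℚ k * (1ℚ + fromℕ k * s)  ≤⟨ *-monoˡ (0≤^ k (≤⇒0≤- s≤1)) (bernoulli k (0≤+ 0≤1 0≤s)) ⟩
    (1ℚ - s) ^ℚ k * (1ℚ + s) ^ℚ k       ≡⟨ ^-distrib-* (1ℚ - s) (1ℚ + s) k ⟨
    ((1ℚ - s) * (1ℚ + s)) ^ℚ k          ≤⟨ ^≤1 k (0≤* (≤⇒0≤- s≤1) (0≤+ 0≤1 0≤s)) (≤-by (s * s) (eq s) (0≤* 0≤s 0≤s)) ⟩
    1ℚ                                  ∎
    where
    eq : ∀ s → 1ℚ ≡ (1ℚ - s) * (1ℚ + s) + s * s
    eq = solve-∀ ℚ-ring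

  -- Bernoulli gives (1 - h)^n ≥ 1 - nh = 1/2, and (1 + h)(1 - h) ≤ 1 turns this into an upper
  -- bound. With h = 1/n the lower bound would degenerate to 0.
  [1+1/2n]^n≤2 : ∀ {h} n → 0ℚ ≤ h → fromℕ n * h + fromℕ n * h ≡ 1ℚ → h ≤ 1ℚ → (1ℚ + h) ^ℚ n ≤ 1ℚ + 1ℚ
  [1+1/2n]^n≤2 {h} n 0≤h 2nh≡1 h≤1 = begin
    (1ℚ + h) ^ℚ n   ≡⟨ *-identityʳ _ ⟨
    (1ℚ + h) ^ℚ n * 1ℚ   ≤⟨ *-monoˡ 0≤p 1≤ ⟩
    (1ℚ + h) ^ℚ n * ((1ℚ + 1ℚ) * (1ℚ - h) ^ℚ n)           ≡⟨ eq₁ ((1ℚ + h) ^ℚ n) ((1ℚ - h) ^ℚ n) ⟩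
    (1ℚ + 1ℚ) * ((1ℚ + h) ^ℚ n * (1ℚ - h) ^ℚ n)           ≡⟨ cong ((1ℚ + 1ℚ) *_) (^-distrib-* (1ℚ + h) (1ℚ - h) n) ⟨
    (1ℚ + 1ℚ) * ((1ℚ + h) * (1ℚ - h)) ^ℚ n                ≤⟨ *-monoˡ (0≤+ 0≤1 0≤1) (^≤1 n (0≤* (0≤+ 0≤1 0≤h) (≤⇒0≤- h≤1)) (≤-by (h * h) (eq₂ h) (0≤* 0≤h 0≤h))) ⟩
    (1ℚ + 1ℚ) * 1ℚ   ≡⟨ *-identityʳ (1ℚ + 1ℚ) ⟩
    1ℚ + 1ℚ                                               ∎
    where
    0≤p = 0≤^ n (0≤+ 0≤1 0≤h)
    eq₁ : ∀ a b → a * ((1ℚ + 1ℚ) * b) ≡ (1ℚ + 1ℚ) * (a * b)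
    eq₁ = solve-∀ ℚ-ring
    eq₂ : ∀ h → 1ℚ ≡ (1ℚ + h) * (1ℚ - h) + h * h
    eq₂ = solve-∀ ℚ-ring
    eq₃ : ∀ a h → (1ℚ + 1ℚ) * (1ℚ + a * (- h)) ≡ (1ℚ + 1ℚ) - (a * h + a * h)
    eq₃ = solve-∀ ℚ-ring
    1≤ : 1ℚ ≤ (1ℚ + 1ℚ) * (1ℚ - h) ^ℚ n
    1≤ = begin
      1ℚ   ≡⟨⟩
      (1ℚ + 1ℚ) - 1ℚ                           ≡⟨ cong (λ z → (1ℚ + 1ℚ) - z) 2nh≡1 ⟨
      (1ℚ + 1ℚ) - (fromℕ n * h + fromℕ n * h)  ≡⟨ eq₃ (fromℕ n) h ⟨
      (1ℚ + 1ℚ) * (1ℚ + fromℕ n * (- h))       ≤⟨ *-monoˡ (0≤+ 0≤1 0≤1) (bernoulli n (≤⇒0≤- h≤1)) ⟩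
      (1ℚ + 1ℚ) * (1ℚ - h) ^ℚ n                ∎

  1≤fromℕ : ∀ n .{{_ : ℕ.NonZero n}} → 1ℚ ≤ fromℕ n
  1≤fromℕ (suc n) = ≤-by (fromℕ n) (fromℕ-suc n) (0≤fromℕ n)

  ⁻¹≤1 : ∀ {q} → 1ℚ ≤ q → q ⁻¹ ≤ 1ℚ
  ⁻¹≤1 {q} 1≤q = begin
    q ⁻¹      ≡⟨ *-identityˡ _ ⟨
    1ℚ * q ⁻¹ ≤⟨ *-monoʳ (0≤⁻¹ (≤-trans 0≤1 1≤q)) 1≤q ⟩
    q * q ⁻¹  ≡⟨ *-⁻¹ (<-≤-trans 0<1 1≤q) ⟩
    1ℚ        ∎

  -- The square of the preceding bound, since 1 + q ≤ (1 + q/2)².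
  [1+1/n]^n≤4 : ∀ n .{{_ : ℕ.NonZero n}} → (1ℚ + fromℕ n ⁻¹) ^ℚ n ≤ fromℕ 4
  [1+1/n]^n≤4 n = begin
    (1ℚ + q) ^ℚ n                      ≤⟨ ^-mono n (0≤+ 0≤1 0≤q) (≤-by (h * h) (eq h q) (0≤* 0≤h 0≤h)) ⟩
    ((1ℚ + h) * (1ℚ + h)) ^ℚ n         ≡⟨ ^-distrib-* (1ℚ + h) (1ℚ + h) n ⟩
    (1ℚ + h) ^ℚ n * (1ℚ + h) ^ℚ n      ≤⟨ *-mono (0≤^ n (0≤+ 0≤1 0≤h)) (0≤fromℕ 2) ≤2 ≤2 ⟩
    fromℕ 4                            ∎
    where
    q = fromℕ n ⁻¹
    0≤q = 0≤⁻¹ (0≤fromℕ n)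
    h = ½ * q
    0≤h : 0ℚ ≤ h
    0≤h = 0≤* (nonNegative⁻¹ (+ 1 / 2)) 0≤q
    half : ∀ a → (+ 1 / 2) * a + (+ 1 / 2) * a ≡ a
    half = solve-∀ ℚ-ring
    eq : ∀ h q → (1ℚ + (+ 1 / 2) * q) * (1ℚ + (+ 1 / 2) * q) ≡ (1ℚ + q) + (+ 1 / 2) * q * ((+ 1 / 2) * q)
    eq h q = eq′ q
      where
      eq′ : ∀ q → (1ℚ + (+ 1 / 2) * q) * (1ℚ + (+ 1 / 2) * q) ≡ (1ℚ + q) + (+ 1 / 2) * q * ((+ 1 / 2) * q)
      eq′ = solve-∀ ℚ-ring
    h≤1 : h ≤ 1ℚ
    h≤1 = ≤-trans (≤-by h (sym (half q)) 0≤h) (⁻¹≤1 (1≤fromℕ n))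
    2nh≡1 : fromℕ n * h + fromℕ n * h ≡ 1ℚ
    2nh≡1 = trans (cong₂ _+_ (x∙yz≈y∙xz (fromℕ n) (+ 1 / 2) q) (x∙yz≈y∙xz (fromℕ n) (+ 1 / 2) q)) (trans (half (fromℕ n * q)) (*-⁻¹ (0<fromℕ n)))
    ≤2 : (1ℚ + h) ^ℚ n ≤ fromℕ 2
    ≤2 = [1+1/2n]^n≤2 n 0≤h 2nh≡1 h≤1

  [1+k/n]^n≤4^k : ∀ k n .{{_ : ℕ.NonZero n}} → (1ℚ + fromℕ k * fromℕ n ⁻¹) ^ℚ n ≤ fromℕ 4 ^ℚ k
  [1+k/n]^n≤4^k k n = begin
    (1ℚ + fromℕ k * q) ^ℚ n  ≤⟨ ^-mono n (0≤+ 0≤1 (0≤* (0≤fromℕ k) 0≤q)) (bernoulli k 0≤1+q) ⟩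
    ((1ℚ + q) ^ℚ k) ^ℚ n     ≡⟨ ^-assocʳ (1ℚ + q) k n ⟩
    (1ℚ + q) ^ℚ (k ℕ.* n)    ≡⟨ cong ((1ℚ + q) ^ℚ_) (ℕ.*-comm k n) ⟩
    (1ℚ + q) ^ℚ (n ℕ.* k)    ≡⟨ ^-assocʳ (1ℚ + q) n k ⟨
    ((1ℚ + q) ^ℚ n) ^ℚ k     ≤⟨ ^-mono k (0≤^ n 0≤1+q) ([1+1/n]^n≤4 n) ⟩
    fromℕ 4 ^ℚ k             ∎
    where
    q = fromℕ n ⁻¹
    0≤q = 0≤⁻¹ (0≤fromℕ n)
    0≤1+q = 0≤+ 0≤1 0≤q

  sum-mono : {f g : Fin m → ℚ} → (∀ i → f i ≤ g i) → sum f ≤ sum g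
  sum-mono {zero}  f≤g = ≤-refl
  sum-mono {suc m} f≤g = +-mono-≤ (f≤g zero) (sum-mono (f≤g ∘ suc))

  sum-const : ∀ m c → sum {m} (λ _ → c) ≡ fromℕ m * c
  sum-const zero    c = sym (*-zeroˡ c)
  sum-const (suc m) c = trans (cong (_+_ c) (sum-const m c)) (trans (eq c (fromℕ m)) (cong (_* c) (sym (fromℕ-suc m))))
    where
    eq : ∀ c k → c + k * c ≡ (1ℚ + k) * c
    eq = solve-∀ ℚ-ring

  argmin : (f : Fin (suc m) → ℚ) → ∃[ i ] (∀ j → f i ≤ f j)
  argmin {zero}  f = zero , λ { zero → ≤-refl }
  argmin {suc m} f with argmin (f ∘ suc)
  ... | i , min with ≤-total (f zero) (f (suc i))
  ...   | inj₁ f0≤fi = zero  , λ { zero → ≤-refl ; (suc j) → ≤-trans f0≤fi (min j) }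
  ...   | inj₂ fi≤f0 = suc i , λ { zero → fi≤f0  ; (suc j) → min j }

  -- Formal sampling programs instead of weight functions: the expectation of a `bind` is then an
  -- iterated expectation by definition, nothing has to be normalized, and every law of `E` is an
  -- induction on the program.
  data Dist : Set → Set₁ where
    choose : (w : Fin m → ℚ) → (∀ i → 0ℚ ≤ w i) → sum w ≡ 1ℚ → Dist (Fin m)
    point  : A → Dist A
    bind   : Dist A → (A → Dist B) → Dist B

  E : Dist A → (A → ℚ) → ℚ
  E (choose w _ _) f = sum (λ i → w i * f i)
  E (point a)      f = f a
  E (bind d k)     f = E d (λ a → E (k a) f)

  E-mono : (d : Dist A) {f g : A → ℚ} → (∀ a → f a ≤ g a) → E d f ≤ E d g
  E-mono (choose w 0≤w _) f≤g = sum-mono λ i → *-monoˡ (0≤w i) (f≤g i)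
  E-mono (point a)        f≤g = f≤g a
  E-mono (bind d k)       f≤g = E-mono d λ a → E-mono (k a) f≤g

  E-cong : (d : Dist A) {f g : A → ℚ} → (∀ a → f a ≡ g a) → E d f ≡ E d g
  E-cong d f≗g = ≤-antisym (E-mono d (≤-reflexive ∘ f≗g)) (E-mono d (≤-reflexive ∘ sym ∘ f≗g))

  E-+ : (d : Dist A) (f g : A → ℚ) → E d (λ a → f a + g a) ≡ E d f + E d g
  E-+ (choose w _ _) f g = trans (sum-cong-≗ λ i → *-distribˡ-+ (w i) (f i) (g i)) (∑-distrib-+ (λ i → w i * f i) (λ i → w i * g i))
  E-+ (point a)      f g = refl
  E-+ (bind d k)     f g = trans (E-cong d λ a → E-+ (k a) f g) (E-+ d _ _)

  E-* : (d : Dist A) (c : ℚ) (f : A → ℚ) → E d (λ a → c * f a) ≡ c * E d f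
  E-* (choose w _ _) c f = trans (sum-cong-≗ λ i → x∙yz≈y∙xz (w i) c (f i)) (sym (*-distribˡ-sum c (λ i → w i * f i)))
  E-* (point a)      c f = refl
  E-* (bind d k)     c f = trans (E-cong d λ a → E-* (k a) c f) (E-* d c _)

  E-const : (d : Dist A) (c : ℚ) → E d (λ _ → c) ≡ c
  E-const (choose w _ ∑w≡1) c = trans (sum-cong-≗ λ i → *-comm (w i) c) (trans (sym (*-distribˡ-sum c w)) (trans (cong (c *_) ∑w≡1) (*-identityʳ c)))
  E-const (point a)         c = refl
  E-const (bind d k)        c = trans (E-cong d λ a → E-const (k a) c) (E-const d c)

  -- The averaging argument behind both choices made later: fixing the random coins and fixing the
  -- first message.
  E-pick : (d : Dist A) (f : A → ℚ) → ∃[ a ] f a ≤ E d f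
  E-pick (choose {zero} w 0≤w ∑w≡1) f = contradiction (sym ∑w≡1) 1≢0
  E-pick d@(choose {suc m} w 0≤w ∑w≡1) f with argmin f
  ... | i , min = i , ≤-trans (≤-reflexive (sym (E-const d (f i)))) (E-mono d min)
  E-pick (point a) f = a , ≤-refl
  E-pick (bind d k) f with E-pick d (λ a → E (k a) f)
  ... | a , p with E-pick (k a) f
  ...   | b , q = b , ≤-trans q p

  E-sum : (d : Dist A) (f : Fin m → A → ℚ) → E d (λ a → sum (λ i → f i a)) ≡ sum (λ i → E d (f i))
  E-sum {m = zero}  d f = E-const d 0ℚ
  E-sum {m = suc m} d f = trans (E-+ d (f zero) _) (cong (_+_ (E d (f zero))) (E-sum d (f ∘ suc)))

  E-swap : (d : Dist A) (e : Dist B) (f : A → B → ℚ) → E d (λ a → E e (f a)) ≡ E e (λ b → E d (λ a → f a b))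
  E-swap (choose w _ _) e f = sym (trans (E-sum e (λ i b → w i * f i b)) (sum-cong-≗ λ i → E-* e (w i) (f i)))
  E-swap (point a)      e f = refl
  E-swap (bind d k)     e f = trans (E-cong d λ a → E-swap (k a) e f) (E-swap d e _)

  E-0≤ : (d : Dist A) {f : A → ℚ} → (∀ a → 0ℚ ≤ f a) → 0ℚ ≤ E d f
  E-0≤ d {f} 0≤f = ≤-trans (≤-reflexive (sym (E-const d 0ℚ))) (E-mono d 0≤f)

  E-*ʳ : (d : Dist A) (c : ℚ) (f : A → ℚ) → E d (λ a → f a * c) ≡ E d f * c
  E-*ʳ d c f = trans (E-cong d λ a → *-comm (f a) c) (trans (E-* d c f) (*-comm c _))

  E-- : (d : Dist A) (f g : A → ℚ) → E d (λ a → f a - g a) ≡ E d f - E d g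
  E-- d f g = trans (E-+ d f (λ a → - g a)) (cong (_+_ (E d f)) (trans (E-cong d λ a → eq (g a)) (trans (E-* d (- 1ℚ) g) (sym (eq (E d g))))))
    where
    eq : ∀ a → - a ≡ - 1ℚ * a
    eq = solve-∀ ℚ-ring

  iid : Dist A → ∀ n → Dist (Vec A n)
  iid d zero    = point []
  iid d (suc n) = bind d λ a → bind (iid d n) λ as → point (a ∷ as)

  unif : ∀ m .{{_ : ℕ.NonZero m}} → Dist (Fin m)
  unif m = choose (λ _ → fromℕ m ⁻¹) (λ _ → 0≤⁻¹ (0≤fromℕ m)) (trans (sum-const m (fromℕ m ⁻¹)) (*-⁻¹ (0<fromℕ m)))

  bit : Bool → ℚ
  bit false = 0ℚ
  bit true  = 1ℚ

  0≤bit : ∀ b → 0ℚ ≤ bit b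
  0≤bit false = ≤-refl
  0≤bit true  = 0≤1

  bit≤1 : ∀ b → bit b ≤ 1ℚ
  bit≤1 false = 0≤1
  bit≤1 true  = ≤-refl

  bit-not : ∀ b → bit (not b) ≡ 1ℚ - bit b
  bit-not false = refl
  bit-not true  = refl

  bit-∧ : ∀ a b → bit (a ∧ b) ≡ bit a * bit b
  bit-∧ false b = sym (*-zeroˡ (bit b))
  bit-∧ true  b = sym (*-identityˡ (bit b))

  δ : Fin m → Fin m → ℚ
  δ i j = bit (does (i Fin.≟ j))

  sum-δ : (i : Fin m) (f : Fin m → ℚ) → sum (λ j → δ i j * f j) ≡ f i
  sum-δ {suc m} zero f = trans (cong₂ _+_ (*-identityˡ (f zero)) (trans (sum-cong-≗ λ j → *-zeroˡ (f (suc j))) (sum-replicate-zero m))) (+-identityʳ (f zero))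
  sum-δ {suc m} (suc i) f = trans (cong₂ _+_ (*-zeroˡ (f zero)) (sum-δ i (f ∘ suc))) (+-identityˡ (f (suc i)))

  E-δ : ∀ m .{{_ : ℕ.NonZero m}} (i : Fin m) (f : Fin m → ℚ) → E (unif m) (λ j → δ i j * f j) ≡ fromℕ m ⁻¹ * f i
  E-δ m i f = trans (sym (*-distribˡ-sum (fromℕ m ⁻¹) (λ j → δ i j * f j))) (cong (fromℕ m ⁻¹ *_) (sum-δ i f))

  E-δ₁ : ∀ m .{{_ : ℕ.NonZero m}} (i : Fin m) → E (unif m) (δ i) ≡ fromℕ m ⁻¹
  E-δ₁ m i = trans (E-cong (unif m) λ j → sym (*-identityʳ (δ i j))) (trans (E-δ m i (λ _ → 1ℚ)) (*-identityʳ _))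

  δ-sym : (i j : Fin m) → δ i j ≡ δ j i
  δ-sym zero    zero    = refl
  δ-sym zero    (suc j) = refl
  δ-sym (suc i) zero    = refl
  δ-sym (suc i) (suc j) = δ-sym i j

  δ-cases : (i j : Fin m) → (δ i j ≡ 0ℚ) ⊎ ((i ≡ j) × δ i j ≡ 1ℚ)
  δ-cases i j with i Fin.≟ j
  ... | yes p = inj₂ (p , refl)
  ... | no  _ = inj₁ refl

  δ-idem : (i j : Fin m) → δ i j * δ i j ≡ δ i j
  δ-idem i j with δ-cases i j
  ... | inj₁ p       = trans (cong₂ _*_ p p) (sym p)
  ... | inj₂ (_ , p) = trans (cong₂ _*_ p p) (sym p)

  -- One family covers every product statistic of a pair of vectors below: (1, -1) is the indicator
  -- of no agreement, (1, 1) is 2 to the number of matches, (0, 1) is the indicator of equality, and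
  -- other parameters give the density bound and the chance of missing two vectors at once.
  agreeProd : (α β : ℚ) → Vec (Fin t) n → Vec (Fin t) n → ℚ
  agreeProd α β []       []       = 1ℚ
  agreeProd α β (x ∷ xs) (y ∷ ys) = (α + β * δ x y) * agreeProd α β xs ys

  agreeProd-1 : ∀ {α β} → α ≡ 1ℚ → β ≡ 0ℚ → (x y : Vec (Fin t) n) → agreeProd α β x y ≡ 1ℚ
  agreeProd-1 refl refl []       []       = refl
  agreeProd-1 refl refl (x ∷ xs) (y ∷ ys) = trans (cong₂ _*_ (trans (cong (_+_ 1ℚ) (*-zeroˡ (δ x y))) (+-identityʳ 1ℚ)) (agreeProd-1 refl refl xs ys)) (*-identityˡ 1ℚ)

  factor-0≤ : ∀ {α β} → 0ℚ ≤ α → 0ℚ ≤ α + β → (i j : Fin m) → 0ℚ ≤ α + β * δ i j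
  factor-0≤ {α = α} {β} 0≤α 0≤α+β i j with δ-cases i j
  ... | inj₁ p       = subst (0ℚ ≤_) (sym (trans (cong (λ z → α + β * z) p) (trans (cong (_+_ α) (*-zeroʳ β)) (+-identityʳ α)))) 0≤α
  ... | inj₂ (_ , p) = subst (0ℚ ≤_) (sym (trans (cong (λ z → α + β * z) p) (cong (_+_ α) (*-identityʳ β)))) 0≤α+β

  agreeProd-0≤ : ∀ {α β} → 0ℚ ≤ α → 0ℚ ≤ α + β → (x y : Vec (Fin t) n) → 0ℚ ≤ agreeProd α β x y
  agreeProd-0≤ 0≤α 0≤α+β []       []       = 0≤1
  agreeProd-0≤ 0≤α 0≤α+β (x ∷ xs) (y ∷ ys) = 0≤* (factor-0≤ 0≤α 0≤α+β x y) (agreeProd-0≤ 0≤α 0≤α+β xs ys)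

  agreeProd-sym : ∀ α β (x y : Vec (Fin t) n) → agreeProd α β x y ≡ agreeProd α β y x
  agreeProd-sym α β []       []       = refl
  agreeProd-sym α β (x ∷ xs) (y ∷ ys) = cong₂ _*_ (cong (λ z → α + β * z) (δ-sym x y)) (agreeProd-sym α β xs ys)

  -- Since δ is idempotent, squaring stays inside the family, so that second moments follow from
  -- `E-agreeProd`.
  agreeProd-sq : ∀ α β (x y : Vec (Fin t) n) →
    agreeProd α β x y * agreeProd α β x y ≡ agreeProd (α * α) ((1ℚ + 1ℚ) * α * β + β * β) x y
  agreeProd-sq α β []       []       = refl
  agreeProd-sq α β (x ∷ xs) (y ∷ ys) = trans (eq₁ (α + β * δ x y) (agreeProd α β xs ys))
    (cong₂ _*_ (trans (eq₂ α β (δ x y)) (trans (cong (λ z → α * α + (1ℚ + 1ℚ) * α * β * δ x y + β * β * z) (δ-idem x y)) (eq₃ α β (δ x y)))) (agreeProd-sq α β xs ys))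
    where
    eq₁ : ∀ a b → (a * b) * (a * b) ≡ (a * a) * (b * b)
    eq₁ = solve-∀ ℚ-ring
    eq₂ : ∀ α β d → (α + β * d) * (α + β * d) ≡ α * α + (1ℚ + 1ℚ) * α * β * d + β * β * (d * d)
    eq₂ = solve-∀ ℚ-ring
    eq₃ : ∀ α β d → α * α + (1ℚ + 1ℚ) * α * β * d + β * β * d ≡ α * α + ((1ℚ + 1ℚ) * α * β + β * β) * d
    eq₃ = solve-∀ ℚ-ring

  E-factor : ∀ α β t .{{_ : ℕ.NonZero t}} (i : Fin t) → E (unif t) (λ j → α + β * δ i j) ≡ α + β * fromℕ t ⁻¹
  E-factor α β t i = trans (E-+ (unif t) (λ _ → α) (λ j → β * δ i j))
    (cong₂ _+_ (E-const (unif t) α) (trans (E-* (unif t) β (δ i)) (cong (β *_) (E-δ₁ t i))))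

  E-agreeProd : ∀ α β .{{_ : ℕ.NonZero t}} (x : Vec (Fin t) n) →
    E (iid (unif t) n) (agreeProd α β x) ≡ (α + β * fromℕ t ⁻¹) ^ℚ n
  E-agreeProd             α β []       = refl
  E-agreeProd {t} {suc n} α β (x ∷ xs) = trans (E-cong (unif t) λ y → E-* (iid (unif t) n) (α + β * δ x y) (agreeProd α β xs))
    (trans (E-*ʳ (unif t) _ (λ y → α + β * δ x y)) (cong₂ _*_ (E-factor α β t x) (E-agreeProd α β xs)))

open Distributions

-- Protocol trees and their error as an expectation

module ProtocolTrees where

  private variable
    A B C : Set
    m n t c r : ℕ

  sumList : List A → (A → ℚ) → ℚ
  sumList []       f = 0ℚ
  sumList (x ∷ xs) f = f x + sumList xs f

  sumList-++ : (xs ys : List A) (f : A → ℚ) → sumList (xs ++ ys) f ≡ sumList xs f + sumList ys f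
  sumList-++ []       ys f = sym (+-identityˡ _)
  sumList-++ (x ∷ xs) ys f = trans (cong (_+_ (f x)) (sumList-++ xs ys f)) (sym (+-assoc (f x) _ _))

  sumList-map : (g : A → B) (xs : List A) (f : B → ℚ) → sumList (List.map g xs) f ≡ sumList xs (f ∘ g)
  sumList-map g []       f = refl
  sumList-map g (x ∷ xs) f = cong (_+_ (f (g x))) (sumList-map g xs f)

  sumList-cong : (xs : List A) {f g : A → ℚ} → (∀ x → f x ≡ g x) → sumList xs f ≡ sumList xs g
  sumList-cong []       f≗g = refl
  sumList-cong (x ∷ xs) f≗g = cong₂ _+_ (f≗g x) (sumList-cong xs f≗g)

  sumList-* : (xs : List A) (c : ℚ) (f : A → ℚ) → sumList xs (λ x → c * f x) ≡ c * sumList xs f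
  sumList-* []       c f = sym (*-zeroʳ c)
  sumList-* (x ∷ xs) c f = trans (cong (_+_ (c * f x)) (sumList-* xs c f)) (sym (*-distribˡ-+ c (f x) _))

  sumList-cartesianProductWith : (h : A → B → C) (xs : List A) (ys : List B) (f : C → ℚ) →
    sumList (cartesianProductWith h xs ys) f ≡ sumList xs (λ x → sumList ys (f ∘ h x))
  sumList-cartesianProductWith h []       ys f = refl
  sumList-cartesianProductWith h (x ∷ xs) ys f = trans (sumList-++ (List.map (h x) ys) _ f)
    (cong₂ _+_ (sumList-map (h x) ys f) (sumList-cartesianProductWith h xs ys f))

  sumList-tabulate : (g : Fin m → A) (f : A → ℚ) → sumList (tabulate g) f ≡ sum (f ∘ g)
  sumList-tabulate {zero}  g f = refl
  sumList-tabulate {suc m} g f = cong (_+_ (f (g zero))) (sumList-tabulate (g ∘ suc) f)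

  length-filter : ∀ {p} {P : Pred A p} (P? : Decidable P) (xs : List A) →
    fromℕ (length (filter P? xs)) ≡ sumList xs (bit ∘ does ∘ P?)
  length-filter P? []       = refl
  length-filter P? (x ∷ xs) with does (P? x)
  ... | true  = trans (fromℕ-suc (length (filter P? xs))) (cong (_+_ 1ℚ) (length-filter P? xs))
  ... | false = trans (length-filter P? xs) (sym (+-identityˡ _))

  sum-unif : ∀ t .{{_ : ℕ.NonZero t}} (f : Fin t → ℚ) → sum f ≡ fromℕ t * E (unif t) f
  sum-unif t f = begin-equality
    sum f   ≡⟨ *-identityˡ (sum f) ⟨
    1ℚ * sum f                                ≡⟨ cong (_* sum f) (*-⁻¹ (0<fromℕ t)) ⟨
    fromℕ t * fromℕ t ⁻¹ * sum f              ≡⟨ *-assoc (fromℕ t) (fromℕ t ⁻¹) (sum f) ⟩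
    fromℕ t * (fromℕ t ⁻¹ * sum f)            ≡⟨ cong (fromℕ t *_) (*-distribˡ-sum (fromℕ t ⁻¹) f) ⟩
    fromℕ t * E (unif t) f                    ∎

  sumList-words : ∀ t n .{{_ : ℕ.NonZero t}} (f : Vec (Fin t) n → ℚ) →
    sumList (words t n) f ≡ fromℕ t ^ℚ n * E (iid (unif t) n) f
  sumList-words t zero    f = trans (+-identityʳ (f [])) (sym (*-identityˡ (f [])))
  sumList-words t (suc n) f = begin-equality
    sumList (words t (suc n)) f   ≡⟨ sumList-cartesianProductWith _∷_ (List.allFin t) (words t n) f ⟩
    sumList (List.allFin t) (λ x → sumList (words t n) (f ∘ (x ∷_)))   ≡⟨ sumList-tabulate {m = t} (λ i → i) _ ⟩
    sum (λ x → sumList (words t n) (f ∘ (x ∷_)))                       ≡⟨ sum-unif t _ ⟩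
    T * E (unif t) (λ x → sumList (words t n) (f ∘ (x ∷_)))            ≡⟨ cong (T *_) (E-cong (unif t) λ x → sumList-words t n (f ∘ (x ∷_))) ⟩
    T * E (unif t) (λ x → T ^ℚ n * E (iid (unif t) n) (f ∘ (x ∷_)))    ≡⟨ cong (T *_) (E-* (unif t) (T ^ℚ n) _) ⟩
    T * (T ^ℚ n * E (iid (unif t) (suc n)) f)                          ≡⟨ *-assoc T (T ^ℚ n) _ ⟨
    T ^ℚ suc n * E (iid (unif t) (suc n)) f                            ∎
    where T = fromℕ t

  wrong : Bool → Bool → ℚ
  wrong a b = bit (does (¬? (a Bool.≟ b)))

  0≤wrong : ∀ a b → 0ℚ ≤ wrong a b
  0≤wrong a b = 0≤bit (does (¬? (a Bool.≟ b)))

  inputs : ∀ n .{{_ : ℕ.NonZero n}} → Dist (Input n)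
  inputs n = iid (unif (4 ℕ.* n) {{ℕ.m*n≢0 4 n}}) n

  treeError : ∀ {n c r} .{{_ : ℕ.NonZero n}} → Tree n c r → ℚ
  treeError {n} T = E (inputs n) λ x → E (inputs n) λ y → wrong (runTree T x y) (EE x y)

  disagree : Vec (Fin t) n → Vec (Fin t) n → ℚ
  disagree = agreeProd 1ℚ (- 1ℚ)

  0≤disagree : (x y : Vec (Fin t) n) → 0ℚ ≤ disagree x y
  0≤disagree = agreeProd-0≤ 0≤1 (≤-refl {0ℚ})

  bit-any : (x y : Vec (Fin t) n) → bit (does (Fin.any? λ i → lookup x i Fin.≟ lookup y i)) ≡ 1ℚ - disagree x y
  bit-any []       []       = refl
  bit-any (x ∷ xs) (y ∷ ys) with does (x Fin.≟ y)
  ... | true  = sym (cong (λ z → 1ℚ - z) (*-zeroˡ (disagree xs ys)))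
  ... | false = trans (bit-any xs ys) (cong (λ z → 1ℚ - z) (sym (*-identityˡ (disagree xs ys))))

  bit-EE : (x y : Input n) → bit (EE x y) ≡ 1ℚ - disagree x y
  bit-EE = bit-any

  1-EE : (x y : Input n) → 1ℚ - bit (EE x y) ≡ disagree x y
  1-EE x y = trans (cong (λ z → 1ℚ - z) (bit-EE x y)) (1-[1-a]≡a (disagree x y))

  bit-injective : ∀ {a b} → bit a ≡ bit b → a ≡ b
  bit-injective {false} {false} _ = refl
  bit-injective {true}  {true}  _ = refl

  EE-sym : (x y : Input n) → EE x y ≡ EE y x
  EE-sym x y = bit-injective (trans (bit-EE x y) (trans (cong (λ z → 1ℚ - z) (agreeProd-sym 1ℚ (- 1ℚ) x y)) (sym (bit-EE y x))))

  -- `error` is a quotient of list lengths; after multiplication by the length of `ν n` both sides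
  -- are the same sum over pairs of words.
  error-run : .{{_ : ℕ.NonZero n}} (Q : Protocol n r c) →
    error Q ≡ E (inputs n) λ x → E (inputs n) λ y → wrong (run Q x y) (EE x y)
  error-run {n} Q = *-cancelˡ-≡ 0<L (begin-equality
    L * error Q   ≡⟨ *-comm L (error Q) ⟩
    error Q * L   ≡⟨ /-* (length (filter (wrong? Q) (ν n))) (length (ν n)) {{ν-nonEmpty n}} ⟩
    fromℕ (length (filter (wrong? Q) (ν n)))             ≡⟨ length-filter (wrong? Q) (ν n) ⟩
    sumList (ν n) (bit ∘ does ∘ wrong? Q)                ≡⟨ sumList-cartesianProductWith _,_ W W _ ⟩
    sumList W (λ x → sumList W (e x))                    ≡⟨ sumList-cong W (λ x → sumList-words T n {{T≢0}} (e x)) ⟩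
    sumList W (λ x → N * E (inputs n) (e x))             ≡⟨ sumList-* W N _ ⟩
    N * sumList W (λ x → E (inputs n) (e x))             ≡⟨ cong (N *_) (sumList-words T n {{T≢0}} _) ⟩
    N * (N * E (inputs n) λ x → E (inputs n) (e x))      ≡⟨ *-assoc N N _ ⟨
    N * N * (E (inputs n) λ x → E (inputs n) (e x))      ≡⟨ cong (_* E (inputs n) λ x → E (inputs n) (e x)) L≡ ⟨
    L * (E (inputs n) λ x → E (inputs n) (e x))          ∎)
    where
    T = 4 ℕ.* n
    .T≢0 : ℕ.NonZero T
    T≢0 = ℕ.m*n≢0 4 n
    W = words T n
    N = fromℕ T ^ℚ n
    L = fromℕ (length (ν n))
    e : Input n → Input n → ℚ
    e x y = wrong (run Q x y) (EE x y)
    0<L : 0ℚ < L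
    0<L = 0<fromℕ (length (ν n)) {{ν-nonEmpty n}}
    L≡ : L ≡ N * N
    L≡ = trans (cong fromℕ (length-ν n)) (trans (fromℕ-* (T ℕ.^ n) (T ℕ.^ n)) (cong₂ _*_ (fromℕ-^ T n) (fromℕ-^ T n)))

  -- By the symmetry of `EE` it does not matter who starts; from here on only the player who moves
  -- first is distinguished.
  error≡treeError : .{{_ : ℕ.NonZero n}} (p : Player) (T : Tree n c r) → error (protocol p T) ≡ treeError T
  error≡treeError alice T = error-run (protocol alice T)
  error≡treeError {n} bob T = trans (error-run (protocol bob T))
    (trans (E-swap (inputs n) (inputs n) (λ x y → wrong (runTree T y x) (EE x y)))
           (E-cong (inputs n) λ y → E-cong (inputs n) λ x → cong (wrong (runTree T y x)) (EE-sym x y)))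

  -- Exactly r messages on every path keep two trees aligned when they run in parallel, and free
  -- input types let the players hold sampled data or pairs of samples.
  data ExactTree (X Y : Set) (c : ℕ) : ℕ → Set where
    output : (X → Bool) → ExactTree X Y c 0
    send   : (X → Vec Bool c) → (Vec Bool c → ExactTree Y X c r) → ExactTree X Y c (suc r)

  runExact : ∀ {X Y} → ExactTree X Y c r → X → Y → Bool
  runExact (output f)   x y = f x
  runExact (send msg k) x y = runExact (k (msg x)) y x

  const : ∀ {X Y} → Bool → ∀ c r → ExactTree X Y c r
  const b c zero    = output λ _ → b
  const b c (suc r) = send (λ _ → Vec.replicate c false) λ _ → const b c r

  run-const : ∀ {X Y} b c r (x : X) (y : Y) → runExact (const b c r) x y ≡ b
  run-const b c zero    x y = refl
  run-const b c (suc r) x y = run-const b c r y x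

  -- An early output is announced in the first bit of a message.
  exact : Tree n (suc c) r → ExactTree (Input n) (Input n) (suc c) r
  exact {r = zero}          (output f)   = output f
  exact {c = c} {r = suc r} (output f)   = send (λ x → f x ∷ Vec.replicate c false) λ m → const (Vec.head m) (suc c) r
  exact                     (send msg k) = send msg (exact ∘ k)

  run-exact : (T : Tree n (suc c) r) (x y : Input n) → runExact (exact T) x y ≡ runTree T x y
  run-exact {r = zero}          (output f)   x y = refl
  run-exact {c = c} {r = suc r} (output f)   x y = run-const (f x) (suc c) r y x
  run-exact                     (send msg k) x y = run-exact (k (msg x)) y x

  toTree : ExactTree (Input n) (Input n) c r → Tree n c r
  toTree (output f)   = output f
  toTree (send msg k) = send msg (toTree ∘ k)

  run-toTree : (T : ExactTree (Input n) (Input n) c r) (x y : Input n) → runTree (toTree T) x y ≡ runExact T x y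
  run-toTree (output f)   x y = refl
  run-toTree (send msg k) x y = run-toTree (k (msg x)) y x

  pullback : ∀ {X Y X′ Y′} → (X′ → X) → (Y′ → Y) → ExactTree X Y c r → ExactTree X′ Y′ c r
  pullback f g (output h)   = output (h ∘ f)
  pullback f g (send msg k) = send (msg ∘ f) (pullback g f ∘ k)

  run-pullback : ∀ {X Y X′ Y′} (f : X′ → X) (g : Y′ → Y) (T : ExactTree X Y c r) x y →
    runExact (pullback f g T) x y ≡ runExact T (f x) (g y)
  run-pullback f g (output h)   x y = refl
  run-pullback f g (send msg k) x y = run-pullback g f (k (msg (f x))) y x

  -- The two runs share each message by concatenation. The same player finishes both, so both
  -- outputs are available to be joined by ⊙.
  combine : ∀ {X Y X′ Y′ a b} → (Bool → Bool → Bool) → ExactTree X Y a r → ExactTree X′ Y′ b r →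
    ExactTree (X × X′) (Y × Y′) (a ℕ.+ b) r
  combine _⊙_ (output f) (output f′) = output λ (x , x′) → f x ⊙ f′ x′
  combine {a = a} _⊙_ (send msg k) (send msg′ k′) =
    send (λ (x , x′) → msg x Vec.++ msg′ x′) λ m → combine _⊙_ (k (Vec.take a m)) (k′ (Vec.drop a m))

  run-combine : ∀ {X Y X′ Y′ a b} (_⊙_ : Bool → Bool → Bool)
    (T : ExactTree X Y a r) (T′ : ExactTree X′ Y′ b r) x x′ y y′ →
    runExact (combine _⊙_ T T′) (x , x′) (y , y′) ≡ runExact T x y ⊙ runExact T′ x′ y′
  run-combine _⊙_ (output f) (output f′) x x′ y y′ = refl
  run-combine {a = a} _⊙_ (send msg k) (send msg′ k′) x x′ y y′ =
    trans (cong₂ (λ m m′ → runExact (combine _⊙_ (k m) (k′ m′)) (y , y′) (x , x′))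
                 (take-++ (msg x) (msg′ x′)) (drop-++ (msg x) (msg′ x′)))
          (run-combine _⊙_ (k (msg x)) (k′ (msg′ x′)) y y′ x x′)
    where
    take-++ : ∀ {a b} (u : Vec Bool a) (v : Vec Bool b) → Vec.take a (u Vec.++ v) ≡ u
    take-++ []      v = refl
    take-++ (_ ∷ u) v = cong (_ ∷_) (take-++ u v)
    drop-++ : ∀ {a b} (u : Vec Bool a) (v : Vec Bool b) → Vec.drop a (u Vec.++ v) ≡ v
    drop-++ []      v = refl
    drop-++ (_ ∷ u) v = drop-++ u v

open ProtocolTrees

-- Randomized protocols: amplification and derandomization

module RandomizedProtocols where

  private variable
    A B C : Set
    m n t c r : ℕ

  infixr 5 _⊗_
  _⊗_ : Dist A → Dist B → Dist (A × B)
  d ⊗ e = bind d λ a → bind e λ b → point (a , b)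

  E-⊗ : (d : Dist A) (e : Dist B) (f : A → ℚ) (g : B → ℚ) → E (d ⊗ e) (λ (a , b) → f a * g b) ≡ E d f * E e g
  E-⊗ d e f g = trans (E-cong d λ a → E-* e (f a) g) (E-*ʳ d (E e g) f)

  -- `coins` are shared, while `own` and `other` are drawn privately given the coins. All randomness
  -- precedes the run, which is then deterministic.
  record Randomized (n c r : ℕ) : Set₁ where
    field
      {Own Other Coin} : Set
      tree  : ExactTree Own Other c r
      coins : Dist Coin
      own   : Coin → Input n → Dist Own
      other : Coin → Input n → Dist Other

  open Randomized

  value : Randomized n c r → (Bool → ℚ) → Input n → Input n → ℚ
  value R φ v u = E (coins R) λ ω → E (own R ω v) λ a → E (other R ω u) λ b → φ (runExact (tree R) a b)

  accept : Randomized n c r → Input n → Input n → ℚ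
  accept R = value R bit

  value-cong : (R : Randomized n c r) {φ ψ : Bool → ℚ} → (∀ b → φ b ≡ ψ b) → ∀ v u → value R φ v u ≡ value R ψ v u
  value-cong R φ≗ψ v u = E-cong (coins R) λ ω → E-cong (own R ω v) λ a → E-cong (other R ω u) λ b → φ≗ψ _

  value-mono : (R : Randomized n c r) {φ ψ : Bool → ℚ} → (∀ b → φ b ≤ ψ b) → ∀ v u → value R φ v u ≤ value R ψ v u
  value-mono R φ≤ψ v u = E-mono (coins R) λ ω → E-mono (own R ω v) λ a → E-mono (other R ω u) λ b → φ≤ψ _

  value-const : (R : Randomized n c r) (q : ℚ) → ∀ v u → value R (λ _ → q) v u ≡ q
  value-const R q v u = trans (E-cong (coins R) λ ω → trans (E-cong (own R ω v) λ a → E-const (other R ω u) q) (E-const (own R ω v) q)) (E-const (coins R) q)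

  0≤accept : (R : Randomized n c r) → ∀ v u → 0ℚ ≤ accept R v u
  0≤accept R v u = subst (_≤ accept R v u) (value-const R 0ℚ v u) (value-mono R 0≤bit v u)

  accept≤1 : (R : Randomized n c r) → ∀ v u → accept R v u ≤ 1ℚ
  accept≤1 R v u = subst (accept R v u ≤_) (value-const R 1ℚ v u) (value-mono R bit≤1 v u)

  E-1- : (d : Dist A) (f : A → ℚ) → E d (λ a → 1ℚ - f a) ≡ 1ℚ - E d f
  E-1- d f = trans (E-- d (λ _ → 1ℚ) f) (cong (λ z → z - E d f) (E-const d 1ℚ))

  value-not : (R : Randomized n c r) → ∀ v u → value R (bit ∘ not) v u ≡ 1ℚ - accept R v u
  value-not R v u = trans (value-cong R bit-not v u)
    (trans (E-cong (coins R) λ ω → trans (E-cong (own R ω v) λ a → E-1- (other R ω u) (λ b → bit (runExact (tree R) a b)))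
                                         (E-1- (own R ω v) (λ a → E (other R ω u) λ b → bit (runExact (tree R) a b))))
           (E-1- (coins R) (λ ω → E (own R ω v) λ a → E (other R ω u) λ b → bit (runExact (tree R) a b))))

  both : ∀ {a b} → (Bool → Bool → Bool) → Randomized n a r → Randomized n b r → Randomized n (a ℕ.+ b) r
  both _⊙_ R S = record
    { tree  = combine _⊙_ (tree R) (tree S)
    ; coins = coins R ⊗ coins S
    ; own   = λ (ω , ω′) v → own R ω v ⊗ own S ω′ v
    ; other = λ (ω , ω′) u → other R ω u ⊗ other S ω′ u
    }

  -- Independence of the two runs, stated for any test that factors over ⊙, so that conjunction
  -- (through `bit`) and disjunction (through the complement) are both instances.
  value-both : ∀ {a b} {_⊙_ : Bool → Bool → Bool} (R : Randomized n a r) (S : Randomized n b r) {φ ψ χ : Bool → ℚ} →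
    (∀ x y → φ (x ⊙ y) ≡ ψ x * χ y) → ∀ v u → value (both _⊙_ R S) φ v u ≡ value R ψ v u * value S χ v u
  value-both {_⊙_ = _⊙_} R S {φ} {ψ} {χ} eq v u =
    trans (E-cong (coins R ⊗ coins S) λ (ω , ω′) →
      trans (E-cong (own R ω v ⊗ own S ω′ v) λ (a , a′) →
        trans (E-cong (other R ω u ⊗ other S ω′ u) λ (b , b′) →
          trans (cong φ (run-combine _⊙_ (tree R) (tree S) a a′ b b′)) (eq _ _))
        (E-⊗ (other R ω u) (other S ω′ u) _ _))
      (E-⊗ (own R ω v) (own S ω′ v) _ _))
    (E-⊗ (coins R) (coins S) _ _)

  accept-∧ : ∀ {a b} (R : Randomized n a r) (S : Randomized n b r) → ∀ v u →
    accept (both _∧_ R S) v u ≡ accept R v u * accept S v u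
  accept-∧ R S = value-both {_⊙_ = _∧_} R S {bit} {bit} {bit} bit-∧

  accept-∨ : ∀ {a b} (R : Randomized n a r) (S : Randomized n b r) → ∀ v u →
    1ℚ - accept (both _∨_ R S) v u ≡ (1ℚ - accept R v u) * (1ℚ - accept S v u)
  accept-∨ R S v u = begin-equality
    1ℚ - accept (both _∨_ R S) v u                            ≡⟨ value-not (both _∨_ R S) v u ⟨
    value (both _∨_ R S) (bit ∘ not) v u                      ≡⟨ value-both {_⊙_ = _∨_} R S {bit ∘ not} {bit ∘ not} {bit ∘ not} deMorgan v u ⟩
    value R (bit ∘ not) v u * value S (bit ∘ not) v u         ≡⟨ cong₂ _*_ (value-not R v u) (value-not S v u) ⟩
    (1ℚ - accept R v u) * (1ℚ - accept S v u)                 ∎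
    where
    deMorgan : ∀ x y → bit (not (x ∨ y)) ≡ bit (not x) * bit (not y)
    deMorgan false y = sym (*-identityˡ (bit (not y)))
    deMorgan true  y = sym (*-zeroˡ (bit (not y)))

  -- The map p ↦ 1 - (1 - p²)² has an interior fixed point near 0.618 and moves values on either
  -- side of it away, quadratically near 0 and 1. A conjunction or a disjunction alone would improve
  -- one side and spoil the other.
  sharpen : Randomized n c r → Randomized n ((c ℕ.+ c) ℕ.+ (c ℕ.+ c)) r
  sharpen R = both _∨_ (both _∧_ R R) (both _∧_ R R)

  accept-sharpen : (R : Randomized n c r) → ∀ v u → let p = accept R v u in
    accept (sharpen R) v u ≡ 1ℚ - (1ℚ - p * p) * (1ℚ - p * p)
  accept-sharpen R v u = trans (sym (1-[1-a]≡a (accept (sharpen R) v u))) (cong (λ z → 1ℚ - z)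
    (trans (accept-∨ (both _∧_ R R) (both _∧_ R R) v u) (cong₂ (λ x y → (1ℚ - x) * (1ℚ - y)) (accept-∧ R R v u) (accept-∧ R R v u))))

  accept-sharpen-≤ : (R : Randomized n c r) → ∀ {x} v u → accept R v u ≤ x → accept (sharpen R) v u ≤ fromℕ 2 * (x * x)
  accept-sharpen-≤ R {x} v u p≤x = begin
    accept (sharpen R) v u               ≡⟨ accept-sharpen R v u ⟩
    1ℚ - (1ℚ - p * p) * (1ℚ - p * p)     ≤⟨ ≤-by (p * p * (p * p)) (eq p) (0≤* (0≤* 0≤p 0≤p) (0≤* 0≤p 0≤p)) ⟩
    fromℕ 2 * (p * p)                    ≤⟨ *-monoˡ (0≤fromℕ 2) (*-mono 0≤p (≤-trans 0≤p p≤x) p≤x p≤x) ⟩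
    fromℕ 2 * (x * x)                    ∎
    where
    p = accept R v u
    0≤p = 0≤accept R v u
    eq : ∀ p → fromℕ 2 * (p * p) ≡ (1ℚ - (1ℚ - p * p) * (1ℚ - p * p)) + p * p * (p * p)
    eq = solve-∀ ℚ-ring

  reject-sharpen-≤ : (R : Randomized n c r) → ∀ {y} v u → 1ℚ - accept R v u ≤ y → 1ℚ - accept (sharpen R) v u ≤ fromℕ 4 * (y * y)
  reject-sharpen-≤ R {y} v u q≤y = begin
    1ℚ - accept (sharpen R) v u                   ≡⟨ cong (λ z → 1ℚ - z) (accept-sharpen R v u) ⟩
    1ℚ - (1ℚ - (1ℚ - p * p) * (1ℚ - p * p))       ≡⟨ eq₁ p ⟩
    (1ℚ - p * p) * (1ℚ - p * p)                   ≤⟨ *-mono 0≤1-p² (0≤* (0≤fromℕ 2) (≤-trans 0≤q q≤y)) 1-p²≤ 1-p²≤ ⟩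
    (fromℕ 2 * y) * (fromℕ 2 * y)                 ≡⟨ eq₂ y ⟩
    fromℕ 4 * (y * y)                             ∎
    where
    p = accept R v u
    q = 1ℚ - p
    0≤p = 0≤accept R v u
    0≤q = ≤⇒0≤- (accept≤1 R v u)
    eq₁ : ∀ p → 1ℚ - (1ℚ - (1ℚ - p * p) * (1ℚ - p * p)) ≡ (1ℚ - p * p) * (1ℚ - p * p)
    eq₁ = solve-∀ ℚ-ring
    eq₂ : ∀ y → (fromℕ 2 * y) * (fromℕ 2 * y) ≡ fromℕ 4 * (y * y)
    eq₂ = solve-∀ ℚ-ring
    eq₃ : ∀ p → fromℕ 2 * (1ℚ - p) ≡ (1ℚ - p * p) + (1ℚ - p) * (1ℚ - p)
    eq₃ = solve-∀ ℚ-ring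
    eq₄ : ∀ p → 1ℚ - p * p ≡ (1ℚ - p) * (1ℚ + p)
    eq₄ = solve-∀ ℚ-ring
    0≤1-p² : 0ℚ ≤ 1ℚ - p * p
    0≤1-p² = subst (0ℚ ≤_) (sym (eq₄ p)) (0≤* 0≤q (0≤+ 0≤1 0≤p))
    1-p²≤ : 1ℚ - p * p ≤ fromℕ 2 * y
    1-p²≤ = ≤-trans (≤-by (q * q) (eq₃ p) (0≤* 0≤q 0≤q)) (*-monoˡ (0≤fromℕ 2) q≤y)

  sharpenBits : ℕ → ℕ → ℕ
  sharpenBits zero    c = c
  sharpenBits (suc d) c = (b ℕ.+ b) ℕ.+ (b ℕ.+ b)
    where b = sharpenBits d c

  iterate : ∀ d → Randomized n c r → Randomized n (sharpenBits d c) r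
  iterate zero    R = R
  iterate (suc d) R = sharpen (iterate d R)

  0≤½ : 0ℚ ≤ ½
  0≤½ = nonNegative⁻¹ ½

  ≤! : ∀ p q → {_ : True (p ≤? q)} → p ≤ q
  ≤! p q {w} = toWitness w

  -- Quadratic decrease is only used as halving, which is valid below 1/4 for acceptance (k = 2) and
  -- below 1/8 for rejection (k = 4).
  sharpen-shrinks : ∀ {k x y} → 0ℚ ≤ x → x ≤ y → k * y ≤ ½ → 0ℚ ≤ k → k * (x * x) ≤ ½ * y
  sharpen-shrinks {k} {x} {y} 0≤x x≤y ky≤½ 0≤k = begin
    k * (x * x)  ≤⟨ *-monoˡ 0≤k (*-mono 0≤x 0≤y x≤y x≤y) ⟩
    k * (y * y)  ≡⟨ *-assoc k y y ⟨
    k * y * y    ≤⟨ *-monoʳ 0≤y ky≤½ ⟩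
    ½ * y        ∎
    where 0≤y = ≤-trans 0≤x x≤y

  -- The starting value 3/8 lies above the halving threshold 1/4; two rounds bring it down by 3/8 →
  -- 9/32 → 81/512.
  accept-sharpen² : (R : Randomized n c r) → ∀ v u → accept R v u ≤ + 3 / 8 → accept (sharpen (sharpen R)) v u ≤ + 1 / 4
  accept-sharpen² R v u p = begin
    accept (sharpen (sharpen R)) v u       ≤⟨ accept-sharpen-≤ (sharpen R) {+ 9 / 32} v u (accept-sharpen-≤ R {+ 3 / 8} v u p) ⟩
    fromℕ 2 * (+ 9 / 32 * (+ 9 / 32))      ≤⟨ ≤! (fromℕ 2 * (+ 9 / 32 * (+ 9 / 32))) (+ 1 / 4) ⟩
    + 1 / 4                                ∎

  accept-iterate : ∀ d (R : Randomized n c r) v u → accept R v u ≤ + 1 / 4 → accept (iterate d R) v u ≤ ½ ^ℚ d * (+ 1 / 4)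
  accept-iterate zero R v u p = ≤-trans p (≤! (+ 1 / 4) (1ℚ * (+ 1 / 4)))
  accept-iterate (suc d) R v u p = begin
    accept (sharpen R′) v u                  ≤⟨ accept-sharpen-≤ R′ v u ≤-refl ⟩
    fromℕ 2 * (a * a)                        ≤⟨ sharpen-shrinks (0≤accept R′ v u) (accept-iterate d R v u p) small (0≤fromℕ 2) ⟩
    ½ * (½ ^ℚ d * (+ 1 / 4))                 ≡⟨ *-assoc ½ (½ ^ℚ d) (+ 1 / 4) ⟨
    ½ ^ℚ suc d * (+ 1 / 4)                   ∎
    where
    R′ = iterate d R
    a = accept R′ v u
    small : fromℕ 2 * (½ ^ℚ d * (+ 1 / 4)) ≤ ½
    small = ≤-trans (*-monoˡ (0≤fromℕ 2) (*-monoʳ (nonNegative⁻¹ (+ 1 / 4)) (^≤1 d 0≤½ (≤! ½ 1ℚ)))) (≤! (fromℕ 2 * (1ℚ * (+ 1 / 4))) ½)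

  reject-iterate : ∀ d (R : Randomized n c r) v u → 1ℚ - accept R v u ≤ + 1 / 8 → 1ℚ - accept (iterate d R) v u ≤ ½ ^ℚ d * (+ 1 / 8)
  reject-iterate zero R v u p = ≤-trans p (≤! (+ 1 / 8) (1ℚ * (+ 1 / 8)))
  reject-iterate (suc d) R v u p = begin
    1ℚ - accept (sharpen R′) v u             ≤⟨ reject-sharpen-≤ R′ v u ≤-refl ⟩
    fromℕ 4 * (a * a)                        ≤⟨ sharpen-shrinks (≤⇒0≤- (accept≤1 R′ v u)) (reject-iterate d R v u p) small (0≤fromℕ 4) ⟩
    ½ * (½ ^ℚ d * (+ 1 / 8))                 ≡⟨ *-assoc ½ (½ ^ℚ d) (+ 1 / 8) ⟨
    ½ ^ℚ suc d * (+ 1 / 8)                   ∎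
    where
    R′ = iterate d R
    a = 1ℚ - accept R′ v u
    small : fromℕ 4 * (½ ^ℚ d * (+ 1 / 8)) ≤ ½
    small = ≤-trans (*-monoˡ (0≤fromℕ 4) (*-monoʳ (nonNegative⁻¹ (+ 1 / 8)) (^≤1 d 0≤½ (≤! ½ 1ℚ)))) (≤! (fromℕ 4 * (1ℚ * (+ 1 / 8))) ½)

  never : Randomized n 0 r
  never {r = r} = record { tree = const {X = ⊤} {Y = ⊤} false 0 r ; coins = point tt ; own = λ _ _ → point tt ; other = λ _ _ → point tt }

  any : ∀ k → (ℕ → Randomized n c r) → Randomized n (k ℕ.* c) r
  any zero    R = never
  any (suc k) R = both _∨_ (R k) (any k R)

  accept-any : ∀ k (R : ℕ → Randomized n c r) {x} v u → (∀ i → accept (R i) v u ≤ x) → accept (any k R) v u ≤ fromℕ k * x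
  accept-any {r = r} zero R {x} v u p = ≤-reflexive (trans (cong bit (run-const false 0 r tt tt)) (sym (*-zeroˡ x)))
  accept-any (suc k) R {x} v u p = begin
    accept (any (suc k) R) v u                   ≡⟨ 1-[1-a]≡a (accept (any (suc k) R) v u) ⟨
    1ℚ - (1ℚ - accept (any (suc k) R) v u)       ≡⟨ cong (λ z → 1ℚ - z) (accept-∨ (R k) (any k R) v u) ⟩
    1ℚ - (1ℚ - a) * (1ℚ - b)                     ≤⟨ ≤-by (a * b) (eq₂ a b) (0≤* (0≤accept (R k) v u) (0≤accept (any k R) v u)) ⟩
    a + b   ≤⟨ +-mono-≤ (p k) (accept-any k R v u p) ⟩
    x + fromℕ k * x                              ≡⟨ eq₃ (fromℕ k) x ⟩
    (1ℚ + fromℕ k) * x                           ≡⟨ cong (_* x) (fromℕ-suc k) ⟨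
    fromℕ (suc k) * x                            ∎
    where
    a = accept (R k) v u
    b = accept (any k R) v u
    eq₂ : ∀ a b → a + b ≡ (1ℚ - (1ℚ - a) * (1ℚ - b)) + a * b
    eq₂ = solve-∀ ℚ-ring
    eq₃ : ∀ k x → x + k * x ≡ (1ℚ + k) * x
    eq₃ = solve-∀ ℚ-ring

  reject-any : ∀ {k} (R : ℕ → Randomized n c r) v u {i} → i ℕ.< k → 1ℚ - accept (any k R) v u ≤ 1ℚ - accept (R i) v u
  reject-any {k = suc k} R v u {i} i<1+k = subst (_≤ 1ℚ - accept (R i) v u) (sym (accept-∨ (R k) (any k R) v u)) (bound (ℕ.m≤n⇒m<n∨m≡n (ℕ.≤-pred i<1+k)))
    where
    a = 1ℚ - accept (R k) v u
    b = 1ℚ - accept (any k R) v u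
    0≤a : 0ℚ ≤ a
    0≤a = ≤⇒0≤- (accept≤1 (R k) v u)
    0≤b : 0ℚ ≤ b
    0≤b = ≤⇒0≤- (accept≤1 (any k R) v u)
    1-≤1 : ∀ {x} → 0ℚ ≤ x → 1ℚ - x ≤ 1ℚ
    1-≤1 {x} = ≤-by x (1≡[1-a]+a x)
    bound : (i ℕ.< k) ⊎ (i ≡ k) → a * b ≤ 1ℚ - accept (R i) v u
    bound (inj₁ i<k) = ≤-trans (*-monoʳ 0≤b (1-≤1 (0≤accept (R k) v u))) (≤-trans (≤-reflexive (*-identityˡ b)) (reject-any R v u i<k))
    bound (inj₂ refl) = ≤-trans (*-monoˡ 0≤a (1-≤1 (0≤accept (any k R) v u))) (≤-reflexive (*-identityʳ a))

  -- Averaging in the order of dependence: the shared coins are fixed globally, then a sample a for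
  -- each v, then a sample b for each u. The chain below starts from the final tree and so undoes
  -- these choices in reverse.
  derandomize : .{{_ : ℕ.NonZero n}} (R : Randomized n c r) {ε : ℚ} →
    (E (inputs n) λ v → E (inputs n) λ u → value R (λ b → wrong b (EE v u)) v u) ≤ ε →
    ∃[ T ] treeError {n} {c} {r} T ≤ ε
  derandomize {n} R {ε} p = toTree (pullback a b (tree R)) , (begin
    (E I λ v → E I λ u → wrong (runTree (toTree (pullback a b (tree R))) v u) (EE v u))
      ≡⟨ (E-cong I λ v → E-cong I λ u → cong (λ z → wrong z (EE v u)) (trans (run-toTree (pullback a b (tree R)) v u) (run-pullback a b (tree R) v u))) ⟩
    (E I λ v → E I λ u → W (a v) (b u) v u)
      ≡⟨ E-swap I I _ ⟩
    (E I λ u → E I λ v → W (a v) (b u) v u)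
      ≤⟨ E-mono I (λ u → proj₂ (pick-b u)) ⟩
    (E I λ u → E (other R ω u) λ b → E I λ v → W (a v) b v u)
      ≡⟨ (E-cong I λ u → E-swap (other R ω u) I _) ⟩
    (E I λ u → E I λ v → E (other R ω u) λ b → W (a v) b v u)
      ≡⟨ E-swap I I _ ⟩
    (E I λ v → E I λ u → E (other R ω u) λ b → W (a v) b v u)
      ≤⟨ E-mono I (λ v → proj₂ (pick-a v)) ⟩
    (E I λ v → E (own R ω v) λ a → E I λ u → E (other R ω u) λ b → W a b v u)
      ≤⟨ proj₂ pick-ω ⟩
    (E (coins R) λ ω → E I λ v → E (own R ω v) λ a → E I λ u → E (other R ω u) λ b → W a b v u)
      ≡⟨ E-swap (coins R) I _ ⟩
    (E I λ v → E (coins R) λ ω → E (own R ω v) λ a → E I λ u → E (other R ω u) λ b → W a b v u)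
      ≡⟨ (E-cong I λ v → trans (E-cong (coins R) λ ω → E-swap (own R ω v) I _) (E-swap (coins R) I _)) ⟩
    (E I λ v → E I λ u → value R (λ b → wrong b (EE v u)) v u)
      ≤⟨ p ⟩
    ε ∎)
    where
    I = inputs n
    W : Own R → Other R → Input n → Input n → ℚ
    W a b v u = wrong (runExact (tree R) a b) (EE v u)
    pick-ω = E-pick (coins R) λ ω → E I λ v → E (own R ω v) λ a → E I λ u → E (other R ω u) λ b → W a b v u
    ω = proj₁ pick-ω
    pick-a = λ v → E-pick (own R ω v) λ a → E I λ u → E (other R ω u) λ b → W a b v u
    a = λ v → proj₁ (pick-a v)
    pick-b = λ u → E-pick (other R ω u) λ b → E I λ v → W (a v) b v u
    b = λ u → proj₁ (pick-b u)

open RandomizedProtocols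

-- Sampling an input coordinate by coordinate

module Coupling (t : ℕ) .{{t≢0 : ℕ.NonZero t}} (τ M : ℚ) (0≤τ : 0ℚ ≤ τ) (τ≤½ : τ ≤ ½) (τM≤1 : τ * M ≤ 1ℚ) where

  U : Dist (Fin t)
  U = unif t

  T : ℚ
  T = fromℕ t

  E-Tδ : (i : Fin t) (f : Fin t → ℚ) → E U (λ j → T * (δ i j * f j)) ≡ f i
  E-Tδ i f = trans (E-* U T (λ j → δ i j * f j)) (trans (cong (T *_) (E-δ t i f))
    (trans (sym (*-assoc T (T ⁻¹) (f i))) (trans (cong (_* f i) (*-⁻¹ (0<fromℕ t))) (*-identityˡ (f i)))))

  module Step (w : Fin t → ℚ) (0≤w : ∀ a → 0ℚ ≤ w a) (Ew≡1 : E U w ≡ 1ℚ)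
              (good : Fin t → Bool) (good⇒≤M : ∀ a → good a ≡ true → w a ≤ M) where

    -- Asked for z, Alice keeps it with probability h z and otherwise samples from the residual
    -- density ρ, so that her coordinate has density w.
    h : Fin t → ℚ
    h a = τ * (bit (good a) * w a)

    gw≤w : ∀ a → bit (good a) * w a ≤ w a
    gw≤w a = ≤-trans (*-monoʳ (0≤w a) (bit≤1 (good a))) (≤-reflexive (*-identityˡ (w a)))

    0≤h : ∀ a → 0ℚ ≤ h a
    0≤h a = 0≤* 0≤τ (0≤* (0≤bit (good a)) (0≤w a))

    h≤τw : ∀ a → h a ≤ τ * w a
    h≤τw a = *-monoˡ 0≤τ (gw≤w a)

    h≤1 : ∀ a → h a ≤ 1ℚ
    h≤1 a with good a in eq
    ... | false = ≤-trans (≤-reflexive (trans (cong (τ *_) (*-zeroˡ (w a))) (*-zeroʳ τ))) 0≤1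
    ... | true  = ≤-trans (*-monoˡ 0≤τ (≤-trans (≤-reflexive (*-identityˡ (w a))) (good⇒≤M a eq))) τM≤1

    h≤w : ∀ a → h a ≤ w a
    h≤w a = ≤-trans (h≤τw a) (≤-trans (*-monoʳ (0≤w a) (≤-trans τ≤½ (≤! ½ 1ℚ))) (≤-reflexive (*-identityˡ (w a))))

    g : ℚ
    g = E U h

    g≤τ : g ≤ τ
    g≤τ = ≤-trans (E-mono U h≤τw) (≤-reflexive (trans (E-* U τ w) (trans (cong (τ *_) Ew≡1) (*-identityʳ τ))))

    ½≤1-g : ½ ≤ 1ℚ - g
    ½≤1-g = ≤-trans (≤! ½ (1ℚ - ½)) (+-monoʳ-≤ 1ℚ (neg-antimono-≤ (≤-trans g≤τ τ≤½)))

    0<1-g : 0ℚ < 1ℚ - g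
    0<1-g = <-≤-trans (positive⁻¹ ½) ½≤1-g

    k : ℚ
    k = (1ℚ - g) ⁻¹

    0≤k : 0ℚ ≤ k
    0≤k = 0≤⁻¹ (<⇒≤ 0<1-g)

    -- The source of the factor 1 + 2τ in all density bounds: (1 - τ)(1 + 2τ) ≥ 1 because τ ≤ 1/2.
    k≤ : k ≤ 1ℚ + fromℕ 2 * τ
    k≤ = *-cancelˡ 0<1-g (begin
      (1ℚ - g) * k                       ≡⟨ *-⁻¹ 0<1-g ⟩
      1ℚ                                 ≤⟨ ≤-by ((½ - τ) * (fromℕ 2 * τ)) (eq₁ τ) (0≤* (≤⇒0≤- τ≤½) (0≤* (0≤fromℕ 2) 0≤τ)) ⟩
      (1ℚ - τ) * (1ℚ + fromℕ 2 * τ)      ≤⟨ *-monoʳ (0≤+ 0≤1 (0≤* (0≤fromℕ 2) 0≤τ)) (+-monoʳ-≤ 1ℚ (neg-antimono-≤ g≤τ)) ⟩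
      (1ℚ - g) * (1ℚ + fromℕ 2 * τ)      ∎)
      where
      eq₁ : ∀ τ → (1ℚ - τ) * (1ℚ + fromℕ 2 * τ) ≡ 1ℚ + (½ - τ) * (fromℕ 2 * τ)
      eq₁ = solve-∀ ℚ-ring

    ρ : Fin t → ℚ
    ρ a = (w a - h a) * k

    0≤ρ : ∀ a → 0ℚ ≤ ρ a
    0≤ρ a = 0≤* (≤⇒0≤- (h≤w a)) 0≤k

    ρ≤ : ∀ a → ρ a ≤ (1ℚ + fromℕ 2 * τ) * w a
    ρ≤ a = begin
      (w a - h a) * k                ≤⟨ *-monoʳ {a = w a - h a} 0≤k (≤-by (h a) (eq (w a) (h a)) (0≤h a)) ⟩
      w a * k                        ≤⟨ *-monoˡ (0≤w a) k≤ ⟩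
      w a * (1ℚ + fromℕ 2 * τ)       ≡⟨ *-comm (w a) _ ⟩
      (1ℚ + fromℕ 2 * τ) * w a       ∎
      where
      eq : ∀ a b → a ≡ (a - b) + b
      eq = solve-∀ ℚ-ring

    [1-g]*ρ : ∀ a → (1ℚ - g) * ρ a ≡ w a - h a
    [1-g]*ρ a = trans (x∙yz≈y∙xz (1ℚ - g) (w a - h a) k) (trans (cong ((w a - h a) *_) (*-⁻¹ 0<1-g)) (*-identityʳ _))

    Eρ≡1 : E U ρ ≡ 1ℚ
    Eρ≡1 = begin-equality
      E U ρ                          ≡⟨ E-*ʳ U k (λ a → w a - h a) ⟩
      E U (λ a → w a - h a) * k      ≡⟨ cong (_* k) (trans (E-- U w h) (cong (λ z → z - g) Ew≡1)) ⟩
      (1ℚ - g) * k                   ≡⟨ *-⁻¹ 0<1-g ⟩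
      1ℚ                             ∎

    -- `choose` takes point masses while ρ is a density relative to the uniform law, hence the
    -- factor `T ⁻¹`.
    weight : Fin t → Fin t → ℚ
    weight z x = h z * δ z x + (1ℚ - h z) * (T ⁻¹ * ρ x)

    sum-weight : ∀ z (f : Fin t → ℚ) → sum (λ x → weight z x * f x) ≡ h z * f z + (1ℚ - h z) * E U (λ x → ρ x * f x)
    sum-weight z f = begin-equality
      sum (λ x → weight z x * f x)
        ≡⟨ sum-cong-≗ (λ x → eq (h z) (δ z x) (1ℚ - h z) (T ⁻¹) (ρ x) (f x)) ⟩
      sum (λ x → h z * (δ z x * f x) + (1ℚ - h z) * (T ⁻¹ * (ρ x * f x)))
        ≡⟨ ∑-distrib-+ (λ x → h z * (δ z x * f x)) (λ x → (1ℚ - h z) * (T ⁻¹ * (ρ x * f x))) ⟩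
      sum (λ x → h z * (δ z x * f x)) + sum (λ x → (1ℚ - h z) * (T ⁻¹ * (ρ x * f x)))
        ≡⟨ cong₂ _+_ (trans (sym (*-distribˡ-sum (h z) (λ x → δ z x * f x))) (cong (h z *_) (sum-δ z f)))
                     (sym (*-distribˡ-sum (1ℚ - h z) (λ x → T ⁻¹ * (ρ x * f x)))) ⟩
      h z * f z + (1ℚ - h z) * E U (λ x → ρ x * f x) ∎
      where
      eq : ∀ h d h′ q ρ f → (h * d + h′ * (q * ρ)) * f ≡ h * (d * f) + h′ * (q * (ρ * f))
      eq = solve-∀ ℚ-ring

    step : Fin t → Dist (Fin t)
    step z = choose (weight z)
      (λ x → 0≤+ (0≤* (0≤h z) (0≤bit (does (z Fin.≟ x)))) (0≤* (≤⇒0≤- (h≤1 z)) (0≤* (0≤⁻¹ (0≤fromℕ t)) (0≤ρ x))))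
      (begin-equality
        sum (weight z)   ≡⟨ sum-cong-≗ (λ x → *-identityʳ (weight z x)) ⟨
        sum (λ x → weight z x * 1ℚ)                            ≡⟨ sum-weight z (λ _ → 1ℚ) ⟩
        h z * 1ℚ + (1ℚ - h z) * E U (λ x → ρ x * 1ℚ)           ≡⟨ cong (λ e → h z * 1ℚ + (1ℚ - h z) * e) (trans (E-cong U λ x → *-identityʳ (ρ x)) Eρ≡1) ⟩
        h z * 1ℚ + (1ℚ - h z) * 1ℚ                             ≡⟨ eq (h z) ⟩
        1ℚ                                                     ∎)
      where
      eq : ∀ a → a * 1ℚ + (1ℚ - a) * 1ℚ ≡ 1ℚ
      eq = solve-∀ ℚ-ring

    E-step : ∀ z (f : Fin t → ℚ) → E (step z) f ≡ h z * f z + (1ℚ - h z) * E U (λ x → ρ x * f x)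
    E-step = sum-weight

    -- For uniform z the kept part has density h and the resampled part (1 - g)ρ = w - h; together
    -- they make w.
    marginal : (f : Fin t → ℚ) → E U (λ z → E (step z) f) ≡ E U (λ x → w x * f x)
    marginal f = begin-equality
      E U (λ z → E (step z) f)                                ≡⟨ E-cong U (λ z → E-step z f) ⟩
      E U (λ z → h z * f z + (1ℚ - h z) * c)                  ≡⟨ E-+ U (λ z → h z * f z) (λ z → (1ℚ - h z) * c) ⟩
      E U (λ z → h z * f z) + E U (λ z → (1ℚ - h z) * c)      ≡⟨ cong (_+_ (E U (λ z → h z * f z))) (trans (E-*ʳ U c (λ z → 1ℚ - h z)) (cong (_* c) (E-1- U h))) ⟩
      E U (λ z → h z * f z) + (1ℚ - g) * c                    ≡⟨ cong (_+_ (E U (λ z → h z * f z))) (E-* U (1ℚ - g) (λ x → ρ x * f x)) ⟨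
      E U (λ z → h z * f z) + E U (λ x → (1ℚ - g) * (ρ x * f x)) ≡⟨ E-+ U (λ z → h z * f z) _ ⟨
      E U (λ x → h x * f x + (1ℚ - g) * (ρ x * f x))          ≡⟨ E-cong U (λ x → trans (eq₁ (h x) (f x) (1ℚ - g) (ρ x)) (trans (cong (λ e → (h x + e) * f x) ([1-g]*ρ x)) (eq₂ (h x) (w x) (f x)))) ⟩
      E U (λ x → w x * f x)                                   ∎
      where
      c = E U (λ x → ρ x * f x)
      eq₁ : ∀ h f g ρ → h * f + g * (ρ * f) ≡ (h + g * ρ) * f
      eq₁ = solve-∀ ℚ-ring
      eq₂ : ∀ h w f → (h + (w - h)) * f ≡ w * f
      eq₂ = solve-∀ ℚ-ring

    -- The kept part lives on the diagonal, whose density relative to the product law is T δ, with h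
    -- ≤ τ w; the resampled part is at most ρ ≤ (1 + 2τ) w, independently of z.
    coupled-≤ : (G : Fin t → Fin t → ℚ) → (∀ x y → 0ℚ ≤ G x y) →
      E U (λ z → E (step z) (λ x → G x z)) ≤ E U λ x → E U λ y → w x * ((1ℚ + fromℕ 2 * τ) + τ * T * δ x y) * G x y
    coupled-≤ G 0≤G = begin
      E U (λ z → E (step z) (λ x → G x z))
        ≤⟨ E-mono U (λ z → ≤-trans (≤-reflexive (E-step z (λ x → G x z))) (+-mono-≤ (*-monoʳ (0≤G z z) (h≤τw z))
             (≤-trans (*-monoʳ (E-0≤ U λ x → 0≤* (0≤ρ x) (0≤G x z)) (1-h≤1 z)) (≤-trans (≤-reflexive (*-identityˡ _)) (E-mono U λ x → *-monoʳ (0≤G x z) (ρ≤ x)))))) ⟩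
      E U (λ z → τ * w z * G z z + E U λ x → c * w x * G x z)
        ≡⟨ E-+ U (λ z → τ * w z * G z z) _ ⟩
      E U (λ z → τ * w z * G z z) + (E U λ z → E U λ x → c * w x * G x z)
        ≡⟨ cong₂ _+_ (E-cong U λ x → sym (E-Tδ x (λ y → τ * w x * G x y))) (E-swap U U _) ⟩
      (E U λ x → E U λ y → T * (δ x y * (τ * w x * G x y))) + (E U λ x → E U λ y → c * w x * G x y)
        ≡⟨ E-+ U _ _ ⟨
      E U (λ x → (E U λ y → T * (δ x y * (τ * w x * G x y))) + (E U λ y → c * w x * G x y))
        ≡⟨ E-cong U (λ x → trans (sym (E-+ U _ _)) (E-cong U λ y → eq T (δ x y) τ (w x) (G x y) c)) ⟩
      (E U λ x → E U λ y → w x * (c + τ * T * δ x y) * G x y) ∎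
      where
      c = 1ℚ + fromℕ 2 * τ
      1-h≤1 : ∀ z → 1ℚ - h z ≤ 1ℚ
      1-h≤1 z = ≤-by (h z) (1≡[1-a]+a (h z)) (0≤h z)
      eq : ∀ T d τ w G c → T * (d * (τ * w * G)) + c * w * G ≡ w * (c + τ * T * d) * G
      eq = solve-∀ ℚ-ring

    -- A kept letter equals z and contributes nothing. What remains is the resampled mass (1 - g)ρ =
    -- w - h, which is w (1 - τ) at good letters.
    coupled-avoid : (H : Fin t → ℚ) → (∀ x → 0ℚ ≤ H x) →
      E U (λ z → E (step z) (λ x → (1ℚ + - 1ℚ * δ x z) * H x)) ≤ E U λ x → w x * (1ℚ - τ * bit (good x)) * H x
    coupled-avoid H 0≤H = begin
      E U (λ z → E (step z) (λ x → (1ℚ + - 1ℚ * δ x z) * H x))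
        ≤⟨ E-mono U bound ⟩
      E U (λ z → (1ℚ - h z) * E U (λ x → ρ x * H x))
        ≡⟨ trans (E-*ʳ U (E U (λ x → ρ x * H x)) (λ z → 1ℚ - h z)) (cong (λ e → e * E U (λ x → ρ x * H x)) (E-1- U h)) ⟩
      (1ℚ - g) * E U (λ x → ρ x * H x)
        ≡⟨ E-* U (1ℚ - g) (λ x → ρ x * H x) ⟨
      E U (λ x → (1ℚ - g) * (ρ x * H x))
        ≡⟨ E-cong U (λ x → trans (sym (*-assoc (1ℚ - g) (ρ x) (H x))) (trans (cong (_* H x) ([1-g]*ρ x)) (eq (w x) τ (bit (good x)) (H x)))) ⟩
      E U (λ x → w x * (1ℚ - τ * bit (good x)) * H x) ∎
      where
      eq : ∀ w τ b H → (w - τ * (b * w)) * H ≡ w * (1ℚ - τ * b) * H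
      eq = solve-∀ ℚ-ring
      δ-refl : ∀ (i : Fin t) → δ i i ≡ 1ℚ
      δ-refl i with i Fin.≟ i
      ... | yes _ = refl
      ... | no ¬p = contradiction refl ¬p
      zeroTerm : ∀ z → h z * ((1ℚ + - 1ℚ * δ z z) * H z) ≡ 0ℚ
      zeroTerm z = trans (cong (λ d → h z * ((1ℚ + - 1ℚ * d) * H z)) (δ-refl z)) (e (h z) (H z))
        where
        e : ∀ a b → a * ((1ℚ + - 1ℚ * 1ℚ) * b) ≡ 0ℚ
        e = solve-∀ ℚ-ring
      1-δ≤1 : ∀ x z → (1ℚ + - 1ℚ * δ x z) * H x ≤ H x
      1-δ≤1 x z = ≤-by (δ x z * H x) (e (δ x z) (H x)) (0≤* (0≤bit (does (x Fin.≟ z))) (0≤H x))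
        where
        e : ∀ d b → b ≡ (1ℚ + - 1ℚ * d) * b + d * b
        e = solve-∀ ℚ-ring
      bound : ∀ z → E (step z) (λ x → (1ℚ + - 1ℚ * δ x z) * H x) ≤ (1ℚ - h z) * E U (λ x → ρ x * H x)
      bound z = begin
        E (step z) (λ x → (1ℚ + - 1ℚ * δ x z) * H x)
          ≡⟨ E-step z _ ⟩
        h z * ((1ℚ + - 1ℚ * δ z z) * H z) + (1ℚ - h z) * E U (λ x → ρ x * ((1ℚ + - 1ℚ * δ x z) * H x))
          ≡⟨ trans (cong (λ e → e + (1ℚ - h z) * E U (λ x → ρ x * ((1ℚ + - 1ℚ * δ x z) * H x))) (zeroTerm z)) (+-identityˡ _) ⟩
        (1ℚ - h z) * E U (λ x → ρ x * ((1ℚ + - 1ℚ * δ x z) * H x))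
          ≤⟨ *-monoˡ (≤⇒0≤- (h≤1 z)) (E-mono U λ x → *-monoˡ (0≤ρ x) (1-δ≤1 x z)) ⟩
        (1ℚ - h z) * E U (λ x → ρ x * H x) ∎

-- The kernel on vectors and the joint law of (x, y)

does-true : {P : Set} (d : Dec P) → does d ≡ true → P
does-true (yes p) _ = p

module Kernel (t : ℕ) .{{t≢0 : ℕ.NonZero t}} (τ M : ℚ) (0≤τ : 0ℚ ≤ τ) (τ≤½ : τ ≤ ½) (τM≤1 : τ * M ≤ 1ℚ) where

  open Coupling t τ M 0≤τ τ≤½ τM≤1 public

  private variable
    n : ℕ

  Weight : ℕ → Set
  Weight n = Vec (Fin t) n → ℚ

  NonNeg : Weight n → Set
  NonNeg s = ∀ x → 0ℚ ≤ s x

  uniform : ∀ n → Dist (Vec (Fin t) n)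
  uniform = iid U

  μ : Weight n → ℚ
  μ {n} s = E (uniform n) s

  infixl 9 _▹_
  _▹_ : Weight (suc n) → Fin t → Weight n
  (s ▹ a) x = s (a ∷ x)

  0≤μ : {s : Weight n} → NonNeg s → 0ℚ ≤ μ s
  0≤μ {n} 0≤s = E-0≤ (uniform n) 0≤s

  -- The condition w(a) ≤ M cleared of the denominator μ s.
  good : Weight (suc n) → Fin t → Bool
  good s a = does (μ (s ▹ a) ≤? M * μ s)

  module Conditional (s : Weight (suc n)) (0≤s : NonNeg s) (0<μs : 0ℚ < μ s) where

    w : Fin t → ℚ
    w a = μ (s ▹ a) * μ s ⁻¹

    μ*w : ∀ a → μ s * w a ≡ μ (s ▹ a)
    μ*w a = trans (x∙yz≈y∙xz (μ s) (μ (s ▹ a)) (μ s ⁻¹)) (trans (cong (μ (s ▹ a) *_) (*-⁻¹ 0<μs)) (*-identityʳ _))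

    0≤w : ∀ a → 0ℚ ≤ w a
    0≤w a = 0≤* (0≤μ (0≤s ∘ (a ∷_))) (0≤⁻¹ (<⇒≤ 0<μs))

    Ew≡1 : E U w ≡ 1ℚ
    Ew≡1 = trans (E-*ʳ U (μ s ⁻¹) (λ a → μ (s ▹ a))) (*-⁻¹ 0<μs)

    good⇒≤M : ∀ a → good s a ≡ true → w a ≤ M
    good⇒≤M a p = *-cancelˡ 0<μs (≤-trans (≤-reflexive (μ*w a)) (≤-trans (does-true (μ (s ▹ a) ≤? M * μ s) p) (≤-reflexive (*-comm M (μ s)))))

    open Step w 0≤w Ew≡1 (good s) good⇒≤M public

  -- The decision is an argument so that proofs can branch on it. A prefix of mass zero has no
  -- conditional density; returning z there is harmless because every estimate carries the factor μ
  -- s.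
  firstIf : (s : Weight (suc n)) → NonNeg s → Dec (0ℚ < μ s) → Fin t → Dist (Fin t)
  firstIf s 0≤s (yes 0<μs) z = Conditional.step s 0≤s 0<μs z
  firstIf s 0≤s (no _)     z = point z

  first : (s : Weight (suc n)) → NonNeg s → Fin t → Dist (Fin t)
  first s 0≤s = firstIf s 0≤s (0ℚ <? μ s)

  kernel : (s : Weight n) → NonNeg s → Vec (Fin t) n → Dist (Vec (Fin t) n)
  kernel s 0≤s []       = point []
  kernel s 0≤s (z ∷ zs) = bind (first s 0≤s z) λ a → bind (kernel (s ▹ a) (0≤s ∘ (a ∷_)) zs) λ as → point (a ∷ as)

  -- The law of the two letters of one coordinate: with chance θ both are the same value of φ,
  -- otherwise they are independent.
  mixed : ℚ → (Fin t → Fin t → ℚ) → ℚ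
  mixed θ G = θ * (E U λ a → G a a) + (1ℚ - θ) * (E U λ a → E U λ b → G a b)

  module Mixed (θ : ℚ) (0≤θ : 0ℚ ≤ θ) (θ≤1 : θ ≤ 1ℚ) where

    -- α + β δ bounds the density of one coordinate pair; β contains T because the diagonal has mass
    -- 1/T.
    α β : ℚ
    α = 1ℚ + fromℕ 2 * (θ * τ)
    β = θ * τ * T

    0≤α : 0ℚ ≤ α
    0≤α = 0≤+ 0≤1 (0≤* (0≤fromℕ 2) (0≤* 0≤θ 0≤τ))

    0≤β : 0ℚ ≤ β
    0≤β = 0≤* (0≤* 0≤θ 0≤τ) (0≤fromℕ t)

    mixed-mono : {F G : Fin t → Fin t → ℚ} → (∀ a b → F a b ≤ G a b) → mixed θ F ≤ mixed θ G
    mixed-mono F≤G = +-mono-≤ (*-monoˡ 0≤θ (E-mono U λ a → F≤G a a)) (*-monoˡ (≤⇒0≤- θ≤1) (E-mono U λ a → E-mono U λ b → F≤G a b))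

    μ≯0 : (s : Weight (suc n)) → NonNeg s → ¬ 0ℚ < μ s → ∀ q {r} → 0ℚ ≤ r → μ s * q ≤ r
    μ≯0 s 0≤s μ≯0 q {r} 0≤r = ≤-trans (≤-reflexive (trans (cong (_* q) (≤-antisym (≮⇒≥ μ≯0) (0≤μ 0≤s))) (*-zeroˡ q))) 0≤r

    0≤factor : ∀ (x y : Fin t) → 0ℚ ≤ α + β * δ x y
    0≤factor x y = 0≤+ 0≤α (0≤* 0≤β (0≤bit (does (x Fin.≟ y))))

    density-step : (s : Weight (suc n)) (0≤s : NonNeg s) (0<μs : 0ℚ < μ s) (G : Fin t → Fin t → ℚ) → (∀ x y → 0ℚ ≤ G x y) →
      let open Conditional s 0≤s 0<μs in
      mixed θ (λ z y → E (step z) (λ x → G x y)) ≤ E U λ x → E U λ y → w x * (α + β * δ x y) * G x y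
    density-step s 0≤s 0<μs G 0≤G = begin
      mixed θ (λ z y → E (step z) (λ x → G x y))
        ≤⟨ +-mono-≤ (*-monoˡ 0≤θ (coupled-≤ G 0≤G)) (≤-reflexive (cong ((1ℚ - θ) *_) (trans (E-swap U U _) (trans (E-cong U λ b → marginal (λ x → G x b)) (E-swap U U _))))) ⟩
      θ * (E U λ x → E U λ y → w x * (c + τ * T * δ x y) * G x y) + (1ℚ - θ) * (E U λ x → E U λ y → w x * G x y)
        ≡⟨ cong₂ _+_ (E²-* θ _) (E²-* (1ℚ - θ) _) ⟨
      (E U λ x → E U λ y → θ * (w x * (c + τ * T * δ x y) * G x y)) + (E U λ x → E U λ y → (1ℚ - θ) * (w x * G x y))
        ≡⟨ trans (E-cong U λ x → E-+ U _ _) (E-+ U _ _) ⟨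
      (E U λ x → E U λ y → θ * (w x * (c + τ * T * δ x y) * G x y) + (1ℚ - θ) * (w x * G x y))
        ≡⟨ (E-cong U λ x → E-cong U λ y → eq θ (w x) τ T (δ x y) (G x y)) ⟩
      (E U λ x → E U λ y → w x * (α + β * δ x y) * G x y) ∎
      where
      open Conditional s 0≤s 0<μs
      c = 1ℚ + fromℕ 2 * τ
      E²-* : ∀ q (F : Fin t → Fin t → ℚ) → (E U λ x → E U λ y → q * F x y) ≡ q * (E U λ x → E U λ y → F x y)
      E²-* q F = trans (E-cong U λ x → E-* U q (F x)) (E-* U q _)
      eq : ∀ θ w τ T d G → θ * (w * ((1ℚ + fromℕ 2 * τ) + τ * T * d) * G) + (1ℚ - θ) * (w * G) ≡ w * ((1ℚ + fromℕ 2 * (θ * τ)) + θ * τ * T * d) * G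
      eq = solve-∀ ℚ-ring

    -- The factor μ s turns the conditional density w into μ(s ▹ x), the normalization that the
    -- induction over coordinates needs next. If μ s = 0, the left side vanishes.
    density-first : (s : Weight (suc n)) (0≤s : NonNeg s) (G : Fin t → Fin t → ℚ) → (∀ x y → 0ℚ ≤ G x y) →
      μ s * mixed θ (λ z y → E (first s 0≤s z) (λ x → G x y)) ≤ E U λ x → E U λ y → (α + β * δ x y) * (μ (s ▹ x) * G x y)
    density-first s 0≤s G 0≤G = go (0ℚ <? μ s)
      where
      go : ∀ d → μ s * mixed θ (λ z y → E (firstIf s 0≤s d z) (λ x → G x y)) ≤ E U λ x → E U λ y → (α + β * δ x y) * (μ (s ▹ x) * G x y)
      go (no μs≯0)  = μ≯0 s 0≤s μs≯0 (mixed θ (λ z y → G z y)) (E-0≤ U λ x → E-0≤ U λ y → 0≤* (0≤factor x y) (0≤* (0≤μ (0≤s ∘ (x ∷_))) (0≤G x y)))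
      go (yes 0<μs) = begin
        μ s * mixed θ (λ z y → E (step z) (λ x → G x y))
          ≤⟨ *-monoˡ (<⇒≤ 0<μs) (density-step s 0≤s 0<μs G 0≤G) ⟩
        μ s * (E U λ x → E U λ y → w x * (α + β * δ x y) * G x y)
          ≡⟨ trans (E-cong U λ x → E-* U (μ s) _) (E-* U (μ s) _) ⟨
        (E U λ x → E U λ y → μ s * (w x * (α + β * δ x y) * G x y))
          ≡⟨ (E-cong U λ x → E-cong U λ y → trans (eq (μ s) (w x) (α + β * δ x y) (G x y)) (cong (λ e → (α + β * δ x y) * (e * G x y)) (μ*w x))) ⟩
        (E U λ x → E U λ y → (α + β * δ x y) * (μ (s ▹ x) * G x y)) ∎
        where
        open Conditional s 0≤s 0<μs
        eq : ∀ m w d G → m * (w * d * G) ≡ d * (m * w * G)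
        eq = solve-∀ ℚ-ring

    θτ≤1 : θ * τ ≤ 1ℚ
    θτ≤1 = ≤-trans (*-mono 0≤θ 0≤½ θ≤1 τ≤½) (≤! (1ℚ * ½) 1ℚ)

    0≤1-θτb : ∀ b → 0ℚ ≤ 1ℚ - θ * τ * bit b
    0≤1-θτb b = ≤⇒0≤- (≤-trans (*-mono (0≤* 0≤θ 0≤τ) 0≤1 θτ≤1 (bit≤1 b)) (≤! (1ℚ * 1ℚ) 1ℚ))

    -- On the independent branch the factor for x ≠ y is dropped; only the matched branch, of weight
    -- θ, earns the factor 1 - τ at good letters.
    avoid-step : (s : Weight (suc n)) (0≤s : NonNeg s) (0<μs : 0ℚ < μ s) (H : Fin t → ℚ) → (∀ x → 0ℚ ≤ H x) →
      let open Conditional s 0≤s 0<μs in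
      mixed θ (λ z y → E (step z) (λ x → (1ℚ + - 1ℚ * δ x y) * H x)) ≤ E U λ x → w x * (1ℚ - θ * τ * bit (good s x)) * H x
    avoid-step s 0≤s 0<μs H 0≤H = begin
      mixed θ (λ z y → E (step z) (λ x → (1ℚ + - 1ℚ * δ x y) * H x))
        ≤⟨ +-mono-≤ (*-monoˡ 0≤θ (coupled-avoid H 0≤H)) (*-monoˡ (≤⇒0≤- θ≤1) independent) ⟩
      θ * E U (λ x → w x * (1ℚ - τ * bit (good s x)) * H x) + (1ℚ - θ) * E U (λ x → w x * H x)
        ≡⟨ cong₂ _+_ (E-* U θ _) (E-* U (1ℚ - θ) _) ⟨
      E U (λ x → θ * (w x * (1ℚ - τ * bit (good s x)) * H x)) + E U (λ x → (1ℚ - θ) * (w x * H x))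
        ≡⟨ E-+ U _ _ ⟨
      E U (λ x → θ * (w x * (1ℚ - τ * bit (good s x)) * H x) + (1ℚ - θ) * (w x * H x))
        ≡⟨ (E-cong U λ x → eq θ (w x) τ (bit (good s x)) (H x)) ⟩
      E U (λ x → w x * (1ℚ - θ * τ * bit (good s x)) * H x) ∎
      where
      open Conditional s 0≤s 0<μs
      eq : ∀ θ w τ b H → θ * (w * (1ℚ - τ * b) * H) + (1ℚ - θ) * (w * H) ≡ w * (1ℚ - θ * τ * b) * H
      eq = solve-∀ ℚ-ring
      1-δ≤1 : ∀ x z → (1ℚ + - 1ℚ * δ x z) * H x ≤ H x
      1-δ≤1 x z = ≤-by (δ x z * H x) (e (δ x z) (H x)) (0≤* (0≤bit (does (x Fin.≟ z))) (0≤H x))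
        where
        e : ∀ d b → b ≡ (1ℚ + - 1ℚ * d) * b + d * b
        e = solve-∀ ℚ-ring
      independent : (E U λ z → E U λ y → E (step z) (λ x → (1ℚ + - 1ℚ * δ x y) * H x)) ≤ E U (λ x → w x * H x)
      independent = begin
        (E U λ z → E U λ y → E (step z) (λ x → (1ℚ + - 1ℚ * δ x y) * H x))  ≤⟨ (E-mono U λ z → E-mono U λ y → E-mono (step z) λ x → 1-δ≤1 x y) ⟩
        (E U λ z → E U λ y → E (step z) H)   ≡⟨ (E-cong U λ z → E-const U (E (step z) H)) ⟩
        (E U λ z → E (step z) H)   ≡⟨ marginal H ⟩
        E U (λ x → w x * H x)                                               ∎

    avoid-first : (s : Weight (suc n)) (0≤s : NonNeg s) (H : Fin t → ℚ) → (∀ x → 0ℚ ≤ H x) →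
      μ s * mixed θ (λ z y → E (first s 0≤s z) (λ x → (1ℚ + - 1ℚ * δ x y) * H x)) ≤ E U λ x → (1ℚ - θ * τ * bit (good s x)) * (μ (s ▹ x) * H x)
    avoid-first s 0≤s H 0≤H = go (0ℚ <? μ s)
      where
      go : ∀ d → μ s * mixed θ (λ z y → E (firstIf s 0≤s d z) (λ x → (1ℚ + - 1ℚ * δ x y) * H x)) ≤ E U λ x → (1ℚ - θ * τ * bit (good s x)) * (μ (s ▹ x) * H x)
      go (no μs≯0)  = μ≯0 s 0≤s μs≯0 (mixed θ (λ z y → (1ℚ + - 1ℚ * δ z y) * H z)) (E-0≤ U λ x → 0≤* (0≤1-θτb (good s x)) (0≤* (0≤μ (0≤s ∘ (x ∷_))) (0≤H x)))
      go (yes 0<μs) = begin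
        μ s * mixed θ (λ z y → E (step z) (λ x → (1ℚ + - 1ℚ * δ x y) * H x))
          ≤⟨ *-monoˡ (<⇒≤ 0<μs) (avoid-step s 0≤s 0<μs H 0≤H) ⟩
        μ s * (E U λ x → w x * (1ℚ - θ * τ * bit (good s x)) * H x)
          ≡⟨ E-* U (μ s) _ ⟨
        (E U λ x → μ s * (w x * (1ℚ - θ * τ * bit (good s x)) * H x))
          ≡⟨ (E-cong U λ x → trans (eq (μ s) (w x) (1ℚ - θ * τ * bit (good s x)) (H x)) (cong (λ e → (1ℚ - θ * τ * bit (good s x)) * (e * H x)) (μ*w x))) ⟩
        (E U λ x → (1ℚ - θ * τ * bit (good s x)) * (μ (s ▹ x) * H x)) ∎
        where
        open Conditional s 0≤s 0<μs
        eq : ∀ m w d G → m * (w * d * G) ≡ d * (m * w * G)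
        eq = solve-∀ ℚ-ring

    -- Bounds the chance of no agreement along x: each good coordinate agrees with chance θτ, and
    -- bad ones are given up.
    miss : Weight n → Vec (Fin t) n → ℚ
    miss s []      = 1ℚ
    miss s (a ∷ x) = (1ℚ - θ * τ * bit (good s a)) * miss (s ▹ a) x

    module Law {Coin : Set} (coin : Dist Coin) (zOf yOf : Coin → Fin t)
               (law : ∀ G → E coin (λ o → G (zOf o) (yOf o)) ≡ mixed θ G) where

      joint : (s : Weight n) → NonNeg s → (Vec (Fin t) n → Vec (Fin t) n → ℚ) → ℚ
      joint {n} s 0≤s f = E (iid coin n) λ ω → E (kernel s 0≤s (Vec.map zOf ω)) λ x → f x (Vec.map yOf ω)

      joint-suc : (s : Weight (suc n)) (0≤s : NonNeg s) (f : Vec (Fin t) (suc n) → Vec (Fin t) (suc n) → ℚ) →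
        joint s 0≤s f ≡ mixed θ (λ z y → E (first s 0≤s z) λ a → joint (s ▹ a) (0≤s ∘ (a ∷_)) λ xs ys → f (a ∷ xs) (y ∷ ys))
      joint-suc {n} s 0≤s f = trans (E-cong coin λ o → E-swap (iid coin n) (first s 0≤s (zOf o)) _) (law _)

      joint-mono : (s : Weight n) (0≤s : NonNeg s) {f g : Vec (Fin t) n → Vec (Fin t) n → ℚ} →
        (∀ x y → f x y ≤ g x y) → joint s 0≤s f ≤ joint s 0≤s g
      joint-mono {n} s 0≤s f≤g = E-mono (iid coin n) λ ω → E-mono (kernel s 0≤s (Vec.map zOf ω)) λ x → f≤g x (Vec.map yOf ω)

      joint-0≤ : (s : Weight n) (0≤s : NonNeg s) {f : Vec (Fin t) n → Vec (Fin t) n → ℚ} →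
        (∀ x y → 0ℚ ≤ f x y) → 0ℚ ≤ joint s 0≤s f
      joint-0≤ {n} s 0≤s 0≤f = E-0≤ (iid coin n) λ ω → E-0≤ (kernel s 0≤s (Vec.map zOf ω)) λ x → 0≤f x (Vec.map yOf ω)

      joint-* : (s : Weight n) (0≤s : NonNeg s) (c : ℚ) (f : Vec (Fin t) n → Vec (Fin t) n → ℚ) →
        joint s 0≤s (λ x y → c * f x y) ≡ c * joint s 0≤s f
      joint-* {n} s 0≤s c f = trans (E-cong (iid coin n) λ ω → E-* (kernel s 0≤s (Vec.map zOf ω)) c _) (E-* (iid coin n) c _)

      joint-+ : (s : Weight n) (0≤s : NonNeg s) (f g : Vec (Fin t) n → Vec (Fin t) n → ℚ) →
        joint s 0≤s (λ x y → f x y + g x y) ≡ joint s 0≤s f + joint s 0≤s g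
      joint-+ {n} s 0≤s f g = trans (E-cong (iid coin n) λ ω → E-+ (kernel s 0≤s (Vec.map zOf ω)) _ _) (E-+ (iid coin n) _ _)

      -- Here s(x)/μ s is the density of the uniform law on S, so x is still uniform on S apart from
      -- the factor `agreeProd α β`. Coordinates are peeled off one at a time by `density-first`.
      density : (s : Weight n) (0≤s : NonNeg s) (f : Vec (Fin t) n → Vec (Fin t) n → ℚ) → (∀ x y → 0ℚ ≤ f x y) →
        μ s * joint s 0≤s f ≤ E (uniform n) λ x → E (uniform n) λ y → s x * (agreeProd α β x y * f x y)
      density {zero}  s 0≤s f 0≤f = ≤-reflexive (cong (s [] *_) (sym (*-identityˡ (f [] []))))
      density {suc n} s 0≤s f 0≤f = begin
        μ s * joint s 0≤s f
          ≡⟨ cong (μ s *_) (joint-suc s 0≤s f) ⟩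
        μ s * mixed θ (λ z y → E (first s 0≤s z) λ a → K a y)
          ≤⟨ density-first s 0≤s K (λ a y → joint-0≤ (s ▹ a) (0≤s ∘ (a ∷_)) λ xs ys → 0≤f (a ∷ xs) (y ∷ ys)) ⟩
        (E U λ a → E U λ b → (α + β * δ a b) * (μ (s ▹ a) * K a b))
          ≤⟨ (E-mono U λ a → E-mono U λ b → *-monoˡ (0≤factor a b) (density (s ▹ a) (0≤s ∘ (a ∷_)) (λ xs ys → f (a ∷ xs) (b ∷ ys)) λ xs ys → 0≤f (a ∷ xs) (b ∷ ys))) ⟩
        (E U λ a → E U λ b → (α + β * δ a b) * (E V λ xs → E V λ ys → s (a ∷ xs) * (agreeProd α β xs ys * f (a ∷ xs) (b ∷ ys))))
          ≡⟨ (E-cong U λ a → trans (E-cong U λ b → trans (sym (trans (E-cong V λ xs → E-* V (α + β * δ a b) _) (E-* V (α + β * δ a b) _)))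
                (E-cong V λ xs → E-cong V λ ys → eq (α + β * δ a b) (s (a ∷ xs)) (agreeProd α β xs ys) (f (a ∷ xs) (b ∷ ys)))) (E-swap U V _)) ⟩
        (E U λ a → E V λ xs → E U λ b → E V λ ys → s (a ∷ xs) * (agreeProd α β (a ∷ xs) (b ∷ ys) * f (a ∷ xs) (b ∷ ys))) ∎
        where
        V = uniform n
        K : Fin t → Fin t → ℚ
        K a y = joint (s ▹ a) (0≤s ∘ (a ∷_)) λ xs ys → f (a ∷ xs) (y ∷ ys)
        eq : ∀ d s p f → d * (s * (p * f)) ≡ s * (d * p * f)
        eq = solve-∀ ℚ-ring

      -- `avoid-first` is applied with H(a) the chance that the later coordinates do not agree
      -- either. That chance depends on the sampled letter a, which is why the one-step estimate
      -- allows a general H.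
      avoidance : (s : Weight n) (0≤s : NonNeg s) → μ s * joint s 0≤s disagree ≤ E (uniform n) λ x → s x * miss s x
      avoidance {zero}  s 0≤s = ≤-refl
      avoidance {suc n} s 0≤s = begin
        μ s * joint s 0≤s disagree
          ≡⟨ cong (μ s *_) (joint-suc s 0≤s disagree) ⟩
        μ s * mixed θ (λ z y → E (first s 0≤s z) λ a → joint (s ▹ a) (0≤s ∘ (a ∷_)) λ xs ys → (1ℚ + - 1ℚ * δ a y) * disagree xs ys)
          ≤⟨ *-monoˡ (0≤μ 0≤s) (mixed-mono λ z y → E-mono (first s 0≤s z) λ a → ≤-reflexive (joint-* (s ▹ a) (0≤s ∘ (a ∷_)) (1ℚ + - 1ℚ * δ a y) disagree)) ⟩
        μ s * mixed θ (λ z y → E (first s 0≤s z) λ a → (1ℚ + - 1ℚ * δ a y) * K a)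
          ≤⟨ avoid-first s 0≤s K (λ a → joint-0≤ (s ▹ a) (0≤s ∘ (a ∷_)) 0≤disagree) ⟩
        (E U λ a → (1ℚ - θ * τ * bit (good s a)) * (μ (s ▹ a) * K a))
          ≤⟨ (E-mono U λ a → *-monoˡ (0≤1-θτb (good s a)) (avoidance (s ▹ a) (0≤s ∘ (a ∷_)))) ⟩
        (E U λ a → (1ℚ - θ * τ * bit (good s a)) * (E V λ xs → s (a ∷ xs) * miss (s ▹ a) xs))
          ≡⟨ (E-cong U λ a → trans (sym (E-* V (1ℚ - θ * τ * bit (good s a)) _)) (E-cong V λ xs → x∙yz≈y∙xz (1ℚ - θ * τ * bit (good s a)) (s (a ∷ xs)) (miss (s ▹ a) xs))) ⟩
        (E (uniform (suc n)) λ x → s x * miss s x) ∎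
        where
        V = uniform n
        K : Fin t → ℚ
        K a = joint (s ▹ a) (0≤s ∘ (a ∷_)) disagree

-- Telescoping densities and the number of good coordinates

⁻¹*≤1 : ∀ {q} → 0ℚ ≤ q → q ⁻¹ * q ≤ 1ℚ
⁻¹*≤1 {q} 0≤q with 0ℚ <? q
... | yes 0<q = ≤-reflexive (trans (*-comm (q ⁻¹) q) (*-⁻¹ 0<q))
... | no q≤0  = ≤-trans (*-monoˡ (0≤⁻¹ 0≤q) (≮⇒≥ q≤0)) (≤-trans (≤-reflexive (*-zeroʳ (q ⁻¹))) 0≤1)

E-unif-0< : ∀ t .{{_ : ℕ.NonZero t}} {f : Fin t → ℚ} → (∀ i → 0ℚ ≤ f i) → ∀ i → 0ℚ < f i → 0ℚ < E (unif t) f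
E-unif-0< t {f} 0≤f i 0<fi = <-≤-trans (0<* (0<⁻¹ (0<fromℕ t)) 0<fi)
  (≤-trans (≤-reflexive (sym (E-δ t i f))) (E-mono (unif t) λ j → ≤-trans (*-monoʳ (0≤f j) (bit≤1 (does (i Fin.≟ j)))) (≤-reflexive (*-identityˡ (f j)))))

gainIf : Bool → ℚ → ℚ → ℚ
gainIf true  m m′ = m * m′ ⁻¹
gainIf false m m′ = 1ℚ

0≤gainIf : ∀ b {m m′} → 0ℚ ≤ m → 0ℚ ≤ m′ → 0ℚ ≤ gainIf b m m′
0≤gainIf true  0≤m 0≤m′ = 0≤* 0≤m (0≤⁻¹ 0≤m′)
0≤gainIf false 0≤m 0≤m′ = 0≤1

gainIf-*-≤ : ∀ b {m m′} → 0ℚ ≤ m → 0ℚ ≤ m′ → gainIf b m m′ * m′ ≤ m + m′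
gainIf-*-≤ true {m} {m′} 0≤m 0≤m′ = begin
  m * m′ ⁻¹ * m′    ≡⟨ *-assoc m _ _ ⟩
  m * (m′ ⁻¹ * m′)  ≤⟨ *-monoˡ 0≤m (⁻¹*≤1 0≤m′) ⟩
  m * 1ℚ            ≡⟨ *-identityʳ m ⟩
  m                 ≤⟨ ≤-by m′ refl 0≤m′ ⟩
  m + m′            ∎
gainIf-*-≤ false {m} {m′} 0≤m 0≤m′ = ≤-by m (eq m m′) 0≤m
  where
  eq : ∀ a b → a + b ≡ 1ℚ * b + a
  eq = solve-∀ ℚ-ring

count : Bool → ℕ
count true  = 1
count false = 0

count-not : ∀ b {g h n} → g ℕ.+ h ≡ n → (count b ℕ.+ g) ℕ.+ (count (not b) ℕ.+ h) ≡ suc n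
count-not true  eq = cong suc eq
count-not false eq = trans (ℕ.+-suc _ _) (cong suc eq)

[1-σ]^count : ∀ b {σ q k} → q ≡ (1ℚ - σ) ^ℚ k → (1ℚ - σ * bit b) * q ≡ (1ℚ - σ) ^ℚ (count b ℕ.+ k)
[1-σ]^count true  {σ} eq = cong₂ _*_ (cong (λ z → 1ℚ - z) (*-identityʳ σ)) eq
[1-σ]^count false {σ} {q} eq = trans (cong (λ z → (1ℚ - z) * q) (*-zeroʳ σ)) (trans (*-identityˡ _) eq)

module Moment (t : ℕ) .{{t≢0 : ℕ.NonZero t}} (τ M : ℚ) (0≤τ : 0ℚ ≤ τ) (τ≤½ : τ ≤ ½) (τM≤1 : τ * M ≤ 1ℚ) (1≤M : 1ℚ ≤ M) where

  open Kernel t τ M 0≤τ τ≤½ τM≤1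

  private variable
    n : ℕ

  -- The reciprocal conditional density at a good letter. Good letters of very small density could
  -- offset many bad ones in the telescoping product, and the product of these factors measures by
  -- how much.
  gain₁ : Weight (suc n) → Fin t → ℚ
  gain₁ s a = gainIf (good s a) (μ s) (μ (s ▹ a))

  gain : Weight n → Vec (Fin t) n → ℚ
  gain s []      = 1ℚ
  gain s (a ∷ x) = gain₁ s a * gain (s ▹ a) x

  #good : Weight n → Vec (Fin t) n → ℕ
  #good s []      = 0
  #good s (a ∷ x) = count (good s a) ℕ.+ #good (s ▹ a) x

  #bad : Weight n → Vec (Fin t) n → ℕ
  #bad s []      = 0
  #bad s (a ∷ x) = count (not (good s a)) ℕ.+ #bad (s ▹ a) x

  #good+#bad : (s : Weight n) (x : Vec (Fin t) n) → #good s x ℕ.+ #bad s x ≡ n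
  #good+#bad s []      = refl
  #good+#bad s (a ∷ x) = count-not (good s a) (#good+#bad (s ▹ a) x)

  0≤gain₁ : (s : Weight (suc n)) → NonNeg s → ∀ a → 0ℚ ≤ gain₁ s a
  0≤gain₁ s 0≤s a = 0≤gainIf (good s a) (0≤μ 0≤s) (0≤μ (0≤s ∘ (a ∷_)))

  0≤gain : (s : Weight n) → NonNeg s → ∀ x → 0ℚ ≤ gain s x
  0≤gain s 0≤s []      = 0≤1
  0≤gain s 0≤s (a ∷ x) = 0≤* (0≤gain₁ s 0≤s a) (0≤gain (s ▹ a) (0≤s ∘ (a ∷_)) x)

  -- Averaging with density w cancels the reciprocal: a good letter contributes μ s and a bad one
  -- μ(s ▹ a). Bounding both by the sum costs a factor 2 for each coordinate.
  moment : (s : Weight n) → NonNeg s → (E (uniform n) λ x → s x * gain s x) ≤ fromℕ 2 ^ℚ n * μ s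
  moment {zero}  s 0≤s = ≤-reflexive (*-comm (s []) 1ℚ)
  moment {suc n} s 0≤s = begin
    (E U λ a → E V λ x → s (a ∷ x) * (gain₁ s a * gain (s ▹ a) x))
      ≡⟨ (E-cong U λ a → trans (E-cong V λ x → x∙yz≈y∙xz (s (a ∷ x)) (gain₁ s a) (gain (s ▹ a) x)) (E-* V (gain₁ s a) _)) ⟩
    (E U λ a → gain₁ s a * E V λ x → s (a ∷ x) * gain (s ▹ a) x)
      ≤⟨ (E-mono U λ a → *-monoˡ (0≤gain₁ s 0≤s a) (moment (s ▹ a) (0≤s ∘ (a ∷_)))) ⟩
    (E U λ a → gain₁ s a * (N * μ (s ▹ a)))
      ≡⟨ (E-cong U λ a → x∙yz≈y∙xz (gain₁ s a) N (μ (s ▹ a))) ⟩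
    (E U λ a → N * (gain₁ s a * μ (s ▹ a)))
      ≤⟨ (E-mono U λ a → *-monoˡ (0≤^ n (0≤fromℕ 2)) (gainIf-*-≤ (good s a) (0≤μ 0≤s) (0≤μ (0≤s ∘ (a ∷_))))) ⟩
    (E U λ a → N * (μ s + μ (s ▹ a)))
      ≡⟨ trans (E-* U N _) (cong (N *_) (trans (E-+ U (λ _ → μ s) (λ a → μ (s ▹ a))) (cong (_+ μ s) (E-const U (μ s))))) ⟩
    N * (μ s + μ s)
      ≡⟨ eq₃ N (μ s) ⟩
    fromℕ 2 * N * μ s ∎
    where
    V = uniform n
    N = fromℕ 2 ^ℚ n
    eq₃ : ∀ a b → a * (b + b) ≡ fromℕ 2 * a * b
    eq₃ = solve-∀ ℚ-ring

  0<μ : (s : Weight n) → NonNeg s → ∀ x → 0ℚ < s x → 0ℚ < μ s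
  0<μ s 0≤s []      0<sx = 0<sx
  0<μ s 0≤s (a ∷ x) 0<sx = E-unif-0< t (λ a → 0≤μ {s = s ▹ a} (0≤s ∘ (a ∷_))) a (0<μ (s ▹ a) (0≤s ∘ (a ∷_)) x 0<sx)

  -- The conditional densities μ(s ▹ a) / μ(s) along x telescope to s(x) / μ(s).
  telescope : (s : Weight n) (0≤s : NonNeg s) → ∀ x → 0ℚ < s x → μ s * M ^ℚ #bad s x ≤ s x * gain s x
  telescope s 0≤s []      0<sx = ≤-refl
  telescope s 0≤s (a ∷ x) 0<sx = go (m ≤? M * μ s)
    where
    0≤s′ : NonNeg (s ▹ a)
    0≤s′ = 0≤s ∘ (a ∷_)
    m = μ (s ▹ a)
    P = M ^ℚ #bad (s ▹ a) x
    Y = gain (s ▹ a) x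
    eq₁ : ∀ a p b c → a * p * (b * c) ≡ a * c * (b * p)
    eq₁ = solve-∀ ℚ-ring
    eq₃ : ∀ a b p → a * (b * p) ≡ b * a * p
    eq₃ = solve-∀ ℚ-ring
    go : ∀ d → μ s * M ^ℚ (count (not (does d)) ℕ.+ #bad (s ▹ a) x) ≤ s (a ∷ x) * (gainIf (does d) (μ s) m * Y)
    go (yes _) = begin
      μ s * P                         ≡⟨ *-identityʳ _ ⟨
      μ s * P * 1ℚ                    ≡⟨ cong (μ s * P *_) (*-⁻¹ (0<μ (s ▹ a) 0≤s′ x 0<sx)) ⟨
      μ s * P * (m * m ⁻¹)            ≡⟨ eq₁ (μ s) P m (m ⁻¹) ⟩
      μ s * m ⁻¹ * (m * P)            ≤⟨ *-monoˡ (0≤* (0≤μ 0≤s) (0≤⁻¹ (0≤μ 0≤s′))) (telescope (s ▹ a) 0≤s′ x 0<sx) ⟩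
      μ s * m ⁻¹ * (s (a ∷ x) * Y)    ≡⟨ x∙yz≈y∙xz (μ s * m ⁻¹) (s (a ∷ x)) Y ⟩
      s (a ∷ x) * (μ s * m ⁻¹ * Y)    ∎
    go (no m≰Mμ) = begin
      μ s * (M * P)                   ≡⟨ eq₃ (μ s) M P ⟩
      M * μ s * P                     ≤⟨ *-monoʳ (0≤^ (#bad (s ▹ a) x) (≤-trans 0≤1 1≤M)) (<⇒≤ (≰⇒> m≰Mμ)) ⟩
      m * P                           ≤⟨ telescope (s ▹ a) 0≤s′ x 0<sx ⟩
      s (a ∷ x) * Y                   ≡⟨ cong (s (a ∷ x) *_) (*-identityˡ Y) ⟨
      s (a ∷ x) * (1ℚ * Y)            ∎

  module Miss (θ : ℚ) (0≤θ : 0ℚ ≤ θ) (θ≤1 : θ ≤ 1ℚ) where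
    open Mixed θ 0≤θ θ≤1

    miss≡ : (s : Weight n) → ∀ x → miss s x ≡ (1ℚ - θ * τ) ^ℚ #good s x
    miss≡ s []      = refl
    miss≡ s (a ∷ x) = [1-σ]^count (good s a) {σ = θ * τ} (miss≡ (s ▹ a) x)

    module Miss-mean (n c l : ℕ) .{{n≢0 : ℕ.NonZero n}} (2≤n : 2 ℕ.≤ n) (75≤l : 75 ℕ.≤ l)
             (θτ≡ : θ * τ ≡ fromℕ l * fromℕ n ⁻¹)
             (M-large : fromℕ 2 ^ℚ (5 ℕ.* c) * fromℕ 2 ^ℚ (20 ℕ.* n) ≤ M ^ℚ (4 ℕ.* n))
             (s : Weight n) (0≤s : NonNeg s) (μ-large : 1ℚ ≤ μ s * fromℕ 2 ^ℚ (c ℕ.+ 1)) where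

      private
        σ = θ * τ
        0≤σ : 0ℚ ≤ σ
        0≤σ = 0≤* 0≤θ 0≤τ
        0≤2 = 0≤fromℕ 2
        1≤2 : 1ℚ ≤ fromℕ 2
        1≤2 = 1≤fromℕ 2

      -- Here σ = l/n with l ≥ 75, so n/5 good coordinates give Gσ ≥ 15 and the power is at most
      -- 1/(1 + 15).
      miss-manyGood : ∀ x → n ℕ.≤ 5 ℕ.* #good s x → miss s x ≤ + 1 / 16
      miss-manyGood x n≤5G = *-cancelˡ (0<fromℕ 16) (begin
        fromℕ 16 * miss s x                     ≡⟨ trans (*-comm (fromℕ 16) (miss s x)) (cong (_* fromℕ 16) (miss≡ s x)) ⟩
        (1ℚ - σ) ^ℚ G * fromℕ 16                ≤⟨ *-monoˡ (0≤^ G (≤⇒0≤- θτ≤1)) (+-monoʳ-≤ 1ℚ 15≤) ⟩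
        (1ℚ - σ) ^ℚ G * (1ℚ + fromℕ G * σ)      ≤⟨ [1-s]^k≤ G 0≤σ θτ≤1 ⟩
        1ℚ   ≡⟨⟩
        fromℕ 16 * (+ 1 / 16)                   ∎)
        where
        G = #good s x
        eq : ∀ f g l q → f * g * (l * q) ≡ f * (g * (l * q))
        eq = solve-∀ ℚ-ring
        15≤ : fromℕ 15 ≤ fromℕ G * σ
        15≤ = *-cancelˡ (0<fromℕ 5) (begin
          fromℕ 5 * fromℕ 15                              ≡⟨⟩
          fromℕ 75   ≤⟨ fromℕ-mono 75≤l ⟩
          fromℕ l   ≡⟨ trans (cong (fromℕ l *_) (*-⁻¹ (0<fromℕ n))) (*-identityʳ (fromℕ l)) ⟨
          fromℕ l * (fromℕ n * fromℕ n ⁻¹)                ≡⟨ x∙yz≈y∙xz (fromℕ n) (fromℕ l) (fromℕ n ⁻¹) ⟨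
          fromℕ n * (fromℕ l * fromℕ n ⁻¹)                ≤⟨ *-monoʳ (0≤* (0≤fromℕ l) (0≤⁻¹ (0≤fromℕ n))) (fromℕ-mono n≤5G) ⟩
          fromℕ (5 ℕ.* G) * (fromℕ l * fromℕ n ⁻¹)        ≡⟨ cong₂ _*_ (fromℕ-* 5 G) (sym θτ≡) ⟩
          fromℕ 5 * fromℕ G * σ                           ≡⟨ *-assoc (fromℕ 5) (fromℕ G) σ ⟩
          fromℕ 5 * (fromℕ G * σ)                         ∎)

      -- With at least 4n/5 bad coordinates, telescoping gives M^(4n/5) ≤ 2^(c+1) `gain`, while
      -- M^(4n/5) ≥ 2^(c+4n). Hence the gain is at least 2^(4n-1), and 4n - 1 ≥ n + 5 for n ≥ 2.
      -- Fifth powers keep the exponents integral.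
      gain-manyBad : ∀ x → s x ≡ 1ℚ → 5 ℕ.* #good s x ℕ.< n → fromℕ 2 ^ℚ (n ℕ.+ 5) ≤ gain s x
      gain-manyBad x sx≡1 5G<n = ^-cancel-≤ 5 (0≤gain s 0≤s x) (*-cancelˡ (0<^ 5 (0<fromℕ 2)) (*-cancelˡ (0<^ (5 ℕ.* c) (0<fromℕ 2)) (begin
        A * (fromℕ 2 ^ℚ 5 * (fromℕ 2 ^ℚ (n ℕ.+ 5)) ^ℚ 5)      ≡⟨ cong (λ z → A * (fromℕ 2 ^ℚ 5 * z)) (^-assocʳ (fromℕ 2) (n ℕ.+ 5) 5) ⟩
        A * (fromℕ 2 ^ℚ 5 * fromℕ 2 ^ℚ ((n ℕ.+ 5) ℕ.* 5))     ≡⟨ cong (A *_) (^-homo-* (fromℕ 2) 5 ((n ℕ.+ 5) ℕ.* 5)) ⟨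
        A * fromℕ 2 ^ℚ (5 ℕ.+ (n ℕ.+ 5) ℕ.* 5)                ≤⟨ *-monoˡ (0≤^ (5 ℕ.* c) 0≤2) (^-mono-exp 1≤2 exponents) ⟩
        A * fromℕ 2 ^ℚ (20 ℕ.* n)                             ≤⟨ M-large ⟩
        M ^ℚ (4 ℕ.* n)   ≤⟨ ^-mono-exp 1≤M 4n≤5B ⟩
        M ^ℚ (B ℕ.* 5)   ≡⟨ ^-assocʳ M B 5 ⟨
        (M ^ℚ B) ^ℚ 5   ≤⟨ ^-mono 5 (0≤^ B 0≤M) M^B≤ ⟩
        (fromℕ 2 ^ℚ (c ℕ.+ 1) * Y) ^ℚ 5                       ≡⟨ ^-distrib-* (fromℕ 2 ^ℚ (c ℕ.+ 1)) Y 5 ⟩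
        (fromℕ 2 ^ℚ (c ℕ.+ 1)) ^ℚ 5 * Y ^ℚ 5                  ≡⟨ cong (_* Y ^ℚ 5) (^-assocʳ (fromℕ 2) (c ℕ.+ 1) 5) ⟩
        fromℕ 2 ^ℚ ((c ℕ.+ 1) ℕ.* 5) * Y ^ℚ 5                 ≡⟨ cong (λ k → fromℕ 2 ^ℚ k * Y ^ℚ 5) (exponent c) ⟩
        fromℕ 2 ^ℚ (5 ℕ.* c ℕ.+ 5) * Y ^ℚ 5                   ≡⟨ cong (_* Y ^ℚ 5) (^-homo-* (fromℕ 2) (5 ℕ.* c) 5) ⟩
        A * fromℕ 2 ^ℚ 5 * Y ^ℚ 5                             ≡⟨ *-assoc A (fromℕ 2 ^ℚ 5) (Y ^ℚ 5) ⟩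
        A * (fromℕ 2 ^ℚ 5 * Y ^ℚ 5)                           ∎)))
        where
        A = fromℕ 2 ^ℚ (5 ℕ.* c)
        B = #bad s x
        Y = gain s x
        0≤M = ≤-trans 0≤1 1≤M
        exponent : ∀ c → (c ℕ.+ 1) ℕ.* 5 ≡ 5 ℕ.* c ℕ.+ 5
        exponent c = trans (ℕ.*-distribʳ-+ 5 c 1) (cong (ℕ._+ 5) (ℕ.*-comm c 5))
        exponents : 5 ℕ.+ (n ℕ.+ 5) ℕ.* 5 ℕ.≤ 20 ℕ.* n
        exponents = ℕ.≤-trans (ℕ.≤-reflexive (trans (cong (5 ℕ.+_) (trans (ℕ.*-distribʳ-+ 5 n 5) (cong (ℕ._+ 25) (ℕ.*-comm n 5)))) (trans (ℕ.+-comm 5 _) (ℕ.+-assoc (5 ℕ.* n) 25 5))))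
          (ℕ.≤-trans (ℕ.+-monoʳ-≤ (5 ℕ.* n) (ℕ.*-monoʳ-≤ 15 2≤n)) (ℕ.≤-reflexive (sym (ℕ.*-distribʳ-+ n 5 15))))
        4n≤5B : 4 ℕ.* n ℕ.≤ B ℕ.* 5
        4n≤5B = ℕ.+-cancelˡ-≤ n _ _ (ℕ.≤-trans (ℕ.≤-reflexive (trans (cong (5 ℕ.*_) (sym (#good+#bad s x))) (trans (ℕ.*-distribˡ-+ 5 (#good s x) B) (cong (5 ℕ.* #good s x ℕ.+_) (ℕ.*-comm 5 B)))))
          (ℕ.+-monoˡ-≤ (B ℕ.* 5) (ℕ.<⇒≤ 5G<n)))
        M^B≤ : M ^ℚ B ≤ fromℕ 2 ^ℚ (c ℕ.+ 1) * Y
        M^B≤ = begin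
          M ^ℚ B   ≡⟨ *-identityˡ _ ⟨
          1ℚ * M ^ℚ B   ≤⟨ *-monoʳ (0≤^ B 0≤M) μ-large ⟩
          μ s * fromℕ 2 ^ℚ (c ℕ.+ 1) * M ^ℚ B           ≡⟨ eq (μ s) (fromℕ 2 ^ℚ (c ℕ.+ 1)) (M ^ℚ B) ⟩
          fromℕ 2 ^ℚ (c ℕ.+ 1) * (μ s * M ^ℚ B)         ≤⟨ *-monoˡ (0≤^ (c ℕ.+ 1) 0≤2) (telescope s 0≤s x (subst (0ℚ <_) (sym sx≡1) 0<1)) ⟩
          fromℕ 2 ^ℚ (c ℕ.+ 1) * (s x * Y)              ≡⟨ cong (fromℕ 2 ^ℚ (c ℕ.+ 1) *_) (trans (cong (_* Y) sx≡1) (*-identityˡ Y)) ⟩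
          fromℕ 2 ^ℚ (c ℕ.+ 1) * Y                      ∎
          where
          eq : ∀ a b c → a * b * c ≡ b * (a * c)
          eq = solve-∀ ℚ-ring

      -- A pointwise form of Markov's inequality: with few good coordinates the second term alone is
      -- at least 1.
      miss≤ : ∀ x → s x ≡ 1ℚ → miss s x ≤ + 1 / 16 + ½ ^ℚ (n ℕ.+ 5) * gain s x
      miss≤ x sx≡1 = go (n ℕ.≤? 5 ℕ.* #good s x)
        where
        go : Dec (n ℕ.≤ 5 ℕ.* #good s x) → miss s x ≤ + 1 / 16 + ½ ^ℚ (n ℕ.+ 5) * gain s x
        go (yes p) = ≤-trans (miss-manyGood x p) (≤-by _ refl (0≤* (0≤^ (n ℕ.+ 5) 0≤½) (0≤gain s 0≤s x)))
        go (no ¬p) = begin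
          miss s x   ≡⟨ miss≡ s x ⟩
          (1ℚ - σ) ^ℚ #good s x                                 ≤⟨ ^≤1 (#good s x) (≤⇒0≤- θτ≤1) (≤-by σ (1≡[1-a]+a σ) 0≤σ) ⟩
          1ℚ   ≡⟨ 1^ (n ℕ.+ 5) ⟨
          (½ * fromℕ 2) ^ℚ (n ℕ.+ 5)                            ≡⟨ ^-distrib-* ½ (fromℕ 2) (n ℕ.+ 5) ⟩
          ½ ^ℚ (n ℕ.+ 5) * fromℕ 2 ^ℚ (n ℕ.+ 5)                 ≤⟨ *-monoˡ (0≤^ (n ℕ.+ 5) 0≤½) (gain-manyBad x sx≡1 (ℕ.≰⇒> ¬p)) ⟩
          ½ ^ℚ (n ℕ.+ 5) * gain s x                             ≤⟨ ≤-by (+ 1 / 16) (+-comm (+ 1 / 16) (½ ^ℚ (n ℕ.+ 5) * gain s x)) (≤! 0ℚ (+ 1 / 16)) ⟩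
          + 1 / 16 + ½ ^ℚ (n ℕ.+ 5) * gain s x                  ∎

      -- The 1/16 for many good coordinates, plus 2^-(n+5) · 2^n = 1/32 from `moment`.
      miss-mean : (∀ x → (s x ≡ 0ℚ) ⊎ (s x ≡ 1ℚ)) → (E (uniform n) λ x → s x * miss s x) ≤ μ s * (+ 3 / 32)
      miss-mean 0∨1 = begin
        (E V λ x → s x * miss s x)   ≤⟨ E-mono V pointwise ⟩
        (E V λ x → s x * (+ 1 / 16) + ½ ^ℚ (n ℕ.+ 5) * (s x * gain s x))   ≡⟨ E-+ V _ _ ⟩
        (E V λ x → s x * (+ 1 / 16)) + (E V λ x → ½ ^ℚ (n ℕ.+ 5) * (s x * gain s x))
          ≡⟨ cong₂ _+_ (E-*ʳ V (+ 1 / 16) s) (E-* V (½ ^ℚ (n ℕ.+ 5)) _) ⟩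
        μ s * (+ 1 / 16) + ½ ^ℚ (n ℕ.+ 5) * (E V λ x → s x * gain s x)     ≤⟨ +-monoʳ-≤ (μ s * (+ 1 / 16)) (*-monoˡ (0≤^ (n ℕ.+ 5) 0≤½) (moment s 0≤s)) ⟩
        μ s * (+ 1 / 16) + ½ ^ℚ (n ℕ.+ 5) * (fromℕ 2 ^ℚ n * μ s)           ≡⟨ cong (λ z → μ s * (+ 1 / 16) + z * (fromℕ 2 ^ℚ n * μ s)) (^-homo-* ½ n 5) ⟩
        μ s * (+ 1 / 16) + ½ ^ℚ n * ½ ^ℚ 5 * (fromℕ 2 ^ℚ n * μ s)          ≡⟨ eq (μ s) (½ ^ℚ n) (fromℕ 2 ^ℚ n) ⟩
        μ s * (+ 1 / 16) + (+ 1 / 32) * (½ ^ℚ n * fromℕ 2 ^ℚ n) * μ s      ≡⟨ cong (λ z → μ s * (+ 1 / 16) + (+ 1 / 32) * z * μ s) (trans (sym (^-distrib-* ½ (fromℕ 2) n)) (1^ n)) ⟩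
        μ s * (+ 1 / 16) + (+ 1 / 32) * 1ℚ * μ s                           ≡⟨ eq₂ (μ s) ⟩
        μ s * (+ 3 / 32)                                                   ∎
        where
        V = uniform n
        eq : ∀ m a b → m * (+ 1 / 16) + a * (+ 1 / 32) * (b * m) ≡ m * (+ 1 / 16) + (+ 1 / 32) * (a * b) * m
        eq = solve-∀ ℚ-ring
        eq₂ : ∀ m → m * (+ 1 / 16) + (+ 1 / 32) * 1ℚ * m ≡ m * (+ 3 / 32)
        eq₂ = solve-∀ ℚ-ring
        eq₃ : ∀ h y → 1ℚ * ((+ 1 / 16) + h * y) ≡ 1ℚ * (+ 1 / 16) + h * (1ℚ * y)
        eq₃ = solve-∀ ℚ-ring
        eq₄ : ∀ h y m → 0ℚ * m ≡ 0ℚ * (+ 1 / 16) + h * (0ℚ * y)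
        eq₄ = solve-∀ ℚ-ring
        pointwise : ∀ x → s x * miss s x ≤ s x * (+ 1 / 16) + ½ ^ℚ (n ℕ.+ 5) * (s x * gain s x)
        pointwise x = go (0∨1 x)
          where
          P : ℚ → Set
          P z = z * miss s x ≤ z * (+ 1 / 16) + ½ ^ℚ (n ℕ.+ 5) * (z * gain s x)
          go : (s x ≡ 0ℚ) ⊎ (s x ≡ 1ℚ) → P (s x)
          go (inj₁ sx≡0) = subst P (sym sx≡0) (≤-reflexive (eq₄ (½ ^ℚ (n ℕ.+ 5)) (gain s x) (miss s x)))
          go (inj₂ sx≡1) = subst P (sym sx≡1) (≤-trans (*-monoˡ 0≤1 (miss≤ x sx≡1)) (≤-reflexive (eq₃ (½ ^ℚ (n ℕ.+ 5)) (gain s x))))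

-- Embedding a small instance

matches : ∀ {t n} → Vec (Fin t) n → Vec (Fin t) n → ℕ
matches []       []       = 0
matches (x ∷ xs) (y ∷ ys) = count (does (x Fin.≟ y)) ℕ.+ matches xs ys

isPositive : ℕ → Bool
isPositive zero    = false
isPositive (suc _) = true

any≡isPositive-matches : ∀ {t n} (x y : Vec (Fin t) n) → does (Fin.any? λ i → lookup x i Fin.≟ lookup y i) ≡ isPositive (matches x y)
any≡isPositive-matches []       []       = refl
any≡isPositive-matches (x ∷ xs) (y ∷ ys) = go (does (x Fin.≟ y)) (any≡isPositive-matches xs ys)
  where
  go : ∀ b {b′ k} → b′ ≡ isPositive k → b ∨ b′ ≡ isPositive (count b ℕ.+ k)
  go true  _  = refl
  go false eq = eq

EE≡isPositive-matches : ∀ {n} (x y : Input n) → EE x y ≡ isPositive (matches x y)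
EE≡isPositive-matches = any≡isPositive-matches

-- Makes the exponential moment of the number of matches a product over coordinates.
2^matches : ∀ {t n} (x y : Vec (Fin t) n) → fromℕ 2 ^ℚ matches x y ≡ agreeProd 1ℚ 1ℚ x y
2^matches []       []       = refl
2^matches (x ∷ xs) (y ∷ ys) = go (does (x Fin.≟ y)) (2^matches xs ys)
  where
  go : ∀ b {k q} → fromℕ 2 ^ℚ k ≡ q → fromℕ 2 ^ℚ (count b ℕ.+ k) ≡ (1ℚ + 1ℚ * bit b) * q
  go true  eq = cong (fromℕ 2 *_) eq
  go false eq = trans eq (sym (*-identityˡ _))

sum-matches : ∀ {t n} (x y : Vec (Fin t) n) → sum (λ i → δ (lookup x i) (lookup y i)) ≡ fromℕ (matches x y)
sum-matches []       []       = refl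
sum-matches (x ∷ xs) (y ∷ ys) = trans (cong (_+_ (δ x y)) (sum-matches xs ys)) (go (does (x Fin.≟ y)) (matches xs ys))
  where
  go : ∀ b k → bit b + fromℕ k ≡ fromℕ (count b ℕ.+ k)
  go true  k = sym (fromℕ-suc k)
  go false k = +-identityˡ (fromℕ k)

module _ {A : Set} (d : Dist A) where

  E-iid-lookup : ∀ {k} (p : Fin k) (f : A → ℚ) → E (iid d k) (λ φ → f (lookup φ p)) ≡ E d f
  E-iid-lookup {suc k} zero    f = E-cong d λ a → E-const (iid d k) (f a)
  E-iid-lookup         (suc p) f = trans (E-cong d λ a → E-iid-lookup p f) (E-const d (E d f))

  -- A random φ hides everything about two letters except whether they are equal.
  E-iid-lookup₂ : ∀ {k} (p q : Fin k) (G : A → A → ℚ) → let D = E d (λ a → G a a); I = E d λ a → E d (G a) in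
    E (iid d k) (λ φ → G (lookup φ p) (lookup φ q)) ≡ I + δ p q * (D - I)
  E-iid-lookup₂ {suc k} zero    zero    G = trans (E-cong d λ a → E-const (iid d k) (G a a)) (eq (E d λ a → E d (G a)) (E d λ a → G a a))
    where
    eq : ∀ i d → d ≡ i + 1ℚ * (d - i)
    eq = solve-∀ ℚ-ring
  E-iid-lookup₂ zero (suc q) G = trans (E-cong d λ a → E-iid-lookup q (G a)) (eq (E d λ a → E d (G a)) (E d λ a → G a a))
    where
    eq : ∀ i d → i ≡ i + 0ℚ * (d - i)
    eq = solve-∀ ℚ-ring
  E-iid-lookup₂ (suc p) zero G = trans (E-cong d λ b → E-iid-lookup p (λ a → G a b)) (trans (E-swap d d (λ b a → G a b)) (eq (E d λ a → E d (G a)) (E d λ a → G a a)))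
    where
    eq : ∀ i d → i ≡ i + 0ℚ * (d - i)
    eq = solve-∀ ℚ-ring
  E-iid-lookup₂ (suc p) (suc q) G = trans (E-cong d λ _ → E-iid-lookup₂ p q G) (E-const d _)

E-affine : {A : Set} (d : Dist A) (i k x : ℚ) (f : A → ℚ) → E d (λ a → i + k * (f a * x)) ≡ i + k * (E d f * x)
E-affine d i k x f = trans (E-+ d (λ _ → i) (λ a → k * (f a * x)))
  (cong₂ _+_ (E-const d i) (trans (E-* d k (λ a → f a * x)) (cong (k *_) (E-*ʳ d x f))))

module Coins (t m i : ℕ) .{{t≢0 : ℕ.NonZero t}} .{{m≢0 : ℕ.NonZero m}} where

  private U = unif t

  -- A position j of the small instance, a survival lottery l, a relabelling φ and a replacement
  -- letter e, all shared; `zOf` reads only u and `yOf` only v.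
  Coin : Set
  Coin = Fin m × Fin (suc i) × Vec (Fin t) (4 ℕ.* m) × Fin t

  coin : Dist Coin
  coin = unif m ⊗ unif (suc i) ⊗ iid U (4 ℕ.* m) ⊗ U

  zOf : Input m → Coin → Fin t
  zOf u (j , _ , φ , _) = lookup φ (lookup u j)

  -- At level i a coordinate survives with probability 1/(i+1), so that i+1 matches act as one.
  yOf : Input m → Coin → Fin t
  yOf v (j , l , φ , e) = if does (zero Fin.≟ l) then lookup φ (lookup v j) else e

  -- A random position is a match with chance k/m for k matches and survives with chance 1/(i + 1).
  -- For k = i + 1 this is 1/m, as for a single match.
  coin-law : (u v : Input m) (G : Fin t → Fin t → ℚ) →
    let θ = fromℕ m ⁻¹ * fromℕ (matches u v) * fromℕ (suc i) ⁻¹ in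
    E coin (λ o → G (zOf u o) (yOf v o)) ≡ θ * E U (λ a → G a a) + (1ℚ - θ) * (E U λ a → E U (G a))
  coin-law u v G = begin-equality
    (E (unif m) λ j → E (unif (suc i)) λ l → E Φ λ φ → E U λ e → G (lookup φ (lookup u j)) (if does (zero Fin.≟ l) then lookup φ (lookup v j) else e))
      ≡⟨ (E-cong (unif m) λ j → E-cong (unif (suc i)) λ l → inner j (does (zero Fin.≟ l))) ⟩
    (E (unif m) λ j → E (unif (suc i)) λ l → I + δ (lookup u j) (lookup v j) * (δ zero l * (D - I)))
      ≡⟨ (E-cong (unif m) λ j → trans (E-affine (unif (suc i)) I (δ (lookup u j) (lookup v j)) (D - I) (δ zero)) (cong (λ z → I + δ (lookup u j) (lookup v j) * (z * (D - I))) (E-δ₁ (suc i) zero))) ⟩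
    (E (unif m) λ j → I + δ (lookup u j) (lookup v j) * (L * (D - I)))
      ≡⟨ trans (E-cong (unif m) λ j → sym (cong (_+_ I) (*-identityˡ _))) (trans (E-affine (unif m) I 1ℚ (L * (D - I)) (λ j → δ (lookup u j) (lookup v j))) (cong (_+_ I) (*-identityˡ _))) ⟩
    I + E (unif m) (λ j → δ (lookup u j) (lookup v j)) * (L * (D - I))
      ≡⟨ cong (λ z → I + z * (L * (D - I))) (trans (sym (*-distribˡ-sum (fromℕ m ⁻¹) (λ j → δ (lookup u j) (lookup v j)))) (cong (fromℕ m ⁻¹ *_) (sum-matches u v))) ⟩
    I + fromℕ m ⁻¹ * fromℕ (matches u v) * (L * (D - I))
      ≡⟨ eq (fromℕ m ⁻¹ * fromℕ (matches u v)) L D I ⟩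
    fromℕ m ⁻¹ * fromℕ (matches u v) * L * D + (1ℚ - fromℕ m ⁻¹ * fromℕ (matches u v) * L) * I ∎
    where
    Φ = iid U (4 ℕ.* m)
    D = E U λ a → G a a
    I = E U λ a → E U (G a)
    L = fromℕ (suc i) ⁻¹
    eq : ∀ k l d i → i + k * (l * (d - i)) ≡ k * l * d + (1ℚ - k * l) * i
    eq = solve-∀ ℚ-ring
    eq₁ : ∀ i k d → i + k * (d - i) ≡ i + k * (1ℚ * (d - i))
    eq₁ = solve-∀ ℚ-ring
    eq₂ : ∀ i k d → i ≡ i + k * (0ℚ * (d - i))
    eq₂ = solve-∀ ℚ-ring
    inner : ∀ j b → (E Φ λ φ → E U λ e → G (lookup φ (lookup u j)) (if b then lookup φ (lookup v j) else e)) ≡ I + δ (lookup u j) (lookup v j) * (bit b * (D - I))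
    inner j true  = trans (E-cong Φ λ φ → E-const U _) (trans (E-iid-lookup₂ U (lookup u j) (lookup v j) G) (eq₁ I (δ (lookup u j) (lookup v j)) D))
    inner j false = trans (E-iid-lookup U (lookup u j) (λ a → E U (G a))) (eq₂ I (δ (lookup u j) (lookup v j)) D)

-- Second moment of the density and the error of a single run

E-EE≤¼ : ∀ {n} .{{_ : ℕ.NonZero n}} (x : Input n) → E (inputs n) (λ y → bit (EE x y)) ≤ + 1 / 4
E-EE≤¼ {n} x = begin
  E (inputs n) (λ y → bit (EE x y))        ≡⟨ E-cong (inputs n) (bit-EE x) ⟩
  E (inputs n) (λ y → 1ℚ - disagree x y)   ≡⟨ E-1- (inputs n) (disagree x) ⟩
  1ℚ - E (inputs n) (disagree x)           ≡⟨ cong (λ z → 1ℚ - z) (E-agreeProd 1ℚ (- 1ℚ) {{T≢0}} x) ⟩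
  1ℚ - (1ℚ + - 1ℚ * q) ^ℚ n                ≤⟨ +-monoʳ-≤ 1ℚ (neg-antimono-≤ (bernoulli n 0≤1-q)) ⟩
  1ℚ - (1ℚ + fromℕ n * (- 1ℚ * q))         ≡⟨ eq (fromℕ n) q ⟩
  fromℕ n * q                              ≡⟨ *-cancelˡ-≡ (0<fromℕ 4) (trans (sym (*-assoc (fromℕ 4) (fromℕ n) q)) (trans (cong (_* q) (sym (fromℕ-* 4 n))) (*-⁻¹ (0<fromℕ (4 ℕ.* n) {{T≢0}})))) ⟩
  + 1 / 4                                  ∎
  where
  .T≢0 : ℕ.NonZero (4 ℕ.* n)
  T≢0 = ℕ.m*n≢0 4 n
  q = fromℕ (4 ℕ.* n) ⁻¹
  eq : ∀ n q → 1ℚ - (1ℚ + n * (- 1ℚ * q)) ≡ n * q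
  eq = solve-∀ ℚ-ring
  eq′ : ∀ q → 1ℚ + - 1ℚ * q ≡ 1ℚ - q
  eq′ = solve-∀ ℚ-ring
  0≤1-q : 0ℚ ≤ 1ℚ + - 1ℚ * q
  0≤1-q = subst (0ℚ ≤_) (sym (eq′ q)) (≤⇒0≤- (⁻¹≤1 (1≤fromℕ (4 ℕ.* n) {{T≢0}})))

abstract
  -- The density D below has E D² ≤ (1 + κ/n)ⁿ ≤ 4^κ.
  κ : ℕ → ℕ
  κ l = 6 ℕ.* l ℕ.+ 12 ℕ.* (l ℕ.* l)

  κ-def : ∀ l → κ l ≡ 6 ℕ.* l ℕ.+ 12 ℕ.* (l ℕ.* l)
  κ-def l = refl

module SecondMoment (n l : ℕ) .{{n≢0 : ℕ.NonZero n}} where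

  C σ : ℚ
  C = fromℕ 4 ^ℚ κ l
  σ = fromℕ l * fromℕ n ⁻¹

  1≤C : 1ℚ ≤ C
  1≤C = 1≤^ (κ l) (1≤fromℕ 4)

  .T≢0 : ℕ.NonZero (4 ℕ.* n)
  T≢0 = ℕ.m*n≢0 4 n

  T : ℚ
  T = fromℕ (4 ℕ.* n)

  T*T⁻¹ : T * T ⁻¹ ≡ 1ℚ
  T*T⁻¹ = *-⁻¹ (0<fromℕ (4 ℕ.* n) {{T≢0}})

  -- On the diagonal β = σT = 4l is a constant, but the diagonal has mass 1/(4n), so each coordinate
  -- contributes a factor 1 + O(1/n).
  second-moment : ∀ {α β} → α ≡ 1ℚ + fromℕ 2 * σ → β ≡ σ * T → (x : Input n) →
    E (inputs n) (λ y → agreeProd α β x y * agreeProd α β x y) ≤ C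
  second-moment {α} {β} refl refl x = begin
    E (inputs n) (λ y → agreeProd α β x y * agreeProd α β x y)       ≡⟨ E-cong (inputs n) (agreeProd-sq α β x) ⟩
    E (inputs n) (agreeProd (α * α) ((1ℚ + 1ℚ) * α * β + β * β) x)   ≡⟨ E-agreeProd (α * α) ((1ℚ + 1ℚ) * α * β + β * β) {{T≢0}} x ⟩
    base ^ℚ n   ≤⟨ ^-mono n 0≤base base≤ ⟩
    (1ℚ + fromℕ (κ l) * q) ^ℚ n   ≤⟨ [1+k/n]^n≤4^k (κ l) n ⟩
    C                                                                ∎
    where
    q = fromℕ n ⁻¹
    λ′ = fromℕ l
    base = α * α + ((1ℚ + 1ℚ) * α * β + β * β) * T ⁻¹
    0≤q : 0ℚ ≤ q
    0≤q = 0≤⁻¹ (0≤fromℕ n)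
    0≤σ : 0ℚ ≤ σ
    0≤σ = 0≤* (0≤fromℕ l) 0≤q
    0≤α : 0ℚ ≤ α
    0≤α = 0≤+ 0≤1 (0≤* (0≤fromℕ 2) 0≤σ)
    0≤β : 0ℚ ≤ β
    0≤β = 0≤* 0≤σ (0≤fromℕ (4 ℕ.* n))
    0≤T⁻¹ : 0ℚ ≤ T ⁻¹
    0≤T⁻¹ = 0≤⁻¹ (0≤fromℕ (4 ℕ.* n))
    0≤base : 0ℚ ≤ base
    0≤base = 0≤+ (0≤* 0≤α 0≤α) (0≤* (0≤+ (0≤* (0≤* (0≤+ 0≤1 0≤1) 0≤α) 0≤β) (0≤* 0≤β 0≤β)) 0≤T⁻¹)
    eq₁ : ∀ σ T T⁻¹ → (1ℚ + fromℕ 2 * σ) * (1ℚ + fromℕ 2 * σ) + ((1ℚ + 1ℚ) * (1ℚ + fromℕ 2 * σ) * (σ * T) + σ * T * (σ * T)) * T⁻¹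
        ≡ (1ℚ + fromℕ 2 * σ) * (1ℚ + fromℕ 2 * σ) + ((1ℚ + 1ℚ) * (1ℚ + fromℕ 2 * σ) * σ + σ * (σ * T)) * (T * T⁻¹)
    eq₁ = solve-∀ ℚ-ring
    eq₂ : ∀ l n q → (1ℚ + fromℕ 2 * (l * q)) * (1ℚ + fromℕ 2 * (l * q)) + ((1ℚ + 1ℚ) * (1ℚ + fromℕ 2 * (l * q)) * (l * q) + l * q * (l * q * (fromℕ 4 * n))) * 1ℚ
        ≡ 1ℚ + fromℕ 6 * l * q + fromℕ 8 * (l * l) * (q * q) + fromℕ 4 * (l * l) * q * (n * q)
    eq₂ = solve-∀ ℚ-ring
    eq₃ : ∀ l q → 1ℚ + (fromℕ 6 * l + fromℕ 12 * (l * l)) * q ≡ (1ℚ + fromℕ 6 * l * q + fromℕ 8 * (l * l) * (q * q) + fromℕ 4 * (l * l) * q * 1ℚ) + fromℕ 8 * (l * l) * (q * (1ℚ - q))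
    eq₃ = solve-∀ ℚ-ring
    κ≡ : fromℕ (κ l) ≡ fromℕ 6 * λ′ + fromℕ 12 * (λ′ * λ′)
    κ≡ = trans (cong fromℕ (κ-def l)) (trans (fromℕ-+ (6 ℕ.* l) (12 ℕ.* (l ℕ.* l))) (cong₂ _+_ (fromℕ-* 6 l) (trans (fromℕ-* 12 (l ℕ.* l)) (cong (fromℕ 12 *_) (fromℕ-* l l)))))
    -- Expanding with T = 4n gives 1 + 6σ + 8σ² + 4l²/n; since σ² ≤ l²/n, the coefficient of 1/n is
    -- at most 6l + 12l².
    base≤ : base ≤ 1ℚ + fromℕ (κ l) * q
    base≤ = begin
      base   ≡⟨ eq₁ σ T (T ⁻¹) ⟩
      α * α + ((1ℚ + 1ℚ) * α * σ + σ * (σ * T)) * (T * T ⁻¹)      ≡⟨ cong₂ (λ a b → α * α + ((1ℚ + 1ℚ) * α * σ + σ * (σ * a)) * b) (fromℕ-* 4 n) T*T⁻¹ ⟩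
      α * α + ((1ℚ + 1ℚ) * α * σ + σ * (σ * (fromℕ 4 * fromℕ n))) * 1ℚ ≡⟨ eq₂ λ′ (fromℕ n) q ⟩
      p + fromℕ 4 * (λ′ * λ′) * q * (fromℕ n * q)                 ≡⟨ cong (λ z → p + fromℕ 4 * (λ′ * λ′) * q * z) (*-⁻¹ (0<fromℕ n)) ⟩
      p + fromℕ 4 * (λ′ * λ′) * q * 1ℚ                            ≤⟨ ≤-by (fromℕ 8 * (λ′ * λ′) * (q * (1ℚ - q))) (eq₃ λ′ q)
                                                                      (0≤* (0≤* (0≤fromℕ 8) (0≤* (0≤fromℕ l) (0≤fromℕ l))) (0≤* 0≤q (≤⇒0≤- (⁻¹≤1 (1≤fromℕ n))))) ⟩
      1ℚ + (fromℕ 6 * λ′ + fromℕ 12 * (λ′ * λ′)) * q              ≡⟨ cong (λ z → 1ℚ + z * q) κ≡ ⟨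
      1ℚ + fromℕ (κ l) * q                                            ∎
      where p = 1ℚ + fromℕ 6 * λ′ * q + fromℕ 8 * (λ′ * λ′) * (q * q)

  -- AM-GM: D b ≤ D²/(64 C) + 16 C b for b ∈ {0, 1}.
  am-gm : ∀ D b → 0ℚ ≤ D → D * bit b ≤ (+ 1 / 64) * C ⁻¹ * (D * D) + fromℕ 16 * C * bit b
  am-gm D false 0≤D = ≤-trans (≤-reflexive (*-zeroʳ D)) (0≤+ (0≤* (0≤* (≤! 0ℚ (+ 1 / 64)) (0≤⁻¹ 0≤C)) (0≤* 0≤D 0≤D)) (0≤* (0≤* (0≤fromℕ 16) 0≤C) ≤-refl))
    where 0≤C = ≤-trans 0≤1 1≤C
  am-gm D true 0≤D = ≤-by ((+ 1 / 64) * C ⁻¹ * ((D - fromℕ 32 * C) * (D - fromℕ 32 * C))) (begin-equality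
    (+ 1 / 64) * C ⁻¹ * (D * D) + fromℕ 16 * C * 1ℚ
      ≡⟨ eq₁ D C (C ⁻¹) ⟩
    D * (C * C ⁻¹) + (+ 1 / 64) * C ⁻¹ * ((D - fromℕ 32 * C) * (D - fromℕ 32 * C)) + fromℕ 16 * C * (1ℚ - C * C ⁻¹)
      ≡⟨ cong (λ z → D * z + R + fromℕ 16 * C * (1ℚ - z)) (*-⁻¹ (<-≤-trans 0<1 1≤C)) ⟩
    D * 1ℚ + R + fromℕ 16 * C * (1ℚ - 1ℚ)
      ≡⟨ eq₂ D R C ⟩
    D * 1ℚ + R ∎)
    (0≤* (0≤* (≤! 0ℚ (+ 1 / 64)) (0≤⁻¹ (≤-trans 0≤1 1≤C))) (0≤sq (D - fromℕ 32 * C)))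
    where
    R = (+ 1 / 64) * C ⁻¹ * ((D - fromℕ 32 * C) * (D - fromℕ 32 * C))
    eq₁ : ∀ D C C⁻¹ → (+ 1 / 64) * C⁻¹ * (D * D) + fromℕ 16 * C * 1ℚ
        ≡ D * (C * C⁻¹) + (+ 1 / 64) * C⁻¹ * ((D - fromℕ 32 * C) * (D - fromℕ 32 * C)) + fromℕ 16 * C * (1ℚ - C * C⁻¹)
    eq₁ = solve-∀ ℚ-ring
    eq₂ : ∀ D R C → D * 1ℚ + R + fromℕ 16 * C * (1ℚ - 1ℚ) ≡ D * 1ℚ + R
    eq₂ = solve-∀ ℚ-ring

0≤-0∨1 : ∀ {q} → (q ≡ 0ℚ) ⊎ (q ≡ 1ℚ) → 0ℚ ≤ q
0≤-0∨1 (inj₁ refl) = ≤-refl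
0≤-0∨1 (inj₂ refl) = 0≤1

module Reduction {c r : ℕ} (n m b l : ℕ) .{{n≢0 : ℕ.NonZero n}} .{{m≢0 : ℕ.NonZero m}} (2≤n : 2 ℕ.≤ n) (75≤l : 75 ℕ.≤ l)
  (τ M : ℚ) (0≤τ : 0ℚ ≤ τ) (τ≤½ : τ ≤ ½) (τM≤1 : τ * M ≤ 1ℚ) (1≤M : 1ℚ ≤ M)
  (τ/m≡l/n : fromℕ m ⁻¹ * τ ≡ fromℕ l * fromℕ n ⁻¹)
  (M-large : fromℕ 2 ^ℚ (5 ℕ.* b) * fromℕ 2 ^ℚ (20 ℕ.* n) ≤ M ^ℚ (4 ℕ.* n))
  (s : Input n → ℚ) (0∨1 : ∀ x → (s x ≡ 0ℚ) ⊎ (s x ≡ 1ℚ)) (μ-large : 1ℚ ≤ E (inputs n) s * fromℕ 2 ^ℚ (b ℕ.+ 1))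
  (tree : ExactTree (Input n) (Input n) c r) (ε : ℚ) (0≤ε : 0ℚ ≤ ε)
  (error-s : (E (inputs n) λ x → E (inputs n) λ y → s x * wrong (runExact tree y x) (EE x y)) ≤ fromℕ 2 * ε * E (inputs n) s)
  (ε-small : ε * (fromℕ 2048 * fromℕ 4 ^ℚ κ l) ≤ 1ℚ)
  where

  open SecondMoment n l

  private
    t = 4 ℕ.* n
    I = inputs n

    instance
      t≢0 : ℕ.NonZero t
      t≢0 = ℕ.m*n≢0 4 n

    0≤s : ∀ x → 0ℚ ≤ s x
    0≤s x = 0≤-0∨1 (0∨1 x)

    e : Input n → Input n → Bool
    e x y = does (¬? (runExact tree y x Bool.≟ EE x y))

  open Kernel t τ M 0≤τ τ≤½ τM≤1 hiding (T)

  private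
    0<μs : 0ℚ < μ s
    0<μs = ≰⇒> λ μ≤0 → <⇒≱ 0<1 (≤-trans μ-large (≤-trans (*-monoʳ (0≤^ (b ℕ.+ 1) (0≤fromℕ 2)) μ≤0) (≤-reflexive (*-zeroˡ (fromℕ 2 ^ℚ (b ℕ.+ 1))))))

    0≤μs : 0ℚ ≤ μ s
    0≤μs = <⇒≤ 0<μs

  -- With the first message fixed, the next to move is the player with y. The holder of v takes that
  -- role, and the shared coins determine y; the holder of u samples x privately.
  level : ℕ → Randomized m c r
  level i = record
    { tree  = tree
    ; coins = iid (Coins.coin t m i) n
    ; own   = λ ω v → point (Vec.map (Coins.yOf t m i v) ω)
    ; other = λ ω u → kernel s 0≤s (Vec.map (Coins.zOf t m i u) ω)
    }

  level-law : ∀ i u v {θ} → fromℕ m ⁻¹ * fromℕ (matches u v) * fromℕ (suc i) ⁻¹ ≡ θ → ∀ G →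
    E (Coins.coin t m i) (λ o → G (Coins.zOf t m i u o) (Coins.yOf t m i v o)) ≡ mixed θ G
  level-law i u v refl G = Coins.coin-law t m i u v G

  -- Without a match θ = 0 and the density bound is 1. Acceptance then means that x and y agree
  -- somewhere, at most 1/4, or that the old protocol errs, at most 2ε.
  accept-level : ∀ i u v → matches u v ≡ 0 → accept (level i) v u ≤ + 3 / 8
  accept-level i u v none = *-cancelˡ 0<μs (begin
    μ s * joint s 0≤s accepts
      ≤⟨ density s 0≤s accepts (λ x y → 0≤bit (runExact tree y x)) ⟩
    (E I λ x → E I λ y → s x * (agreeProd α β x y * accepts x y))
      ≤⟨ (E-mono I λ x → E-mono I λ y → *-monoˡ (0≤s x) (≤-trans (≤-reflexive (trans (cong (_* accepts x y) (agreeProd-1 α≡1 β≡0 x y)) (*-identityˡ _))) (split (runExact tree y x) (EE x y)))) ⟩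
    (E I λ x → E I λ y → s x * (bit (EE x y) + bit (e x y)))
      ≡⟨ trans (E-cong I λ x → trans (E-cong I λ y → *-distribˡ-+ (s x) (bit (EE x y)) (bit (e x y))) (E-+ I _ _)) (E-+ I _ _) ⟩
    (E I λ x → E I λ y → s x * bit (EE x y)) + (E I λ x → E I λ y → s x * bit (e x y))
      ≤⟨ +-mono-≤ (E-mono I λ x → ≤-trans (≤-reflexive (E-* I (s x) (λ y → bit (EE x y)))) (*-monoˡ (0≤s x) (E-EE≤¼ x))) error-s ⟩
    (E I λ x → s x * (+ 1 / 4)) + fromℕ 2 * ε * μ s
      ≡⟨ cong₂ _+_ (E-*ʳ I (+ 1 / 4) s) (*-comm (fromℕ 2 * ε) (μ s)) ⟩
    μ s * (+ 1 / 4) + μ s * (fromℕ 2 * ε)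
      ≡⟨ *-distribˡ-+ (μ s) (+ 1 / 4) (fromℕ 2 * ε) ⟨
    μ s * (+ 1 / 4 + fromℕ 2 * ε)
      ≤⟨ *-monoˡ 0≤μs (≤-trans (+-monoʳ-≤ (+ 1 / 4) 2ε≤) (≤! (+ 1 / 4 + + 1 / 1024) (+ 3 / 8))) ⟩
    μ s * (+ 3 / 8) ∎)
    where
    open Mixed 0ℚ ≤-refl 0≤1
    θ≡0 : fromℕ m ⁻¹ * fromℕ (matches u v) * fromℕ (suc i) ⁻¹ ≡ 0ℚ
    θ≡0 = trans (cong (λ k → fromℕ m ⁻¹ * fromℕ k * fromℕ (suc i) ⁻¹) none) (eq (fromℕ m ⁻¹) (fromℕ (suc i) ⁻¹))
      where
      eq : ∀ a b → a * 0ℚ * b ≡ 0ℚ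
      eq = solve-∀ ℚ-ring
    open Law (Coins.coin t m i) (Coins.zOf t m i u) (Coins.yOf t m i v) (level-law i u v θ≡0)
    accepts : Input n → Input n → ℚ
    accepts x y = bit (runExact tree y x)
    α≡1 : α ≡ 1ℚ
    α≡1 = eq τ
      where
      eq : ∀ τ → 1ℚ + fromℕ 2 * (0ℚ * τ) ≡ 1ℚ
      eq = solve-∀ ℚ-ring
    β≡0 : β ≡ 0ℚ
    β≡0 = eq τ (fromℕ t)
      where
      eq : ∀ τ T → 0ℚ * τ * T ≡ 0ℚ
      eq = solve-∀ ℚ-ring
    split : ∀ a b → bit a ≤ bit b + bit (does (¬? (a Bool.≟ b)))
    split false b = 0≤+ (0≤bit b) (0≤bit (does (¬? (false Bool.≟ b))))
    split true false = ≤! 1ℚ (0ℚ + 1ℚ)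
    split true true  = ≤! 1ℚ (1ℚ + 0ℚ)
    2ε≤ : fromℕ 2 * ε ≤ + 1 / 1024
    2ε≤ = *-cancelˡ (0<fromℕ 1024) (begin
      fromℕ 1024 * (fromℕ 2 * ε)    ≡⟨ trans (sym (*-assoc (fromℕ 1024) (fromℕ 2) ε)) (trans (*-comm (fromℕ 2048) ε) (cong (ε *_) (sym (*-identityʳ (fromℕ 2048))))) ⟩
      ε * (fromℕ 2048 * 1ℚ)         ≤⟨ *-monoˡ 0≤ε (*-monoˡ (0≤fromℕ 2048) 1≤C) ⟩
      ε * (fromℕ 2048 * C)          ≤⟨ ε-small ⟩
      1ℚ                            ≡⟨⟩
      fromℕ 1024 * (+ 1 / 1024)     ∎)

  -- At the matching level θ = 1/m. Rejection means that x and y nowhere agree, at most 3/32, or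
  -- that the old protocol errs, at most 1/32.
  reject-level : ∀ i u v → matches u v ≡ suc i → 1ℚ - accept (level i) v u ≤ + 1 / 8
  reject-level i u v match = begin
    1ℚ - accept (level i) v u
      ≡⟨ value-not (level i) v u ⟨
    joint s 0≤s (λ x y → bit (not (runExact tree y x)))
      ≤⟨ joint-mono s 0≤s (λ x y → ≤-trans (split (runExact tree y x) (EE x y)) (≤-reflexive (cong (_+ bit (e x y)) (1-EE x y)))) ⟩
    joint s 0≤s (λ x y → disagree x y + bit (e x y))
      ≡⟨ joint-+ s 0≤s disagree (λ x y → bit (e x y)) ⟩
    joint s 0≤s disagree + joint s 0≤s (λ x y → bit (e x y))
      ≤⟨ +-mono-≤ (*-cancelˡ 0<μs (≤-trans (avoidance s 0≤s) (miss-mean 0∨1))) (*-cancelˡ 0<μs wrong≤) ⟩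
    + 3 / 32 + + 1 / 32
      ≡⟨⟩
    + 1 / 8 ∎
    where
    θ = fromℕ m ⁻¹
    0≤θ : 0ℚ ≤ θ
    0≤θ = 0≤⁻¹ (0≤fromℕ m)
    θ≤1 : θ ≤ 1ℚ
    θ≤1 = ⁻¹≤1 (1≤fromℕ m)
    open Mixed θ 0≤θ θ≤1
    open Moment.Miss t τ M 0≤τ τ≤½ τM≤1 1≤M θ 0≤θ θ≤1 using (module Miss-mean)
    open Miss-mean n b l 2≤n 75≤l τ/m≡l/n M-large s 0≤s μ-large using (miss-mean)
    θ≡ : fromℕ m ⁻¹ * fromℕ (matches u v) * fromℕ (suc i) ⁻¹ ≡ θ
    θ≡ = trans (cong (λ k → θ * fromℕ k * fromℕ (suc i) ⁻¹) match) (trans (*-assoc θ _ _) (trans (cong (θ *_) (*-⁻¹ (0<fromℕ (suc i)))) (*-identityʳ θ)))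
    open Law (Coins.coin t m i) (Coins.zOf t m i u) (Coins.yOf t m i v) (level-law i u v θ≡)
    split : ∀ a b → bit (not a) ≤ (1ℚ - bit b) + bit (does (¬? (a Bool.≟ b)))
    split false false = ≤! 1ℚ (1ℚ - 0ℚ + 0ℚ)
    split false true  = ≤! 1ℚ (1ℚ - 1ℚ + 1ℚ)
    split true  false = ≤! 0ℚ (1ℚ - 0ℚ + 1ℚ)
    split true  true  = ≤! 0ℚ (1ℚ - 1ℚ + 0ℚ)
    D : Input n → Input n → ℚ
    D = agreeProd α β
    0≤D : ∀ x y → 0ℚ ≤ D x y
    0≤D = agreeProd-0≤ 0≤α (0≤+ 0≤α 0≤β)
    A B : ℚ
    A = (+ 1 / 64) * C ⁻¹
    B = fromℕ 16 * C
    0≤C : 0ℚ ≤ C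
    0≤C = ≤-trans 0≤1 1≤C
    0≤A : 0ℚ ≤ A
    0≤A = 0≤* (≤! 0ℚ (+ 1 / 64)) (0≤⁻¹ 0≤C)
    eq₁ : ∀ s A X B e → s * (A * X + B * e) ≡ s * A * X + B * (s * e)
    eq₁ = solve-∀ ℚ-ring
    eq₂ : ∀ s k C⁻¹ C → s * (k * C⁻¹) * C ≡ s * k * (C * C⁻¹)
    eq₂ = solve-∀ ℚ-ring
    eq₃ : ∀ C ε m → fromℕ 16 * C * (fromℕ 2 * ε * m) ≡ m * ((+ 1 / 64) * (ε * (fromℕ 2048 * C)))
    eq₃ = solve-∀ ℚ-ring
    eq₄ : ∀ m → m * (+ 1 / 64) * 1ℚ + m * ((+ 1 / 64) * 1ℚ) ≡ m * (+ 1 / 32)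
    eq₄ = solve-∀ ℚ-ring
    D-mean : ∀ x → s x * A * E I (λ y → D x y * D x y) ≤ s x * (+ 1 / 64) * 1ℚ
    D-mean x = begin
      s x * A * E I (λ y → D x y * D x y)     ≤⟨ *-monoˡ (0≤* (0≤s x) 0≤A) (second-moment (cong (λ z → 1ℚ + fromℕ 2 * z) τ/m≡l/n) (cong (_* fromℕ t) τ/m≡l/n) x) ⟩
      s x * A * C                             ≡⟨ eq₂ (s x) (+ 1 / 64) (C ⁻¹) C ⟩
      s x * (+ 1 / 64) * (C * C ⁻¹)           ≡⟨ cong (s x * (+ 1 / 64) *_) (*-⁻¹ (<-≤-trans 0<1 1≤C)) ⟩
      s x * (+ 1 / 64) * 1ℚ                   ∎
    -- The D² term contributes C/(64C) = 1/64, and the error term 16C · 2ε ≤ 1/64 because 2048 C ε ≤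
    -- 1.
    wrong≤ : μ s * joint s 0≤s (λ x y → bit (e x y)) ≤ μ s * (+ 1 / 32)
    wrong≤ = begin
      μ s * joint s 0≤s (λ x y → bit (e x y))
        ≤⟨ density s 0≤s (λ x y → bit (e x y)) (λ x y → 0≤bit (e x y)) ⟩
      (E I λ x → E I λ y → s x * (D x y * bit (e x y)))
        ≤⟨ (E-mono I λ x → E-mono I λ y → *-monoˡ (0≤s x) (am-gm (D x y) (e x y) (0≤D x y))) ⟩
      (E I λ x → E I λ y → s x * (A * (D x y * D x y) + B * bit (e x y)))
        ≡⟨ (E-cong I λ x → trans (E-cong I λ y → eq₁ (s x) A (D x y * D x y) B (bit (e x y))) (trans (E-+ I _ _) (cong₂ _+_ (E-* I (s x * A) (λ y → D x y * D x y)) (E-* I B (λ y → s x * bit (e x y)))))) ⟩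
      (E I λ x → s x * A * E I (λ y → D x y * D x y) + B * E I (λ y → s x * bit (e x y)))
        ≡⟨ trans (E-+ I _ _) (cong (_+_ (E I λ x → s x * A * E I (λ y → D x y * D x y))) (E-* I B _)) ⟩
      (E I λ x → s x * A * E I (λ y → D x y * D x y)) + B * (E I λ x → E I λ y → s x * bit (e x y))
        ≤⟨ +-mono-≤ (E-mono I D-mean) (*-monoˡ (0≤* (0≤fromℕ 16) 0≤C) error-s) ⟩
      (E I λ x → s x * (+ 1 / 64) * 1ℚ) + B * (fromℕ 2 * ε * μ s)
        ≡⟨ cong₂ _+_ (trans (E-*ʳ I 1ℚ (λ x → s x * (+ 1 / 64))) (cong (_* 1ℚ) (E-*ʳ I (+ 1 / 64) s))) (eq₃ C ε (μ s)) ⟩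
      μ s * (+ 1 / 64) * 1ℚ + μ s * ((+ 1 / 64) * (ε * (fromℕ 2048 * C)))
        ≤⟨ +-monoʳ-≤ (μ s * (+ 1 / 64) * 1ℚ) (*-monoˡ 0≤μs (*-monoˡ (≤! 0ℚ (+ 1 / 64)) ε-small)) ⟩
      μ s * (+ 1 / 64) * 1ℚ + μ s * ((+ 1 / 64) * 1ℚ)
        ≡⟨ eq₄ (μ s) ⟩
      μ s * (+ 1 / 32) ∎

-- Amplification and the choice of a message

sharpenBits≡ : ∀ d c → sharpenBits d c ≡ 4 ℕ.^ d ℕ.* c
sharpenBits≡ zero    c = sym (ℕ.*-identityˡ c)
sharpenBits≡ (suc d) c = trans (four (sharpenBits d c)) (trans (cong (4 ℕ.*_) (sharpenBits≡ d c)) (sym (ℕ.*-assoc 4 (4 ℕ.^ d) c)))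
  where
  four : ∀ b → (b ℕ.+ b) ℕ.+ (b ℕ.+ b) ≡ 4 ℕ.* b
  four b = trans (ℕ.+-assoc b b (b ℕ.+ b)) (cong (λ z → b ℕ.+ (b ℕ.+ (b ℕ.+ z))) (sym (ℕ.+-identityʳ b)))

½^*2^ : ∀ k → ½ ^ℚ k * fromℕ 2 ^ℚ k ≡ 1ℚ
½^*2^ k = trans (sym (^-distrib-* ½ (fromℕ 2) k)) (1^ k)

½^≤1 : ∀ k → ½ ^ℚ k ≤ 1ℚ
½^≤1 k = ^≤1 k 0≤½ (≤! ½ 1ℚ)

½^-antimono : ∀ {j k} → j ℕ.≤ k → ½ ^ℚ k ≤ ½ ^ℚ j
½^-antimono {k = k} ℕ.z≤n     = ½^≤1 k
½^-antimono         (ℕ.s≤s p) = *-monoˡ 0≤½ (½^-antimono p)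

suc-*½^≤1 : ∀ k → fromℕ (suc k) * ½ ^ℚ k ≤ 1ℚ
suc-*½^≤1 k = begin
  fromℕ (suc k) * ½ ^ℚ k        ≡⟨ *-comm (fromℕ (suc k)) (½ ^ℚ k) ⟩
  ½ ^ℚ k * fromℕ (suc k)        ≤⟨ *-monoˡ (0≤^ k 0≤½) (≤-trans (fromℕ-mono (1+k≤2^k k)) (≤-reflexive (fromℕ-^ 2 k))) ⟩
  ½ ^ℚ k * fromℕ 2 ^ℚ k         ≡⟨ ½^*2^ k ⟩
  1ℚ                            ∎
  where
  1+k≤2^k : ∀ k → suc k ℕ.≤ 2 ℕ.^ k
  1+k≤2^k zero    = ℕ.s≤s ℕ.z≤n
  1+k≤2^k (suc k) = ℕ.≤-trans (ℕ.+-mono-≤ (ℕ.m^n>0 2 k) (1+k≤2^k k)) (ℕ.≤-reflexive (cong (2 ℕ.^ k ℕ.+_) (sym (ℕ.+-identityʳ (2 ℕ.^ k)))))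

module Assemble {m c r : ℕ} .{{m≢0 : ℕ.NonZero m}} (R : ℕ → Randomized m c r)
  (accept≤ : ∀ i u v → matches u v ≡ 0 → accept (R i) v u ≤ + 3 / 8)
  (reject≤ : ∀ i u v → matches u v ≡ suc i → 1ℚ - accept (R i) v u ≤ + 1 / 8)
  (K d : ℕ) where

  sharpened : ℕ → Randomized m (sharpenBits d (sharpenBits 2 c)) r
  sharpened i = iterate d (sharpen (sharpen (R i)))

  amplified : Randomized m (K ℕ.* sharpenBits d (sharpenBits 2 c)) r
  amplified = any K sharpened

  -- The first term pays for the failures of the amplified levels. The second is at least 1 as soon
  -- as k ≥ K and covers matches beyond the last level.
  bound : ℕ → ℚ
  bound k = fromℕ (suc K) * ½ ^ℚ d + ½ ^ℚ K * fromℕ 2 ^ℚ k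

  0≤½^d : 0ℚ ≤ ½ ^ℚ d
  0≤½^d = 0≤^ d 0≤½

  ½^d*q≤ : ∀ {q} → q ≤ 1ℚ → ½ ^ℚ d * q ≤ ½ ^ℚ d
  ½^d*q≤ q≤1 = ≤-trans (*-monoˡ 0≤½^d q≤1) (≤-reflexive (*-identityʳ _))

  ≤bound : ∀ k {q} → q ≤ fromℕ (suc K) * ½ ^ℚ d → q ≤ bound k
  ≤bound k q≤ = ≤-trans q≤ (≤-by (½ ^ℚ K * fromℕ 2 ^ℚ k) refl (0≤* (0≤^ K 0≤½) (0≤^ k (0≤fromℕ 2))))

  -- Without a match every level has to reject, which costs a union bound. With i + 1 matches
  -- acceptance is correct, so it suffices that level i accepts; nothing is asked of the other
  -- levels.
  wrong≤bound : ∀ v u k → matches u v ≡ k → ∀ b → b ≡ isPositive k → value amplified (λ a → wrong a b) v u ≤ bound k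
  wrong≤bound v u zero none b refl = ≤bound zero (begin
    value amplified (λ a → wrong a false) v u     ≡⟨ value-cong amplified {λ a → wrong a false} {bit} (λ { false → refl ; true → refl }) v u ⟩
    accept amplified v u                          ≤⟨ accept-any K sharpened v u (λ i → accept-iterate d (sharpen (sharpen (R i))) v u (accept-sharpen² (R i) v u (accept≤ i u v none))) ⟩
    fromℕ K * (½ ^ℚ d * (+ 1 / 4))                ≤⟨ *-mono (0≤fromℕ K) 0≤½^d (fromℕ-mono (ℕ.n≤1+n K)) (½^d*q≤ (≤! (+ 1 / 4) 1ℚ)) ⟩
    fromℕ (suc K) * ½ ^ℚ d                        ∎)
  wrong≤bound v u (suc i) match b refl = go (suc i ℕ.≤? K)
    where
    reject≤⅛ : 1ℚ - accept (sharpen (sharpen (R i))) v u ≤ + 1 / 8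
    reject≤⅛ = ≤-trans
      (reject-sharpen-≤ (sharpen (R i)) {+ 1 / 16} v u (reject-sharpen-≤ (R i) {+ 1 / 8} v u (reject≤ i u v match)))
      (≤! (fromℕ 4 * (+ 1 / 16 * (+ 1 / 16))) (+ 1 / 8))
    go : Dec (i ℕ.< K) → value amplified (λ a → wrong a true) v u ≤ bound (suc i)
    go (yes i<K) = ≤bound (suc i) (begin
      value amplified (λ a → wrong a true) v u      ≡⟨ value-cong amplified {λ a → wrong a true} {bit ∘ not} (λ { false → refl ; true → refl }) v u ⟩
      value amplified (bit ∘ not) v u               ≡⟨ value-not amplified v u ⟩
      1ℚ - accept amplified v u                     ≤⟨ reject-any sharpened v u i<K ⟩
      1ℚ - accept (sharpened i) v u                 ≤⟨ reject-iterate d (sharpen (sharpen (R i))) v u reject≤⅛ ⟩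
      ½ ^ℚ d * (+ 1 / 8)                            ≤⟨ *-monoˡ 0≤½^d (≤! (+ 1 / 8) 1ℚ) ⟩
      ½ ^ℚ d * 1ℚ   ≡⟨ *-comm (½ ^ℚ d) 1ℚ ⟩
      1ℚ * ½ ^ℚ d   ≤⟨ *-monoʳ 0≤½^d (1≤fromℕ (suc K)) ⟩
      fromℕ (suc K) * ½ ^ℚ d                        ∎)
    go (no i≮K) = begin
      value amplified (λ a → wrong a true) v u      ≤⟨ value-mono amplified {λ a → wrong a true} {λ _ → 1ℚ} (λ { false → ≤-refl ; true → 0≤1 }) v u ⟩
      value amplified (λ _ → 1ℚ) v u                ≡⟨ value-const amplified 1ℚ v u ⟩
      1ℚ   ≡⟨ ½^*2^ K ⟨
      ½ ^ℚ K * fromℕ 2 ^ℚ K                         ≤⟨ *-monoˡ (0≤^ K 0≤½) (^-mono-exp (1≤fromℕ 2) (ℕ.≤-trans (ℕ.≮⇒≥ i≮K) (ℕ.n≤1+n i))) ⟩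
      ½ ^ℚ K * fromℕ 2 ^ℚ suc i                     ≤⟨ ≤-by (fromℕ (suc K) * ½ ^ℚ d) (+-comm (fromℕ (suc K) * ½ ^ℚ d) (½ ^ℚ K * fromℕ 2 ^ℚ suc i)) (0≤* (0≤fromℕ (suc K)) 0≤½^d) ⟩
      bound (suc i)                                 ∎

  private
    I = inputs m
    .T≢0 : ℕ.NonZero (4 ℕ.* m)
    T≢0 = ℕ.m*n≢0 4 m

  -- The exponential moment makes the contribution of more than K matches O(2^-K).
  E-2^matches : ∀ v → E I (λ u → fromℕ 2 ^ℚ matches u v) ≤ fromℕ 4
  E-2^matches v = begin
    E I (λ u → fromℕ 2 ^ℚ matches u v)              ≡⟨ E-cong I (λ u → trans (2^matches u v) (agreeProd-sym 1ℚ 1ℚ u v)) ⟩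
    E I (agreeProd 1ℚ 1ℚ v)                         ≡⟨ E-agreeProd 1ℚ 1ℚ {{T≢0}} v ⟩
    (1ℚ + 1ℚ * fromℕ (4 ℕ.* m) ⁻¹) ^ℚ m             ≤⟨ ^-mono m (0≤+ 0≤1 (0≤* 0≤1 (0≤⁻¹ (0≤fromℕ (4 ℕ.* m))))) (+-monoʳ-≤ 1ℚ (≤-trans (≤-reflexive (*-identityˡ _)) T⁻¹≤m⁻¹)) ⟩
    (1ℚ + fromℕ m ⁻¹) ^ℚ m                          ≤⟨ [1+1/n]^n≤4 m ⟩
    fromℕ 4                                         ∎
    where
    T⁻¹ = fromℕ (4 ℕ.* m) ⁻¹
    T⁻¹≤m⁻¹ : T⁻¹ ≤ fromℕ m ⁻¹
    T⁻¹≤m⁻¹ = *-cancelˡ (0<fromℕ m) (begin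
      fromℕ m * T⁻¹                     ≤⟨ *-monoʳ (0≤⁻¹ (0≤fromℕ (4 ℕ.* m))) (fromℕ-mono (ℕ.m≤n*m m 4)) ⟩
      fromℕ (4 ℕ.* m) * T⁻¹             ≡⟨ *-⁻¹ (0<fromℕ (4 ℕ.* m) {{T≢0}}) ⟩
      1ℚ                                ≡⟨ *-⁻¹ (0<fromℕ m) ⟨
      fromℕ m * fromℕ m ⁻¹              ∎)

  E-bound : (E I λ v → E I λ u → bound (matches u v)) ≤ fromℕ (suc K) * ½ ^ℚ d + ½ ^ℚ K * fromℕ 4
  E-bound = begin
    (E I λ v → E I λ u → bound (matches u v))
      ≡⟨ (E-cong I λ v → trans (E-+ I (λ _ → X) (λ u → ½ ^ℚ K * fromℕ 2 ^ℚ matches u v)) (cong₂ _+_ (E-const I X) (E-* I (½ ^ℚ K) (λ u → fromℕ 2 ^ℚ matches u v)))) ⟩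
    (E I λ v → X + ½ ^ℚ K * E I (λ u → fromℕ 2 ^ℚ matches u v))
      ≤⟨ (E-mono I λ v → +-monoʳ-≤ X (*-monoˡ (0≤^ K 0≤½) (E-2^matches v))) ⟩
    (E I λ v → X + ½ ^ℚ K * fromℕ 4)
      ≡⟨ E-const I (X + ½ ^ℚ K * fromℕ 4) ⟩
    X + ½ ^ℚ K * fromℕ 4 ∎
    where
    X = fromℕ (suc K) * ½ ^ℚ d

  assembled : ∀ {ε} → fromℕ (suc K) * ½ ^ℚ d + ½ ^ℚ K * fromℕ 4 ≤ ε →
    ∃[ T ] treeError {m} {K ℕ.* sharpenBits d (sharpenBits 2 c)} {r} T ≤ ε
  assembled small = derandomize amplified (≤-trans (E-mono I λ v → E-mono I λ u →
    wrong≤bound v u (matches u v) refl (EE v u) (trans (EE-sym v u) (EE≡isPositive-matches u v))) (≤-trans E-bound small))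

-- K = e + 3 makes the tail 4 · 2^-K half of 2^-e. With depth K + 1 + e the other term is also at
-- most half of it, because (K + 1) 2^-K ≤ 1.
levels : ℕ → ℕ
levels e = 3 ℕ.+ e

depth : ℕ → ℕ
depth e = levels e ℕ.+ (1 ℕ.+ e)

-- Each sharpening runs four copies; 16 accounts for the two initial ones. The value depends on e
-- alone and becomes α.
blowup : ℕ → ℕ
blowup e = levels e ℕ.* (4 ℕ.^ depth e ℕ.* 16)

bits≡ : ∀ e c → levels e ℕ.* sharpenBits (depth e) (sharpenBits 2 c) ≡ blowup e ℕ.* c
bits≡ e c = trans (cong (levels e ℕ.*_) (trans (sharpenBits≡ (depth e) (sharpenBits 2 c))
    (trans (cong (4 ℕ.^ depth e ℕ.*_) (sharpenBits≡ 2 c)) (sym (ℕ.*-assoc (4 ℕ.^ depth e) 16 c)))))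
  (sym (ℕ.*-assoc (levels e) (4 ℕ.^ depth e ℕ.* 16) c))

levels-depth-small : ∀ e → fromℕ (suc (levels e)) * ½ ^ℚ depth e + ½ ^ℚ levels e * fromℕ 4 ≤ ½ ^ℚ e
levels-depth-small e = begin
  fromℕ (suc K) * ½ ^ℚ (K ℕ.+ (1 ℕ.+ e)) + ½ ^ℚ (3 ℕ.+ e) * fromℕ 4
    ≡⟨ cong (λ z → fromℕ (suc K) * z + ½ ^ℚ (3 ℕ.+ e) * fromℕ 4) (^-homo-* ½ K (1 ℕ.+ e)) ⟩
  fromℕ (suc K) * (½ ^ℚ K * (½ * ½ ^ℚ e)) + ½ ^ℚ (3 ℕ.+ e) * fromℕ 4
    ≡⟨ cong₂ _+_ (sym (*-assoc (fromℕ (suc K)) (½ ^ℚ K) (½ * ½ ^ℚ e))) (eq₁ (½ ^ℚ e)) ⟩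
  fromℕ (suc K) * ½ ^ℚ K * (½ * ½ ^ℚ e) + ½ * ½ ^ℚ e
    ≤⟨ +-monoˡ-≤ (½ * ½ ^ℚ e) (*-monoʳ (0≤* 0≤½ (0≤^ e 0≤½)) (suc-*½^≤1 K)) ⟩
  1ℚ * (½ * ½ ^ℚ e) + ½ * ½ ^ℚ e
    ≡⟨ eq₂ (½ ^ℚ e) ⟩
  ½ ^ℚ e ∎
  where
  K = levels e
  eq₁ : ∀ p → ½ * (½ * (½ * p)) * fromℕ 4 ≡ ½ * p
  eq₁ = solve-∀ ℚ-ring
  eq₂ : ∀ p → 1ℚ * (½ * p) + ½ * p ≡ p
  eq₂ = solve-∀ ℚ-ring

fair : Dist Bool
fair = bind (unif 2) λ i → point (does (i Fin.≟ zero))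

equal : ∀ {c} → Vec Bool c → Vec Bool c → ℚ
equal []       []       = 1ℚ
equal (a ∷ as) (b ∷ bs) = bit (does (a Bool.≟ b)) * equal as bs

equal-cases : ∀ {c} (a b : Vec Bool c) → (equal a b ≡ 0ℚ) ⊎ ((a ≡ b) × equal a b ≡ 1ℚ)
equal-cases []       []       = inj₂ (refl , refl)
equal-cases (a ∷ as) (b ∷ bs) with a Bool.≟ b | equal-cases as bs
... | no _     | _                = inj₁ (*-zeroˡ (equal as bs))
... | yes refl | inj₁ p           = inj₁ (trans (*-identityˡ (equal as bs)) p)
... | yes refl | inj₂ (refl , p)  = inj₂ (refl , trans (*-identityˡ (equal as as)) p)

E-equal : ∀ {c} (b : Vec Bool c) → E (iid fair c) (λ a → equal a b) ≡ ½ ^ℚ c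
E-equal []                = refl
E-equal {suc c} (b ∷ bs) = trans (E-cong fair λ a → E-* (iid fair c) (bit (does (a Bool.≟ b))) (λ as → equal as bs))
  (trans (E-*ʳ fair _ (λ a → bit (does (a Bool.≟ b)))) (cong₂ _*_ (E-fair b) (E-equal bs)))
  where
  E-fair : ∀ b → E fair (λ a → bit (does (a Bool.≟ b))) ≡ ½
  E-fair false = refl
  E-fair true  = refl

module Message {n c r : ℕ} .{{n≢0 : ℕ.NonZero n}} (msg : Input n → Vec Bool c) (k : Vec Bool c → ExactTree (Input n) (Input n) c r)
  {ε : ℚ} (0<ε : 0ℚ < ε)
  (error≤ : (E (inputs n) λ x → E (inputs n) λ y → wrong (runExact (k (msg x)) y x) (EE x y)) ≤ ε) where

  private
    I = inputs n
    Ms = iid fair c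
    W : Vec Bool c → Input n → Input n → ℚ
    W m x y = wrong (runExact (k m) y x) (EE x y)
    err : Vec Bool c → ℚ
    err m = E I λ x → E I λ y → equal m (msg x) * W m x y
    mass : Vec Bool c → ℚ
    mass m = E I λ x → equal m (msg x)
    q = ½ ^ℚ c
    err₀ = E I λ x → E I λ y → W (msg x) x y

    equal-*-W : ∀ m x y → equal m (msg x) * W m x y ≡ equal m (msg x) * W (msg x) x y
    equal-*-W m x y = go (equal-cases m (msg x))
      where
      go : (equal m (msg x) ≡ 0ℚ) ⊎ ((m ≡ msg x) × equal m (msg x) ≡ 1ℚ) → equal m (msg x) * W m x y ≡ equal m (msg x) * W (msg x) x y
      go (inj₁ p)       = trans (cong (_* W m x y) p) (trans (*-zeroˡ (W m x y)) (trans (sym (*-zeroˡ (W (msg x) x y))) (cong (_* W (msg x) x y) (sym p))))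
      go (inj₂ (p , _)) = cong (λ z → equal m (msg x) * W z x y) p

    E-err : E Ms err ≡ q * err₀
    E-err = begin-equality
      (E Ms λ m → E I λ x → E I λ y → equal m (msg x) * W m x y)
        ≡⟨ (E-cong Ms λ m → E-cong I λ x → trans (E-cong I λ y → equal-*-W m x y) (E-* I (equal m (msg x)) (W (msg x) x))) ⟩
      (E Ms λ m → E I λ x → equal m (msg x) * E I (W (msg x) x))
        ≡⟨ E-swap Ms I (λ m x → equal m (msg x) * E I (W (msg x) x)) ⟩
      (E I λ x → E Ms λ m → equal m (msg x) * E I (W (msg x) x))
        ≡⟨ (E-cong I λ x → trans (E-*ʳ Ms (E I (W (msg x) x)) (λ m → equal m (msg x))) (cong (_* E I (W (msg x) x)) (E-equal (msg x)))) ⟩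
      (E I λ x → q * E I (W (msg x) x))
        ≡⟨ E-* I q (λ x → E I (W (msg x) x)) ⟩
      q * err₀ ∎

    E-mass : E Ms mass ≡ q
    E-mass = trans (E-swap Ms I (λ m x → equal m (msg x))) (trans (E-cong I λ x → E-equal (msg x)) (E-const I q))

    0≤q : 0ℚ ≤ q
    0≤q = 0≤^ c 0≤½

    -- One quantity encodes both demands on a message. Its mean is at most qε + εq - 2εq = 0, and a
    -- message with score at most 0 has error at most 2ε times its mass and, because of the term εq,
    -- mass at least q/2.
    score : Vec Bool c → ℚ
    score m = (err m + ε * q) - fromℕ 2 * ε * mass m

    E-score≤0 : E Ms score ≤ 0ℚ
    E-score≤0 = begin
      E Ms score
        ≡⟨ E-- Ms (λ m → err m + ε * q) (λ m → fromℕ 2 * ε * mass m) ⟩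
      E Ms (λ m → err m + ε * q) - E Ms (λ m → fromℕ 2 * ε * mass m)
        ≡⟨ cong₂ _-_ (trans (E-+ Ms err (λ _ → ε * q)) (cong₂ _+_ E-err (E-const Ms (ε * q)))) (trans (E-* Ms (fromℕ 2 * ε) mass) (cong (fromℕ 2 * ε *_) E-mass)) ⟩
      (q * err₀ + ε * q) - fromℕ 2 * ε * q
        ≤⟨ +-monoˡ-≤ (- (fromℕ 2 * ε * q)) (+-monoˡ-≤ (ε * q) (*-monoˡ 0≤q error≤)) ⟩
      (q * ε + ε * q) - fromℕ 2 * ε * q
        ≡⟨ eq q ε ⟩
      0ℚ ∎
      where
      eq : ∀ q ε → (q * ε + ε * q) - fromℕ 2 * ε * q ≡ 0ℚ
      eq = solve-∀ ℚ-ring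

    picked : ∃[ m ] score m ≤ E Ms score
    picked = E-pick Ms score

  message : Vec Bool c
  message = proj₁ picked

  private
    score≤0 : score message ≤ 0ℚ
    score≤0 = ≤-trans (proj₂ picked) E-score≤0

    combined : err message + ε * q ≤ fromℕ 2 * ε * mass message
    combined = 0≤-⇒≤ (≤-trans (neg-antimono-≤ score≤0) (≤-reflexive (eq (err message + ε * q) (fromℕ 2 * ε * mass message))))
      where
      eq : ∀ a b → - (a - b) ≡ b - a
      eq = solve-∀ ℚ-ring

    0≤err : 0ℚ ≤ err message
    0≤err = E-0≤ I λ x → E-0≤ I λ y → 0≤* (0≤equal message (msg x)) (0≤wrong (runExact (k message) y x) (EE x y))
      where
      0≤equal : ∀ {c} (a b : Vec Bool c) → 0ℚ ≤ equal a b
      0≤equal []       []       = 0≤1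
      0≤equal (a ∷ as) (b ∷ bs) = 0≤* (0≤bit (does (a Bool.≟ b))) (0≤equal as bs)

  -- The indicator of the inputs on which the chosen message is sent.
  sender : Input n → ℚ
  sender x = equal message (msg x)

  sender-0∨1 : ∀ x → (sender x ≡ 0ℚ) ⊎ (sender x ≡ 1ℚ)
  sender-0∨1 x = go (equal-cases message (msg x))
    where
    go : (sender x ≡ 0ℚ) ⊎ ((message ≡ msg x) × sender x ≡ 1ℚ) → (sender x ≡ 0ℚ) ⊎ (sender x ≡ 1ℚ)
    go (inj₁ p)       = inj₁ p
    go (inj₂ (_ , p)) = inj₂ p

  sender-error : (E I λ x → E I λ y → sender x * wrong (runExact (k message) y x) (EE x y)) ≤ fromℕ 2 * ε * E I sender
  sender-error = ≤-trans (≤-by (ε * q) refl (0≤* (<⇒≤ 0<ε) 0≤q)) combined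

  sender-mass : 1ℚ ≤ E I sender * fromℕ 2 ^ℚ (c ℕ.+ 1)
  sender-mass = *-cancelˡ 0<ε (begin
    ε * 1ℚ   ≡⟨ cong (ε *_) (½^*2^ c) ⟨
    ε * (q * fromℕ 2 ^ℚ c)                          ≡⟨ *-assoc ε q (fromℕ 2 ^ℚ c) ⟨
    ε * q * fromℕ 2 ^ℚ c                            ≤⟨ *-monoʳ (0≤^ c (0≤fromℕ 2)) εq≤ ⟩
    fromℕ 2 * ε * mass message * fromℕ 2 ^ℚ c       ≡⟨ eq ε (mass message) (fromℕ 2 ^ℚ c) ⟩
    ε * (mass message * (fromℕ 2 ^ℚ c * fromℕ 2 ^ℚ 1)) ≡⟨ cong (λ z → ε * (mass message * z)) (^-homo-* (fromℕ 2) c 1) ⟨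
    ε * (mass message * fromℕ 2 ^ℚ (c ℕ.+ 1))       ∎)
    where
    εq≤ : ε * q ≤ fromℕ 2 * ε * mass message
    εq≤ = ≤-trans (≤-by (err message) (+-comm (err message) (ε * q)) 0≤err) combined
    eq : ∀ ε m p → fromℕ 2 * ε * m * p ≡ ε * (m * (p * (fromℕ 2 * 1ℚ)))
    eq = solve-∀ ℚ-ring

-- One-round protocols

module Pairs (t : ℕ) .{{t≢0 : ℕ.NonZero t}} (2≤t : 2 ℕ.≤ t) where

  private variable
    n : ℕ

  private
    U = unif t
    q = fromℕ t ⁻¹
    a = 1ℚ - q
    z = 1ℚ - fromℕ 2 * q

    0≤q : 0ℚ ≤ q
    0≤q = 0≤⁻¹ (0≤fromℕ t)

    2q≤1 : fromℕ 2 * q ≤ 1ℚ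
    2q≤1 = ≤-trans (*-monoʳ 0≤q (fromℕ-mono 2≤t)) (≤-reflexive (*-⁻¹ (0<fromℕ t)))

    0≤z : 0ℚ ≤ z
    0≤z = ≤⇒0≤- 2q≤1

    z≤a : z ≤ a
    z≤a = ≤-by q (eq q) 0≤q
      where
      eq : ∀ q → 1ℚ - q ≡ (1ℚ - fromℕ 2 * q) + q
      eq = solve-∀ ℚ-ring

    0≤a : 0ℚ ≤ a
    0≤a = ≤-trans 0≤z z≤a

  -- The chance that a uniform y agrees with neither vector: a coordinate contributes 1 - 2q where
  -- they differ and 1 - q where they coincide.
  bothMiss : Vec (Fin t) n → Vec (Fin t) n → ℚ
  bothMiss = agreeProd z q

  E-bothMiss₁ : ∀ (i j : Fin t) → E U (λ k → (1ℚ + - 1ℚ * δ i k) * (1ℚ + - 1ℚ * δ j k)) ≡ z + q * δ i j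
  E-bothMiss₁ i j = begin-equality
    E U (λ k → (1ℚ + - 1ℚ * δ i k) * (1ℚ + - 1ℚ * δ j k))
      ≡⟨ E-cong U (λ k → eq₁ (δ i k) (δ j k)) ⟩
    E U (λ k → (1ℚ - (δ i k + δ j k)) + δ i k * δ j k)
      ≡⟨ E-+ U (λ k → 1ℚ - (δ i k + δ j k)) (λ k → δ i k * δ j k) ⟩
    E U (λ k → 1ℚ - (δ i k + δ j k)) + E U (λ k → δ i k * δ j k)
      ≡⟨ cong₂ _+_ (trans (E-1- U (λ k → δ i k + δ j k)) (cong (λ e → 1ℚ - e) (trans (E-+ U (δ i) (δ j)) (cong₂ _+_ (E-δ₁ t i) (E-δ₁ t j))))) (E-δ t i (δ j)) ⟩
    (1ℚ - (q + q)) + q * δ j i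
      ≡⟨ cong₂ (λ d e → d + q * e) (eq₂ q) (δ-sym j i) ⟩
    z + q * δ i j ∎
    where
    eq₁ : ∀ d e → (1ℚ + - 1ℚ * d) * (1ℚ + - 1ℚ * e) ≡ (1ℚ - (d + e)) + d * e
    eq₁ = solve-∀ ℚ-ring
    eq₂ : ∀ q → 1ℚ - (q + q) ≡ 1ℚ - fromℕ 2 * q
    eq₂ = solve-∀ ℚ-ring

  E-bothMiss : (x x′ : Vec (Fin t) n) → E (iid U n) (λ y → disagree x y * disagree x′ y) ≡ bothMiss x x′
  E-bothMiss         []      []        = refl
  E-bothMiss {suc n} (i ∷ x) (j ∷ x′) = trans (E-cong U λ k → trans (E-cong V λ y → eq (1ℚ + - 1ℚ * δ i k) (disagree x y) (1ℚ + - 1ℚ * δ j k) (disagree x′ y))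
      (trans (E-* V ((1ℚ + - 1ℚ * δ i k) * (1ℚ + - 1ℚ * δ j k)) (λ y → disagree x y * disagree x′ y)) (cong ((1ℚ + - 1ℚ * δ i k) * (1ℚ + - 1ℚ * δ j k) *_) (E-bothMiss x x′))))
    (trans (E-*ʳ U (bothMiss x x′) (λ k → (1ℚ + - 1ℚ * δ i k) * (1ℚ + - 1ℚ * δ j k))) (cong (_* bothMiss x x′) (E-bothMiss₁ i j)))
    where
    V = iid U n
    eq : ∀ a b c d → a * b * (c * d) ≡ a * c * (b * d)
    eq = solve-∀ ℚ-ring

  z+q≡a : ∀ {d} → d ≡ 1ℚ → z + q * d ≡ a
  z+q≡a refl = eq q
    where
    eq : ∀ q → (1ℚ - fromℕ 2 * q) + q * 1ℚ ≡ 1ℚ - q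
    eq = solve-∀ ℚ-ring

  z+q≡z : ∀ {d} → d ≡ 0ℚ → z + q * d ≡ z
  z+q≡z refl = trans (cong (_+_ z) (*-zeroʳ q)) (+-identityʳ z)

  bothMiss-≤-a^n : (x x′ : Vec (Fin t) n) → bothMiss x x′ ≤ a ^ℚ n
  bothMiss-≤-a^n         []      []       = ≤-refl
  bothMiss-≤-a^n {suc n} (i ∷ x) (j ∷ x′) = *-mono (factor-0≤ 0≤z (0≤+ 0≤z 0≤q) i j) (0≤^ n 0≤a) (factor≤a (δ-cases i j)) (bothMiss-≤-a^n x x′)
    where
    factor≤a : (δ i j ≡ 0ℚ) ⊎ ((i ≡ j) × δ i j ≡ 1ℚ) → z + q * δ i j ≤ a
    factor≤a (inj₁ p)       = ≤-trans (≤-reflexive (z+q≡z p)) z≤a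
    factor≤a (inj₂ (_ , p)) = ≤-reflexive (z+q≡a p)

  same : Vec (Fin t) n → Vec (Fin t) n → ℚ
  same = agreeProd 0ℚ 1ℚ

  -- A single differing coordinate already replaces a factor a by z. The extra a on the left avoids
  -- the exponent n - 1.
  bothMiss-≤ : (x x′ : Vec (Fin t) n) → a * bothMiss x x′ ≤ a ^ℚ n * (z + q * same x x′)
  bothMiss-≤ [] [] = ≤-reflexive (trans (*-identityʳ a) (trans (sym (z+q≡a refl)) (sym (*-identityˡ _))))
  bothMiss-≤ {suc n} (i ∷ x) (j ∷ x′) = go (δ-cases i j)
    where
    eq₁ : ∀ a z p → a * (z * p) ≡ a * z * p
    eq₁ = solve-∀ ℚ-ring
    eq₂ : ∀ a z q s p → a * z * p ≡ a * p * (z + q * ((0ℚ + 1ℚ * 0ℚ) * s))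
    eq₂ = solve-∀ ℚ-ring
    eq₃ : ∀ a p z q s → a * (p * (z + q * s)) ≡ a * p * (z + q * ((0ℚ + 1ℚ * 1ℚ) * s))
    eq₃ = solve-∀ ℚ-ring
    go : (δ i j ≡ 0ℚ) ⊎ ((i ≡ j) × δ i j ≡ 1ℚ) → a * ((z + q * δ i j) * bothMiss x x′) ≤ a ^ℚ suc n * (z + q * ((0ℚ + 1ℚ * δ i j) * same x x′))
    go (inj₁ p) = begin
      a * ((z + q * δ i j) * bothMiss x x′)                          ≡⟨ cong (λ e → a * (e * bothMiss x x′)) (z+q≡z p) ⟩
      a * (z * bothMiss x x′)   ≡⟨ eq₁ a z (bothMiss x x′) ⟩
      a * z * bothMiss x x′   ≤⟨ *-monoˡ (0≤* 0≤a 0≤z) (bothMiss-≤-a^n x x′) ⟩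
      a * z * a ^ℚ n   ≡⟨ eq₂ a z q (same x x′) (a ^ℚ n) ⟩
      a ^ℚ suc n * (z + q * ((0ℚ + 1ℚ * 0ℚ) * same x x′))            ≡⟨ cong (λ e → a ^ℚ suc n * (z + q * ((0ℚ + 1ℚ * e) * same x x′))) p ⟨
      a ^ℚ suc n * (z + q * ((0ℚ + 1ℚ * δ i j) * same x x′))         ∎
    go (inj₂ (_ , p)) = begin
      a * ((z + q * δ i j) * bothMiss x x′)                          ≡⟨ cong (λ e → a * (e * bothMiss x x′)) (z+q≡a p) ⟩
      a * (a * bothMiss x x′)   ≤⟨ *-monoˡ 0≤a (bothMiss-≤ x x′) ⟩
      a * (a ^ℚ n * (z + q * same x x′))                             ≡⟨ eq₃ a (a ^ℚ n) z q (same x x′) ⟩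
      a ^ℚ suc n * (z + q * ((0ℚ + 1ℚ * 1ℚ) * same x x′))            ≡⟨ cong (λ e → a ^ℚ suc n * (z + q * ((0ℚ + 1ℚ * e) * same x x′))) p ⟨
      a ^ℚ suc n * (z + q * ((0ℚ + 1ℚ * δ i j) * same x x′))         ∎

  -- `a ^ℚ n - bothMiss x x′` is the chance that y meets one vector but not the other; for distinct
  -- vectors it is at least a^(n-1) q, as a - z = q.
  separation : (x x′ : Vec (Fin t) n) → a ^ℚ n * q * (1ℚ - same x x′) ≤ a * (a ^ℚ n - bothMiss x x′)
  separation {n} x x′ = ≤-by (a ^ℚ n * (z + q * same x x′) - a * bothMiss x x′) (eq q (a ^ℚ n) (same x x′) (bothMiss x x′)) (≤⇒0≤- (bothMiss-≤ x x′))
    where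
    eq : ∀ q p s b → (1ℚ - q) * (p - b) ≡ p * q * (1ℚ - s) + (p * ((1ℚ - fromℕ 2 * q) + q * s) - (1ℚ - q) * b)
    eq = solve-∀ ℚ-ring

-- Once the message is fixed, y alone decides the output for all x in S. A random y separates two
-- distinct members of S with chance of order 1/n and is then wrong for one of them, so the error on
-- S is of order 1/n.
module OneRound (n c : ℕ) .{{n≢0 : ℕ.NonZero n}}
  (s : Input n → ℚ) (0∨1 : ∀ x → (s x ≡ 0ℚ) ⊎ (s x ≡ 1ℚ)) (f : Input n → Bool) (ε : ℚ)
  (error-s : (E (inputs n) λ x → E (inputs n) λ y → s x * wrong (f y) (EE x y)) ≤ fromℕ 2 * ε * E (inputs n) s)
  (μ-large : 1ℚ ≤ E (inputs n) s * fromℕ 2 ^ℚ (c ℕ.+ 1))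
  (c-small : fromℕ 2 ^ℚ (c ℕ.+ 2) ≤ fromℕ (4 ℕ.* n) ^ℚ n)
  (ε-small : fromℕ 64 * fromℕ n * ε ≤ 1ℚ)
  where

  private
    t = 4 ℕ.* n
    I = inputs n

    instance
      t≢0 : ℕ.NonZero t
      t≢0 = ℕ.m*n≢0 4 n

    2≤t : 2 ℕ.≤ t
    2≤t = ℕ.≤-trans (ℕ.s≤s (ℕ.s≤s ℕ.z≤n)) (ℕ.m≤m*n 4 n)

  open Pairs t 2≤t

  private
    q a μ : ℚ
    q = fromℕ t ⁻¹
    a = 1ℚ - q
    μ = E I s

    W : Input n → Input n → ℚ
    W x y = wrong (f y) (EE x y)

    0≤s : ∀ x → 0ℚ ≤ s x
    0≤s x = 0≤-0∨1 (0∨1 x)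

    s≤1 : ∀ x → s x ≤ 1ℚ
    s≤1 x = go (0∨1 x)
      where
      go : (s x ≡ 0ℚ) ⊎ (s x ≡ 1ℚ) → s x ≤ 1ℚ
      go (inj₁ p) = ≤-trans (≤-reflexive p) 0≤1
      go (inj₂ p) = ≤-reflexive p

    0≤q : 0ℚ ≤ q
    0≤q = 0≤⁻¹ (0≤fromℕ t)

    q≤1 : q ≤ 1ℚ
    q≤1 = ⁻¹≤1 (1≤fromℕ t)

    0<μ : 0ℚ < μ
    0<μ = ≰⇒> λ μ≤0 → <⇒≱ 0<1 (≤-trans μ-large (≤-trans (*-monoʳ (0≤^ (c ℕ.+ 1) (0≤fromℕ 2)) μ≤0) (≤-reflexive (*-zeroˡ (fromℕ 2 ^ℚ (c ℕ.+ 1))))))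

    -- If y meets x but not x′, then one of f y ≠ EE x y and f y ≠ EE x′ y holds.
    clash : ∀ x x′ y → disagree x′ y - disagree x y * disagree x′ y ≤ W x y + W x′ y
    clash x x′ y = subst₂ (λ d d′ → d′ - d * d′ ≤ W x y + W x′ y) (1-EE x y) (1-EE x′ y) (go (f y) (EE x y) (EE x′ y))
      where
      go : ∀ b e e′ → (1ℚ - bit e′) - (1ℚ - bit e) * (1ℚ - bit e′) ≤ wrong b e + wrong b e′
      go false false false = ≤! 0ℚ 0ℚ
      go false false true  = ≤! 0ℚ 1ℚ
      go false true  false = ≤! 1ℚ 1ℚ
      go false true  true  = ≤! 0ℚ (1ℚ + 1ℚ)
      go true  false false = ≤! 0ℚ (1ℚ + 1ℚ)
      go true  false true  = ≤! 0ℚ 1ℚ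
      go true  true  false = ≤! 1ℚ 1ℚ
      go true  true  true  = ≤! 0ℚ 0ℚ

    clash-mean : ∀ x x′ → a ^ℚ n - bothMiss x x′ ≤ E I (W x) + E I (W x′)
    clash-mean x x′ = begin
      a ^ℚ n - bothMiss x x′
        ≡⟨ cong₂ _-_ (trans (cong (_^ℚ n) (eq q)) (sym (E-agreeProd 1ℚ (- 1ℚ) x′))) (sym (E-bothMiss x x′)) ⟩
      E I (disagree x′) - E I (λ y → disagree x y * disagree x′ y)
        ≡⟨ E-- I (disagree x′) (λ y → disagree x y * disagree x′ y) ⟨
      E I (λ y → disagree x′ y - disagree x y * disagree x′ y)
        ≤⟨ E-mono I (clash x x′) ⟩
      E I (λ y → W x y + W x′ y)
        ≡⟨ E-+ I (W x) (W x′) ⟩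
      E I (W x) + E I (W x′) ∎
      where
      eq : ∀ q → 1ℚ - q ≡ 1ℚ + - 1ℚ * q
      eq = solve-∀ ℚ-ring

    err : ℚ
    err = E I λ x → s x * E I (W x)

    err≤ : err ≤ fromℕ 2 * ε * μ
    err≤ = ≤-trans (≤-reflexive (E-cong I λ x → sym (E-* I (s x) (W x)))) error-s

    E²-W : (E I λ x → E I λ x′ → s x * s x′ * (E I (W x) + E I (W x′))) ≡ fromℕ 2 * (μ * err)
    E²-W = begin-equality
      (E I λ x → E I λ x′ → s x * s x′ * (E I (W x) + E I (W x′)))
        ≡⟨ (E-cong I λ x → trans (E-cong I λ x′ → eq₁ (s x) (s x′) (E I (W x)) (E I (W x′)))
              (trans (E-+ I (λ x′ → s x * E I (W x) * s x′) (λ x′ → s x * (s x′ * E I (W x′))))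
                     (cong₂ _+_ (E-* I (s x * E I (W x)) s) (E-* I (s x) (λ x′ → s x′ * E I (W x′)))))) ⟩
      (E I λ x → s x * E I (W x) * μ + s x * err)
        ≡⟨ trans (E-+ I (λ x → s x * E I (W x) * μ) (λ x → s x * err)) (cong₂ _+_ (E-*ʳ I μ (λ x → s x * E I (W x))) (E-*ʳ I err s)) ⟩
      err * μ + μ * err
        ≡⟨ eq₂ err μ ⟩
      fromℕ 2 * (μ * err) ∎
      where
      eq₁ : ∀ s s′ w w′ → s * s′ * (w + w′) ≡ s * w * s′ + s * (s′ * w′)
      eq₁ = solve-∀ ℚ-ring
      eq₂ : ∀ e m → e * m + m * e ≡ fromℕ 2 * (m * e)
      eq₂ = solve-∀ ℚ-ring

    same≤ : ∀ x → E I (λ x′ → s x′ * same x x′) ≤ q ^ℚ n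
    same≤ x = begin
      E I (λ x′ → s x′ * same x x′)   ≤⟨ (E-mono I λ x′ → ≤-trans (*-monoʳ (agreeProd-0≤ ≤-refl 0≤1 x x′) (s≤1 x′)) (≤-reflexive (*-identityˡ (same x x′)))) ⟩
      E I (same x)                    ≡⟨ E-agreeProd 0ℚ 1ℚ x ⟩
      (0ℚ + 1ℚ * q) ^ℚ n              ≡⟨ cong (_^ℚ n) (eq q) ⟩
      q ^ℚ n                          ∎
      where
      eq : ∀ q → 0ℚ + 1ℚ * q ≡ q
      eq = solve-∀ ℚ-ring

    -- For a fixed x, the coincidence x′ = x has probability q^n, so almost all pairs from S consist
    -- of distinct inputs once μ exceeds q^n.
    E²-same : μ * (μ - q ^ℚ n) ≤ E I λ x → E I λ x′ → s x * s x′ * (1ℚ - same x x′)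
    E²-same = begin
      μ * (μ - q ^ℚ n)
        ≡⟨ E-*ʳ I (μ - q ^ℚ n) s ⟨
      (E I λ x → s x * (μ - q ^ℚ n))
        ≤⟨ (E-mono I λ x → *-monoˡ (0≤s x) (+-monoʳ-≤ μ (neg-antimono-≤ (same≤ x)))) ⟩
      (E I λ x → s x * (μ - E I (λ x′ → s x′ * same x x′)))
        ≡⟨ (E-cong I λ x → trans (cong (s x *_) (sym (E-- I s (λ x′ → s x′ * same x x′)))) (trans (sym (E-* I (s x) (λ x′ → s x′ - s x′ * same x x′))) (E-cong I λ x′ → eq (s x) (s x′) (same x x′)))) ⟩
      (E I λ x → E I λ x′ → s x * s x′ * (1ℚ - same x x′)) ∎
      where
      eq : ∀ s s′ d → s * (s′ - s′ * d) ≡ s * s′ * (1ℚ - d)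
      eq = solve-∀ ℚ-ring

    0≤a : 0ℚ ≤ a
    0≤a = ≤⇒0≤- q≤1

    a≤1 : a ≤ 1ℚ
    a≤1 = ≤-by q (1≡[1-a]+a q) 0≤q

    A : ℚ
    A = a ^ℚ n * q

    0≤A : 0ℚ ≤ A
    0≤A = 0≤* (0≤^ n 0≤a) 0≤q

    main : A * (μ * (μ - q ^ℚ n)) ≤ a * (fromℕ 2 * (μ * err))
    main = begin
      A * (μ * (μ - q ^ℚ n))
        ≤⟨ *-monoˡ 0≤A E²-same ⟩
      A * (E I λ x → E I λ x′ → s x * s x′ * (1ℚ - same x x′))
        ≡⟨ E²-* A (λ x x′ → s x * s x′ * (1ℚ - same x x′)) ⟨
      (E I λ x → E I λ x′ → A * (s x * s x′ * (1ℚ - same x x′)))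
        ≤⟨ (E-mono I λ x → E-mono I λ x′ → bound x x′) ⟩
      (E I λ x → E I λ x′ → a * (s x * s x′ * (E I (W x) + E I (W x′))))
        ≡⟨ E²-* a (λ x x′ → s x * s x′ * (E I (W x) + E I (W x′))) ⟩
      a * (E I λ x → E I λ x′ → s x * s x′ * (E I (W x) + E I (W x′)))
        ≡⟨ cong (a *_) E²-W ⟩
      a * (fromℕ 2 * (μ * err)) ∎
      where
      E²-* : ∀ k (F : Input n → Input n → ℚ) → (E I λ x → E I λ x′ → k * F x x′) ≡ k * (E I λ x → E I λ x′ → F x x′)
      E²-* k F = trans (E-cong I λ x → E-* I k (F x)) (E-* I k (λ x → E I (F x)))
      bound : ∀ x x′ → A * (s x * s x′ * (1ℚ - same x x′)) ≤ a * (s x * s x′ * (E I (W x) + E I (W x′)))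
      bound x x′ = begin
        A * (s x * s x′ * (1ℚ - same x x′))                   ≡⟨ x∙yz≈y∙xz A (s x * s x′) (1ℚ - same x x′) ⟩
        s x * s x′ * (A * (1ℚ - same x x′))                   ≤⟨ *-monoˡ (0≤* (0≤s x) (0≤s x′)) (separation x x′) ⟩
        s x * s x′ * (a * (a ^ℚ n - bothMiss x x′))           ≤⟨ *-monoˡ (0≤* (0≤s x) (0≤s x′)) (*-monoˡ 0≤a (clash-mean x x′)) ⟩
        s x * s x′ * (a * (E I (W x) + E I (W x′)))           ≡⟨ x∙yz≈y∙xz (s x * s x′) a (E I (W x) + E I (W x′)) ⟩
        a * (s x * s x′ * (E I (W x) + E I (W x′)))           ∎

    -- The bound on c enters here: 2^(c+2) ≤ (4n)^n gives S at least twice the mass of a single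
    -- input.
    2q^n≤μ : fromℕ 2 * q ^ℚ n ≤ μ
    2q^n≤μ = *-cancelˡ (0<^ (c ℕ.+ 1) (0<fromℕ 2)) (begin
      P * (fromℕ 2 * q ^ℚ n)              ≡⟨ eq P (fromℕ 2) (q ^ℚ n) ⟩
      (P * fromℕ 2) * q ^ℚ n              ≡⟨ cong (_* q ^ℚ n) (trans (cong (P *_) (sym (*-identityʳ (fromℕ 2)))) (trans (sym (^-homo-* (fromℕ 2) (c ℕ.+ 1) 1)) (cong (fromℕ 2 ^ℚ_) (ℕ.+-assoc c 1 1)))) ⟩
      fromℕ 2 ^ℚ (c ℕ.+ 2) * q ^ℚ n       ≤⟨ *-monoʳ (0≤^ n 0≤q) c-small ⟩
      fromℕ t ^ℚ n * q ^ℚ n               ≡⟨ ^-distrib-* (fromℕ t) q n ⟨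
      (fromℕ t * q) ^ℚ n                  ≡⟨ trans (cong (_^ℚ n) (*-⁻¹ (0<fromℕ t))) (1^ n) ⟩
      1ℚ   ≤⟨ μ-large ⟩
      μ * P                               ≡⟨ *-comm μ P ⟩
      P * μ                               ∎)
      where
      P = fromℕ 2 ^ℚ (c ℕ.+ 1)
      eq : ∀ a b c → a * (b * c) ≡ (a * b) * c
      eq = solve-∀ ℚ-ring

    4nq≡1 : fromℕ 4 * (fromℕ n * q) ≡ 1ℚ
    4nq≡1 = trans (sym (*-assoc (fromℕ 4) (fromℕ n) q)) (trans (cong (_* q) (sym (fromℕ-* 4 n))) (*-⁻¹ (0<fromℕ t)))

    ¾≤a^n : + 3 / 4 ≤ a ^ℚ n
    ¾≤a^n = begin
      + 3 / 4                         ≡⟨⟩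
      1ℚ - (+ 1 / 4) * 1ℚ             ≡⟨ cong (λ z → 1ℚ - (+ 1 / 4) * z) 4nq≡1 ⟨
      1ℚ - (+ 1 / 4) * (fromℕ 4 * (fromℕ n * q)) ≡⟨ eq (fromℕ n) q ⟩
      1ℚ + fromℕ n * (- q)            ≤⟨ bernoulli n 0≤a ⟩
      a ^ℚ n                          ∎
      where
      eq : ∀ n q → 1ℚ - (+ 1 / 4) * (fromℕ 4 * (n * q)) ≡ 1ℚ + n * (- q)
      eq = solve-∀ ℚ-ring

    0≤err : 0ℚ ≤ err
    0≤err = E-0≤ I λ x → 0≤* (0≤s x) (E-0≤ I λ y → 0≤wrong (f y) (EE x y))

    -- Dividing `main` by μ² leaves (3/4) q · (1/2) ≤ 2 · 2ε.
    ε-large : + 3 / 32 * q ≤ ε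
    ε-large = *-cancelˡ (0<* 0<μ 0<μ) (begin
      μ * μ * (+ 3 / 32 * q)                  ≡⟨ eq₁ μ q ⟩
      (+ 1 / 4) * ((+ 3 / 4 * q) * (μ * (½ * μ)))  ≤⟨ *-monoˡ (≤! 0ℚ (+ 1 / 4)) (*-mono (0≤* (≤! 0ℚ (+ 3 / 4)) 0≤q) (0≤* (<⇒≤ 0<μ) 0≤μ-q^n) (*-monoʳ 0≤q ¾≤a^n) (*-monoˡ (<⇒≤ 0<μ) ½μ≤)) ⟩
      (+ 1 / 4) * (A * (μ * (μ - q ^ℚ n)))    ≤⟨ *-monoˡ (≤! 0ℚ (+ 1 / 4)) main ⟩
      (+ 1 / 4) * (a * (fromℕ 2 * (μ * err))) ≤⟨ *-monoˡ {b = fromℕ 2 * (μ * err)} (≤! 0ℚ (+ 1 / 4)) (≤-trans (*-monoʳ (0≤* (0≤fromℕ 2) (0≤* (<⇒≤ 0<μ) 0≤err)) a≤1) (≤-reflexive (*-identityˡ (fromℕ 2 * (μ * err))))) ⟩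
      (+ 1 / 4) * (fromℕ 2 * (μ * err))       ≤⟨ *-monoˡ (≤! 0ℚ (+ 1 / 4)) (*-monoˡ (0≤fromℕ 2) (*-monoˡ (<⇒≤ 0<μ) err≤)) ⟩
      (+ 1 / 4) * (fromℕ 2 * (μ * (fromℕ 2 * ε * μ))) ≡⟨ eq₂ μ ε ⟩
      μ * μ * ε                               ∎)
      where
      eq₁ : ∀ m q → m * m * (+ 3 / 32 * q) ≡ (+ 1 / 4) * ((+ 3 / 4 * q) * (m * (½ * m)))
      eq₁ = solve-∀ ℚ-ring
      eq₂ : ∀ m e → (+ 1 / 4) * (fromℕ 2 * (m * (fromℕ 2 * e * m))) ≡ m * m * e
      eq₂ = solve-∀ ℚ-ring
      eq₃ : ∀ m p → m - p ≡ ½ * m + ½ * (m - fromℕ 2 * p)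
      eq₃ = solve-∀ ℚ-ring
      ½μ≤ : ½ * μ ≤ μ - q ^ℚ n
      ½μ≤ = ≤-by (½ * (μ - fromℕ 2 * q ^ℚ n)) (eq₃ μ (q ^ℚ n)) (0≤* 0≤½ (≤⇒0≤- 2q^n≤μ))
      0≤μ-q^n : 0ℚ ≤ μ - q ^ℚ n
      0≤μ-q^n = ≤-trans (0≤* 0≤½ (<⇒≤ 0<μ)) ½μ≤

  impossible : ⊥
  impossible = toWitnessFalse {a? = 1ℚ + ½ ≤? 1ℚ} tt (begin
    -- Since q = 1/(4n), 64n · (3/32) q = 3/2, which exceeds 1.
    1ℚ + ½   ≡⟨ trans (cong (λ z → (1ℚ + ½) * z) (sym 4nq≡1)) (eq (fromℕ n) q) ⟩
    fromℕ 64 * fromℕ n * (+ 3 / 32 * q)        ≤⟨ *-monoˡ (0≤* (0≤fromℕ 64) (0≤fromℕ n)) ε-large ⟩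
    fromℕ 64 * fromℕ n * ε                     ≤⟨ ε-small ⟩
    1ℚ                                         ∎)
    where
    eq : ∀ n q → (1ℚ + ½) * (fromℕ 4 * (n * q)) ≡ fromℕ 64 * n * (+ 3 / 32 * q)
    eq = solve-∀ ℚ-ring

-- Size parameters

-- Messages of no bits carry nothing, so the output depends on one input; the summand records whose
-- it is relative to the first mover.
collapse : ∀ {n r} → Tree n 0 r → (Input n → Bool) ⊎ (Input n → Bool)
collapse (output f)   = inj₁ f
collapse (send msg k) = Sum.swap (collapse (k []))

runCollapsed : ∀ {n} → (Input n → Bool) ⊎ (Input n → Bool) → Input n → Input n → Bool
runCollapsed (inj₁ f) own other = f own
runCollapsed (inj₂ f) own other = f other

run-collapse : ∀ {n r} (T : Tree n 0 r) (x y : Input n) → runTree T x y ≡ runCollapsed (collapse T) x y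
run-collapse (output f)   x y = refl
run-collapse (send msg k) x y = trans (go (msg x)) (swapped (collapse (k [])))
  where
  go : ∀ m → runTree (k m) y x ≡ runCollapsed (collapse (k [])) y x
  go [] = run-collapse (k []) y x
  swapped : ∀ t → runCollapsed t y x ≡ runCollapsed (Sum.swap t) x y
  swapped (inj₁ f) = refl
  swapped (inj₂ f) = refl

-- For c = 0 the allowance α c is also 0, so no amplification can be paid for, and there is no bit
-- in which to announce an early output. Instead n is kept and the error is reproduced exactly.
silent : ∀ {n r} .{{_ : ℕ.NonZero n}} (T : Tree n 0 r) (r′ : ℕ) → ∃[ Q ] error {n} {r′} {0} Q ≡ treeError T
silent {n} T r′ = go (collapse T) (run-collapse T)
  where
  go : ∀ t → (∀ x y → runTree T x y ≡ runCollapsed t x y) → ∃[ Q ] error {n} {r′} {0} Q ≡ treeError T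
  go (inj₁ f) eq = protocol alice (output f) , trans (error≡treeError {n} {0} {r′} alice (output f))
    (E-cong (inputs n) λ x → E-cong (inputs n) λ y → cong (λ b → wrong b (EE x y)) (sym (eq x y)))
  go (inj₂ f) eq = protocol bob (output f) , trans (error≡treeError {n} {0} {r′} bob (output f))
    (trans (E-swap (inputs n) (inputs n) λ x y → wrong (f x) (EE x y))
      (E-cong (inputs n) λ y → E-cong (inputs n) λ x → trans (cong (wrong (f x)) (EE-sym x y)) (cong (λ b → wrong b (EE y x)) (sym (eq y x)))))

-- For n = 1 the alphabet has four letters; in this encoding the receiver looks up the bit at the
-- position of its own letter.
oneHot : Input 1 → Vec Bool 4
oneHot x = Vec.tabulate λ i → does (Vec.head x Fin.≟ i)

singleton : ∀ r → Tree 1 4 (suc r)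
singleton r = send oneHot λ m → output λ y → lookup m (Vec.head y)

run-singleton : ∀ r x y → runTree (singleton r) x y ≡ EE x y
run-singleton r (i ∷ []) (j ∷ []) = trans (lookup∘tabulate (λ k → does (i Fin.≟ k)) j) (go (does (i Fin.≟ j)))
  where
  go : ∀ b → b ≡ b ∨ false
  go false = refl
  go true  = refl

singleton-error : ∀ r → treeError (singleton r) ≡ 0ℚ
singleton-error r = trans (E-cong I λ x → trans (E-cong I λ y → trans (cong (λ b → wrong b (EE x y)) (run-singleton r x y)) (wrong-refl (EE x y))) (E-const I 0ℚ)) (E-const I 0ℚ)
  where
  I = inputs 1
  wrong-refl : ∀ b → wrong b b ≡ 0ℚ
  wrong-refl false = refl
  wrong-refl true  = refl

reply : ∀ {X Y c} → ExactTree X Y c 0 → X → Bool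
reply (output f) = f

run-reply : ∀ {X Y c} (T : ExactTree X Y c 0) (x : X) (y : Y) → runExact T x y ≡ reply T x
run-reply (output f) x y = refl

-- 4800 = 32 · 75 · 2: the factor 32^(4n) = 2^(20n) demanded of M, the value 75 of nθτ, and m ≤ 2(m
-- - 1).
β : ℚ
β = + 1 / 4800

β*4800 : ∀ q → fromℕ 4800 * (β * q) ≡ q
β*4800 q = trans (sym (*-assoc (fromℕ 4800) β q)) (*-identityˡ q)

0<β : 0ℚ < β
0<β = positive⁻¹ β

sizeBound-self : ∀ n c → SizeBound β n c n
sizeBound-self n c = begin
  (β * N) ^ℚ (4 ℕ.* n)                                ≤⟨ ^-mono (4 ℕ.* n) (0≤* (<⇒≤ 0<β) (0≤fromℕ n)) (≤-trans (*-monoʳ (0≤fromℕ n) (≤! β 1ℚ)) (≤-reflexive (*-identityˡ N))) ⟩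
  N ^ℚ (4 ℕ.* n)   ≡⟨ *-identityʳ _ ⟨
  N ^ℚ (4 ℕ.* n) * 1ℚ                                 ≤⟨ *-monoˡ (0≤^ (4 ℕ.* n) (0≤fromℕ n)) (1≤fromℕ (2 ℕ.^ (5 ℕ.* c)) {{ℕ.m^n≢0 2 (5 ℕ.* c)}}) ⟩
  N ^ℚ (4 ℕ.* n) * fromℕ (2 ℕ.^ (5 ℕ.* c))            ∎
  where N = fromℕ n

-- For P the size bound this yields an admissible size m ≥ 2 whose predecessor is inadmissible: the
-- first is part of the claim, the second makes M large.
threshold : {P : ℕ → Set} → (∀ k → Dec (P k)) → ¬ P 1 → ∀ k → P (suc k) → ∃[ j ] (¬ P (suc j)) × P (suc (suc j))
threshold {P} P? ¬P1 zero    p = contradiction p ¬P1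
threshold {P} P? ¬P1 (suc k) p = go (P? (suc k))
  where
  go : Dec (P (suc k)) → ∃[ j ] (¬ P (suc j)) × P (suc (suc j))
  go (yes q) = threshold P? ¬P1 k q
  go (no ¬q) = k , ¬q , p

<½nlog⇒2≤n : ∀ c n → c <½nlog n → 2 ℕ.≤ n
<½nlog⇒2≤n c zero          p = contradiction p (ℕ.≤⇒≯ (ℕ.m^n>0 2 (2 ℕ.* c)))
<½nlog⇒2≤n c (suc zero)    p = contradiction p (ℕ.≤⇒≯ (ℕ.m^n>0 2 (2 ℕ.* c)))
<½nlog⇒2≤n c (suc (suc n)) p = ℕ.s≤s (ℕ.s≤s ℕ.z≤n)

<½nlog⇒2^[c+2]≤ : ∀ c n → c <½nlog n → fromℕ 2 ^ℚ (c ℕ.+ 2) ≤ fromℕ (4 ℕ.* n) ^ℚ n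
<½nlog⇒2^[c+2]≤ c n p = begin
  fromℕ 2 ^ℚ (c ℕ.+ 2)              ≡⟨ ^-homo-* (fromℕ 2) c 2 ⟩
  fromℕ 2 ^ℚ c * fromℕ 4 ^ℚ 1       ≤⟨ *-mono (0≤^ c (0≤fromℕ 2)) (0≤^ n (0≤fromℕ 4)) 2^c≤N^n (^-mono-exp (1≤fromℕ 4) 1≤n) ⟩
  fromℕ n ^ℚ n * fromℕ 4 ^ℚ n       ≡⟨ *-comm (fromℕ n ^ℚ n) (fromℕ 4 ^ℚ n) ⟩
  fromℕ 4 ^ℚ n * fromℕ n ^ℚ n       ≡⟨ ^-distrib-* (fromℕ 4) (fromℕ n) n ⟨
  (fromℕ 4 * fromℕ n) ^ℚ n          ≡⟨ cong (_^ℚ n) (fromℕ-* 4 n) ⟨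
  fromℕ (4 ℕ.* n) ^ℚ n              ∎
  where
  1≤n : 1 ℕ.≤ n
  1≤n = ℕ.≤-trans (ℕ.s≤s ℕ.z≤n) (<½nlog⇒2≤n c n p)
  2^c≤N^n : fromℕ 2 ^ℚ c ≤ fromℕ n ^ℚ n
  2^c≤N^n = begin
    fromℕ 2 ^ℚ c        ≡⟨ fromℕ-^ 2 c ⟨
    fromℕ (2 ℕ.^ c)     ≤⟨ fromℕ-mono (ℕ.≤-trans (ℕ.^-monoʳ-≤ 2 (ℕ.m≤m+n c (c ℕ.+ 0))) (ℕ.<⇒≤ p)) ⟩
    fromℕ (n ℕ.^ n)     ≡⟨ fromℕ-^ n n ⟩
    fromℕ n ^ℚ n        ∎

-- The size bound at 1 says βn ≤ 2^(5c/4n), and the bound on c makes the right side at most n^(5/8).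
-- Hence (βn)⁸ ≤ n⁵, which bounds n; eighth powers clear the fractions.
module Small (n c : ℕ) .{{n≢0 : ℕ.NonZero n}} (c<½nlog : c <½nlog n) (size : SizeBound β n c 1) where

  private
    N x : ℚ
    N = fromℕ n
    x = β * N
    0≤N = 0≤fromℕ n
    0≤x : 0ℚ ≤ x
    0≤x = 0≤* (<⇒≤ 0<β) 0≤N

    x^8≤N^5 : x ^ℚ 8 ≤ N ^ℚ 5
    x^8≤N^5 = ^-cancel-≤ n (0≤^ 5 0≤N) (begin
      (x ^ℚ 8) ^ℚ n                               ≡⟨ ^-assocʳ x 8 n ⟩
      x ^ℚ (8 ℕ.* n)                              ≡⟨ cong (x ^ℚ_) (trans (ℕ.*-assoc 2 4 n) (ℕ.*-comm 2 (4 ℕ.* n))) ⟩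
      x ^ℚ ((4 ℕ.* n) ℕ.* 2)                      ≡⟨ ^-assocʳ x (4 ℕ.* n) 2 ⟨
      (x ^ℚ (4 ℕ.* n)) ^ℚ 2                       ≤⟨ ^-mono 2 (0≤^ (4 ℕ.* n) 0≤x) size ⟩
      (1ℚ ^ℚ (4 ℕ.* n) * fromℕ (2 ℕ.^ (5 ℕ.* c))) ^ℚ 2 ≡⟨ cong (_^ℚ 2) size-rhs ⟩
      (fromℕ 2 ^ℚ (5 ℕ.* c)) ^ℚ 2                 ≡⟨ ^-assocʳ (fromℕ 2) (5 ℕ.* c) 2 ⟩
      fromℕ 2 ^ℚ ((5 ℕ.* c) ℕ.* 2)                ≡⟨ cong (fromℕ 2 ^ℚ_) exponent ⟩
      fromℕ 2 ^ℚ ((2 ℕ.* c) ℕ.* 5)                ≡⟨ ^-assocʳ (fromℕ 2) (2 ℕ.* c) 5 ⟨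
      (fromℕ 2 ^ℚ (2 ℕ.* c)) ^ℚ 5                 ≤⟨ ^-mono 5 (0≤^ (2 ℕ.* c) (0≤fromℕ 2)) 2^2c≤N^n ⟩
      (N ^ℚ n) ^ℚ 5                               ≡⟨ ^-assocʳ N n 5 ⟩
      N ^ℚ (n ℕ.* 5)                              ≡⟨ cong (N ^ℚ_) (ℕ.*-comm n 5) ⟩
      N ^ℚ (5 ℕ.* n)                              ≡⟨ ^-assocʳ N 5 n ⟨
      (N ^ℚ 5) ^ℚ n                               ∎)
      where
      size-rhs : 1ℚ ^ℚ (4 ℕ.* n) * fromℕ (2 ℕ.^ (5 ℕ.* c)) ≡ fromℕ 2 ^ℚ (5 ℕ.* c)
      size-rhs = trans (cong₂ _*_ (1^ (4 ℕ.* n)) (fromℕ-^ 2 (5 ℕ.* c))) (*-identityˡ (fromℕ 2 ^ℚ (5 ℕ.* c)))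
      exponent : (5 ℕ.* c) ℕ.* 2 ≡ (2 ℕ.* c) ℕ.* 5
      exponent = trans (ℕ.*-comm (5 ℕ.* c) 2) (trans (sym (ℕ.*-assoc 2 5 c)) (trans (ℕ.*-assoc 5 2 c) (ℕ.*-comm 5 (2 ℕ.* c))))
      2^2c≤N^n : fromℕ 2 ^ℚ (2 ℕ.* c) ≤ N ^ℚ n
      2^2c≤N^n = begin
        fromℕ 2 ^ℚ (2 ℕ.* c)      ≡⟨ fromℕ-^ 2 (2 ℕ.* c) ⟨
        fromℕ (2 ℕ.^ (2 ℕ.* c))   ≤⟨ fromℕ-mono (ℕ.<⇒≤ c<½nlog) ⟩
        fromℕ (n ℕ.^ n)           ≡⟨ fromℕ-^ n n ⟩
        N ^ℚ n                    ∎

    B : ℚ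
    B = fromℕ 4800 ^ℚ 8

    N≤B : N ≤ B
    N≤B = *-cancelˡ (0<^ 5 (0<fromℕ n)) (begin
      N ^ℚ 5 * N                  ≤⟨ *-monoˡ (0≤^ 5 0≤N) (≤-trans (≤-reflexive (sym (*-identityʳ N))) (*-monoˡ 0≤N (1≤^ 2 (1≤fromℕ n)))) ⟩
      N ^ℚ 5 * N ^ℚ 3             ≡⟨ ^-homo-* N 5 3 ⟨
      N ^ℚ 8                      ≡⟨ cong (_^ℚ 8) (β*4800 N) ⟨
      (fromℕ 4800 * x) ^ℚ 8       ≡⟨ ^-distrib-* (fromℕ 4800) x 8 ⟩
      B * x ^ℚ 8                  ≤⟨ *-monoˡ (0≤^ 8 (0≤fromℕ 4800)) x^8≤N^5 ⟩
      B * N ^ℚ 5                  ≡⟨ *-comm B (N ^ℚ 5) ⟩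
      N ^ℚ 5 * B                  ∎)

  64nε≤1 : ∀ {e} → 110 ℕ.≤ e → fromℕ 64 * fromℕ n * ½ ^ℚ e ≤ 1ℚ
  64nε≤1 {e} 110≤e = begin
    fromℕ 64 * N * ½ ^ℚ e                 ≤⟨ *-mono (0≤* (0≤fromℕ 64) 0≤N) (0≤^ 110 0≤½) 64N≤ (½^-antimono 110≤e) ⟩
    fromℕ 2 ^ℚ 110 * ½ ^ℚ 110             ≡⟨ trans (*-comm (fromℕ 2 ^ℚ 110) (½ ^ℚ 110)) (½^*2^ 110) ⟩
    1ℚ                                    ∎
    where
    64N≤ : fromℕ 64 * N ≤ fromℕ 2 ^ℚ 110
    64N≤ = begin
      -- 4800 ≤ 2^13 turns the bound 4800⁸ on n into 2^104, and 64 = 2^6 completes the exponent 110.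
      fromℕ 64 * N                        ≤⟨ *-monoˡ (0≤fromℕ 64) (≤-trans N≤B (^-mono 8 (0≤fromℕ 4800) (≤! (fromℕ 4800) (fromℕ 2 ^ℚ 13)))) ⟩
      fromℕ 64 * (fromℕ 2 ^ℚ 13) ^ℚ 8     ≡⟨ cong (fromℕ 64 *_) (^-assocʳ (fromℕ 2) 13 8) ⟩
      fromℕ 2 ^ℚ 6 * fromℕ 2 ^ℚ 104       ≡⟨ ^-homo-* (fromℕ 2) 6 104 ⟨
      fromℕ 2 ^ℚ 110                      ∎

-- M is chosen so that τ = 1/M and θ = 1/m give θ τ = 75/n; minimality of m makes M large.
module Large (n c k : ℕ) .{{n≢0 : ℕ.NonZero n}} (¬size : ¬ SizeBound β n c (suc k)) where

  m : ℕ
  m = suc (suc k)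

  private
    N L : ℚ
    N = fromℕ n
    L = fromℕ (75 ℕ.* m)
    P : ℕ
    P = 4 ℕ.* n

    instance
      P≢0 : ℕ.NonZero P
      P≢0 = ℕ.m*n≢0 4 n

    0<L : 0ℚ < L
    0<L = 0<fromℕ (75 ℕ.* m) {{ℕ.m*n≢0 75 m}}

    0≤L = <⇒≤ 0<L
    0≤2 = 0≤fromℕ 2

  M : ℚ
  M = N * L ⁻¹

  private
    L*M : L * M ≡ N
    L*M = trans (x∙yz≈y∙xz L N (L ⁻¹)) (trans (cong (N *_) (*-⁻¹ 0<L)) (*-identityʳ N))

    0≤M : 0ℚ ≤ M
    0≤M = 0≤* (0≤fromℕ n) (0≤⁻¹ 0≤L)

  M-large : fromℕ 2 ^ℚ (5 ℕ.* c) * fromℕ 2 ^ℚ (20 ℕ.* n) ≤ M ^ℚ P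
  M-large = *-cancelˡ (0<^ P 0<L) (begin
    L ^ℚ P * (A * fromℕ 2 ^ℚ (20 ℕ.* n))              ≡⟨ cong (λ z → L ^ℚ P * (A * z)) (trans (cong (fromℕ 2 ^ℚ_) (ℕ.*-assoc 5 4 n)) (sym (^-assocʳ (fromℕ 2) 5 P))) ⟩
    L ^ℚ P * (A * fromℕ 32 ^ℚ P)                      ≡⟨ eq (L ^ℚ P) A (fromℕ 32 ^ℚ P) ⟩
    (fromℕ 32 ^ℚ P * L ^ℚ P) * A                      ≡⟨ cong (_* A) (^-distrib-* (fromℕ 32) L P) ⟨
    (fromℕ 32 * L) ^ℚ P * A                           ≤⟨ *-monoʳ (0≤^ (5 ℕ.* c) 0≤2) (^-mono P (0≤* (0≤fromℕ 32) 0≤L) 32L≤) ⟩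
    (fromℕ 4800 * fromℕ (suc k)) ^ℚ P * A             ≡⟨ trans (cong (_* A) (^-distrib-* (fromℕ 4800) (fromℕ (suc k)) P)) (*-assoc (fromℕ 4800 ^ℚ P) _ A) ⟩
    fromℕ 4800 ^ℚ P * (fromℕ (suc k) ^ℚ P * A)        ≤⟨ *-monoˡ (0≤^ P (0≤fromℕ 4800)) (≤-trans (≤-reflexive (cong (fromℕ (suc k) ^ℚ P *_) (sym (fromℕ-^ 2 (5 ℕ.* c))))) (<⇒≤ (≰⇒> ¬size))) ⟩
    fromℕ 4800 ^ℚ P * (β * N) ^ℚ P                    ≡⟨ ^-distrib-* (fromℕ 4800) (β * N) P ⟨
    (fromℕ 4800 * (β * N)) ^ℚ P                       ≡⟨ cong (_^ℚ P) (trans (β*4800 N) (sym L*M)) ⟩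
    (L * M) ^ℚ P   ≡⟨ ^-distrib-* L M P ⟩
    L ^ℚ P * M ^ℚ P                                   ∎)
    where
    A = fromℕ 2 ^ℚ (5 ℕ.* c)
    eq : ∀ a b c → a * (b * c) ≡ (c * a) * b
    eq = solve-∀ ℚ-ring
    32L≤ : fromℕ 32 * L ≤ fromℕ 4800 * fromℕ (suc k)
    32L≤ = begin
      fromℕ 32 * L                        ≡⟨ fromℕ-* 32 (75 ℕ.* m) ⟨
      fromℕ (32 ℕ.* (75 ℕ.* m))           ≤⟨ fromℕ-mono (ℕ.≤-trans (ℕ.≤-reflexive (sym (ℕ.*-assoc 32 75 m)))
                                               (ℕ.≤-trans (ℕ.*-monoʳ-≤ 2400 m≤2k) (ℕ.≤-reflexive (sym (ℕ.*-assoc 2400 2 (suc k)))))) ⟩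
      fromℕ (4800 ℕ.* suc k)              ≡⟨ fromℕ-* 4800 (suc k) ⟩
      fromℕ 4800 * fromℕ (suc k)          ∎
      where
      m≤2k : m ℕ.≤ 2 ℕ.* suc k
      m≤2k = ℕ.+-mono-≤ (ℕ.s≤s (ℕ.z≤n {k})) (ℕ.≤-reflexive (sym (ℕ.+-identityʳ (suc k))))

  2≤M : fromℕ 2 ≤ M
  2≤M = ^-cancel-≤ P 0≤M (begin
    fromℕ 2 ^ℚ P   ≤⟨ ^-mono-exp (1≤fromℕ 2) (ℕ.*-monoˡ-≤ n (ℕ.m≤m+n 4 16)) ⟩
    fromℕ 2 ^ℚ (20 ℕ.* n)   ≡⟨ *-identityˡ _ ⟨
    1ℚ * fromℕ 2 ^ℚ (20 ℕ.* n)                                 ≤⟨ *-monoʳ (0≤^ (20 ℕ.* n) 0≤2) (1≤^ (5 ℕ.* c) (1≤fromℕ 2)) ⟩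
    fromℕ 2 ^ℚ (5 ℕ.* c) * fromℕ 2 ^ℚ (20 ℕ.* n)               ≤⟨ M-large ⟩
    M ^ℚ P                                                     ∎)

  1≤M : 1ℚ ≤ M
  1≤M = ≤-trans (≤! 1ℚ (fromℕ 2)) 2≤M

  private
    0<M : 0ℚ < M
    0<M = <-≤-trans 0<1 1≤M

  τ : ℚ
  τ = M ⁻¹

  0≤τ : 0ℚ ≤ τ
  0≤τ = 0≤⁻¹ 0≤M

  τM≤1 : τ * M ≤ 1ℚ
  τM≤1 = ⁻¹*≤1 0≤M

  τ≤½ : τ ≤ ½
  τ≤½ = *-cancelˡ (0<fromℕ 2) (begin
    fromℕ 2 * τ       ≤⟨ *-monoʳ 0≤τ 2≤M ⟩
    M * τ             ≡⟨ *-⁻¹ 0<M ⟩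
    1ℚ                ≡⟨⟩
    fromℕ 2 * ½       ∎)

  τ/m≡75/n : fromℕ m ⁻¹ * τ ≡ fromℕ 75 * N ⁻¹
  τ/m≡75/n = *-cancelˡ-≡ (0<fromℕ n) (begin-equality
    N * (fromℕ m ⁻¹ * τ)                          ≡⟨ cong (_* (fromℕ m ⁻¹ * τ)) (trans (sym L*M) (cong (_* M) (fromℕ-* 75 m))) ⟩
    fromℕ 75 * fromℕ m * M * (fromℕ m ⁻¹ * τ)     ≡⟨ eq (fromℕ 75) (fromℕ m) M (fromℕ m ⁻¹) τ ⟩
    fromℕ 75 * (fromℕ m * fromℕ m ⁻¹) * (M * τ)   ≡⟨ cong₂ (λ a b → fromℕ 75 * a * b) (*-⁻¹ (0<fromℕ m)) (*-⁻¹ 0<M) ⟩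
    fromℕ 75 * 1ℚ * 1ℚ                            ≡⟨⟩
    fromℕ 75 * 1ℚ                                 ≡⟨ cong (fromℕ 75 *_) (*-⁻¹ (0<fromℕ n)) ⟨
    fromℕ 75 * (N * N ⁻¹)                         ≡⟨ x∙yz≈y∙xz (fromℕ 75) N (N ⁻¹) ⟩
    N * (fromℕ 75 * N ⁻¹)                         ∎)
    where
    eq : ∀ l m M m⁻¹ τ → l * m * M * (m⁻¹ * τ) ≡ l * (m * m⁻¹) * (M * τ)
    eq = solve-∀ ℚ-ring

-- The round elimination step

module Elimination (e : ℕ) (e-large : 11 ℕ.+ 2 ℕ.* κ 75 ℕ.≤ e) (110≤e : 110 ℕ.≤ e) where

  ε α : ℚ
  ε = ½ ^ℚ e
  α = fromℕ (blowup e)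

  0<ε : 0ℚ < ε
  0<ε = 0<^ e (positive⁻¹ ½)

  Conclusion : ℕ → ℕ → ℕ → Set
  Conclusion n c r = ∃[ n′ ] SizeBound β n c n′ × (∃[ c′ ] (fromℕ c′ ≤ α * fromℕ c) × (∃[ Q′ ] error {n′} {r} {c′} Q′ ≤ ε))

  ε-small : ε * (fromℕ 2048 * fromℕ 4 ^ℚ κ 75) ≤ 1ℚ
  ε-small = begin
    ε * (fromℕ 2048 * fromℕ 4 ^ℚ κ 75)                    ≡⟨ cong (λ z → ε * (fromℕ 2048 * z)) (^-assocʳ (fromℕ 2) 2 (κ 75)) ⟩
    ε * (fromℕ 2 ^ℚ 11 * fromℕ 2 ^ℚ (2 ℕ.* κ 75))         ≡⟨ cong (ε *_) (^-homo-* (fromℕ 2) 11 (2 ℕ.* κ 75)) ⟨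
    ε * fromℕ 2 ^ℚ (11 ℕ.+ 2 ℕ.* κ 75)                    ≤⟨ *-monoˡ (<⇒≤ 0<ε) (^-mono-exp (1≤fromℕ 2) e-large) ⟩
    ½ ^ℚ e * fromℕ 2 ^ℚ e                                 ≡⟨ ½^*2^ e ⟩
    1ℚ                                                    ∎

  4≤blowup : 4 ℕ.≤ blowup e
  4≤blowup = ℕ.*-mono-≤ (ℕ.s≤s (ℕ.z≤n {2 ℕ.+ e})) (ℕ.*-mono-≤ (ℕ.m^n>0 4 (depth e)) (ℕ.m≤m+n 4 12))

  module _ (n c r : ℕ) .{{n≢0 : ℕ.NonZero n}} (c<½nlog : suc c <½nlog n)
           (msg : Input n → Vec Bool (suc c)) (k : Vec Bool (suc c) → ExactTree (Input n) (Input n) (suc c) r)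
           (error≤ : (E (inputs n) λ x → E (inputs n) λ y → wrong (runExact (k (msg x)) y x) (EE x y)) ≤ ε) where

    open Message msg k 0<ε error≤

    large : ∀ j → ¬ SizeBound β n (suc c) (suc j) → SizeBound β n (suc c) (suc (suc j)) → Conclusion n (suc c) r
    large j ¬size size = m , size , blowup e ℕ.* suc c , ≤-reflexive (fromℕ-* (blowup e) (suc c)) , conclude (Assemble.assembled level accept-level reject-level (levels e) (depth e) (levels-depth-small e))
      where
      open Large n (suc c) j ¬size
      open Reduction n m (suc c) 75 (<½nlog⇒2≤n (suc c) n c<½nlog) ℕ.≤-refl τ M 0≤τ τ≤½ τM≤1 1≤M τ/m≡75/n M-large
        sender sender-0∨1 sender-mass (k message) ε (<⇒≤ 0<ε) sender-error ε-small
      conclude : ∃[ T ] treeError {m} {levels e ℕ.* sharpenBits (depth e) (sharpenBits 2 (suc c))} {r} T ≤ ε →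
        ∃[ Q′ ] error {m} {r} {blowup e ℕ.* suc c} Q′ ≤ ε
      conclude p = let (T , T≤ε) = subst (λ b → ∃[ T ] treeError {m} {b} {r} T ≤ ε) (bits≡ e (suc c)) p in
        protocol alice T , ≤-trans (≤-reflexive (error≡treeError alice T)) T≤ε

  small : ∀ n c r .{{n≢0 : ℕ.NonZero n}} → suc c <½nlog n →
    (msg : Input n → Vec Bool (suc c)) (k : Vec Bool (suc c) → ExactTree (Input n) (Input n) (suc c) r) →
    (E (inputs n) λ x → E (inputs n) λ y → wrong (runExact (k (msg x)) y x) (EE x y)) ≤ ε →
    SizeBound β n (suc c) 1 → Conclusion n (suc c) r
  small n c zero c<½nlog msg k error≤ size = ⊥-elim (OneRound.impossible n (suc c) sender sender-0∨1 (reply (k message)) ε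
    (≤-trans (≤-reflexive (E-cong I λ x → E-cong I λ y → cong (λ b → sender x * wrong b (EE x y)) (sym (run-reply (k message) y x)))) sender-error)
    sender-mass (<½nlog⇒2^[c+2]≤ (suc c) n c<½nlog) (Small.64nε≤1 n (suc c) c<½nlog size 110≤e))
    where
    I = inputs n
    open Message msg k 0<ε error≤
  small n c (suc r) c<½nlog msg k error≤ size = 1 , size , 4 ,
    -- The message length is positive here, so α times it leaves room for the four bits.
    ≤-trans (fromℕ-mono (ℕ.*-mono-≤ 4≤blowup (ℕ.s≤s (ℕ.z≤n {c})))) (≤-reflexive (fromℕ-* (blowup e) (suc c))) ,
    protocol alice (singleton r) , ≤-trans (≤-reflexive (trans (error≡treeError alice (singleton r)) (singleton-error r))) (<⇒≤ 0<ε)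

  speaking : ∀ n c r .{{n≢0 : ℕ.NonZero n}} → suc c <½nlog n → (T : ExactTree (Input n) (Input n) (suc c) (suc r)) →
    (E (inputs n) λ x → E (inputs n) λ y → wrong (runExact T x y) (EE x y)) ≤ ε → Conclusion n (suc c) r
  speaking zero    c r c<½nlog (send msg k) error≤ = contradiction (<½nlog⇒2≤n (suc c) 0 c<½nlog) λ ()
  speaking (suc n) c r c<½nlog (send msg k) error≤ = go (size? 1)
    where
    size? : ∀ j → Dec (SizeBound β (suc n) (suc c) j)
    size? j = _ ≤? _
    go : Dec (SizeBound β (suc n) (suc c) 1) → Conclusion (suc n) (suc c) r
    go (yes size) = small (suc n) c r c<½nlog msg k error≤ size
    -- The size n itself always satisfies the bound, so a crossing between 1 and n exists.
    go (no ¬size) = let (j , ¬size′ , size′) = threshold size? ¬size n (sizeBound-self (suc n) (suc c)) in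
      large (suc n) c r c<½nlog msg k error≤ j ¬size′ size′

  eliminate : ∀ r c n .{{n≢0 : ℕ.NonZero n}} → c <½nlog n → (Q : Protocol n (suc r) c) → error Q ≤ ε → Conclusion n c r
  eliminate r zero n c<½nlog (protocol p T) error≤ = let (Q′ , eq) = silent T r in
    n , sizeBound-self n 0 , 0 , ≤-reflexive (sym (*-zeroʳ α)) , Q′ ,
    ≤-trans (≤-reflexive (trans eq (sym (error≡treeError p T)))) error≤
  eliminate r (suc c) n c<½nlog (protocol p T) error≤ = speaking n c r c<½nlog (exact T)
    (≤-trans (≤-reflexive (trans (E-cong (inputs n) λ x → E-cong (inputs n) λ y → cong (λ b → wrong b (EE x y)) (run-exact T x y)) (sym (error≡treeError p T)))) error≤)

abstract
  -- 2¹¹ 4^κ ≤ 2^e₀ serves the main case, 64 · 4800⁸ ≤ 2¹¹⁰ ≤ 2^e₀ the case of bounded n.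
  e₀ : ℕ
  e₀ = 110 ℕ.+ (11 ℕ.+ 2 ℕ.* κ 75)

  κ≤e₀ : 11 ℕ.+ 2 ℕ.* κ 75 ℕ.≤ e₀
  κ≤e₀ = ℕ.m≤n+m (11 ℕ.+ 2 ℕ.* κ 75) 110

  110≤e₀ : 110 ℕ.≤ e₀
  110≤e₀ = ℕ.m≤m+n 110 (11 ℕ.+ 2 ℕ.* κ 75)

open Elimination e₀ κ≤e₀ 110≤e₀

lemma11 : ∃[ ε₀ ] ∃[ α ] ∃[ β ]
    (0ℚ < ε₀) × (ε₀ < + 1 / 200) × (0ℚ < α) × (0ℚ < β) ×
    (∀ (r c n : ℕ) → r > 0 → c <½nlog n →
    (∃[ Q ] error {n} {r} {c} Q ≤ ε₀) →
    ∃[ n′ ] SizeBound β n c n′ ×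
    (∃[ c′ ] (fromℕ c′ ≤ α * fromℕ c) ×
    (∃[ Q′ ] error {n′} {r ∸ 1} {c′} Q′ ≤ ε₀)))
lemma11 = ε , α , β , 0<ε , ε<1/200 , 0<α , 0<β , eliminateAll
  where
  ε<1/200 : ε < + 1 / 200
  ε<1/200 = ≤-<-trans (½^-antimono (ℕ.≤-trans (ℕ.m≤m+n 8 102) 110≤e₀)) (toWitness {a? = ½ ^ℚ 8 <? + 1 / 200} tt)
  0<α : 0ℚ < α
  0<α = <-≤-trans (0<fromℕ 4) (fromℕ-mono 4≤blowup)
  eliminateAll : ∀ (r c n : ℕ) → r > 0 → c <½nlog n → (∃[ Q ] error {n} {r} {c} Q ≤ ε) →
    ∃[ n′ ] SizeBound β n c n′ × (∃[ c′ ] (fromℕ c′ ≤ α * fromℕ c) × (∃[ Q′ ] error {n′} {r ∸ 1} {c′} Q′ ≤ ε))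
  eliminateAll (suc r) c zero    r>0 c<½nlog (Q , p) = contradiction (<½nlog⇒2≤n c 0 c<½nlog) λ ()
  eliminateAll (suc r) c (suc n) r>0 c<½nlog (Q , p) = eliminate r c (suc n) c<½nlog Q p
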